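{- The number $C'(2,n)$ of colored 2-ball prime juggling patterns of period $n$ satisfies $C'(2,n)\sim\gamma_{C'}\,n\,2^n$ as $n\to\infty$, where $$\gamma_{C'}=\frac12\sum_{t=1}^\infty t\,q_t^2=\frac18\sum_{t=1}^\infty t\left(\prod_{i=2}^t\frac{i-1}{2^i-i-1}\right)^2\approx0.478326.$$
   Context: The two balls have distinct colors, orange and blue. A 2-ball colored state is an ordered pair $(x,y)$ of distinct positive integers (beats until the orange, resp. blue, ball lands). Transitions: from $(x,y)$ with $x,y\ge2$ only to $(x-1,y-1)$; from $(1,y)$ to $(z,y-1)$ for every positive integer $z\ne y-1$; from $(x,1)$ to $(x-1,z)$ for every positive integer $z\ne x-1$. A colored 2-ball prime juggling pattern of period $n$ is a directed cycle of length $n$ in this graph; two such cycles are regarded as the same pattern if one is obtained from the other by a cyclic rotation and/or by interchanging the two colors. $C'(2,n)$ is the number of such patterns. $q_t=\frac12\prod_{i=2}^t\frac{i-1}{2^i-i-1}$. -}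

module Defs where

open import Data.Nat using (ℕ; zero; suc; _+_; _*_; _∸_; _^_; _≡ᵇ_; _<ᵇ_)
open import Data.Bool using (Bool; true; false; _∧_; _∨_; not; if_then_else_)
open import Data.Product using (_×_; _,_; proj₁; proj₂)
open import Data.List using (List; []; _∷_; map; concatMap; applyUpTo; upTo; drop; take; _++_; length; foldr)
open import Data.Integer using (+_)
open import Data.Rational as ℚ using (ℚ; _/_)

-- Colored 2-ball states: ordered pairs (x , y) of distinct positive
-- integers (x = beats until orange lands, y = beats until blue lands).

State : Set
State = ℕ × ℕ

validᵇ : State → Bool
validᵇ (x , y) = (0 <ᵇ x) ∧ (0 <ᵇ y) ∧ not (x ≡ᵇ y)

-- Edge relation of the state graph (both endpoints assumed valid).
--  (x,y), x,y ≥ 2  → (x-1,y-1)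
--  (1,y)           → (z,y-1) for every positive z ≠ y-1
--  (x,1)           → (x-1,z) for every positive z ≠ x-1
stepᵇ : State → State → Bool
stepᵇ (x , y) (x' , y') =
  validᵇ (x , y) ∧ validᵇ (x' , y') ∧
  ( ((1 <ᵇ x) ∧ (1 <ᵇ y) ∧ (x' ≡ᵇ x ∸ 1) ∧ (y' ≡ᵇ y ∸ 1))
  ∨ ((x ≡ᵇ 1) ∧ (y' ≡ᵇ y ∸ 1))
  ∨ ((y ≡ᵇ 1) ∧ (x' ≡ᵇ x ∸ 1)) )
  -- in the last two cases z ≠ y-1 (resp. z ≠ x-1) and z ≥ 1 are
  -- exactly validity of the target state.

eqStateᵇ : State → State → Bool
eqStateᵇ (x , y) (x' , y') = (x ≡ᵇ x') ∧ (y ≡ᵇ y')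

allᵇ : {A : Set} → (A → Bool) → List A → Bool
allᵇ p []       = true
allᵇ p (a ∷ as) = p a ∧ allᵇ p as

elemᵇ : State → List State → Bool
elemᵇ s []       = false
elemᵇ s (t ∷ ts) = eqStateᵇ s t ∨ elemᵇ s ts

distinctᵇ : List State → Bool
distinctᵇ []       = true
distinctᵇ (s ∷ ss) = not (elemᵇ s ss) ∧ distinctᵇ ss

chainᵇ : State → List State → Bool
chainᵇ first []            = true
chainᵇ first (s ∷ [])      = stepᵇ s first
chainᵇ first (s ∷ t ∷ ss)  = stepᵇ s t ∧ chainᵇ first (t ∷ ss)

closedWalkᵇ : List State → Bool
closedWalkᵇ []       = false
closedWalkᵇ (s ∷ ss) = chainᵇ s (s ∷ ss)

isCycleᵇ : ℕ → List State → Bool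
isCycleᵇ n ss = (length ss ≡ᵇ n) ∧ allᵇ validᵇ ss ∧ distinctᵇ ss ∧ closedWalkᵇ ss

rotate : ℕ → List State → List State
rotate k ss = drop k ss ++ take k ss

swapColors : List State → List State
swapColors = map (λ { (x , y) → (y , x) })

leqStateLexᵇ : List State → List State → Bool
leqStateLexᵇ []             _              = true
leqStateLexᵇ (_ ∷ _)        []             = false
leqStateLexᵇ ((x , y) ∷ ss) ((x' , y') ∷ ts) =
  (x <ᵇ x') ∨ ((x ≡ᵇ x') ∧ ((y <ᵇ y') ∨ ((y ≡ᵇ y') ∧ leqStateLexᵇ ss ts)))

-- ss is the lexicographically least member of its orbit under
-- rotations and color interchange: one representative per pattern.
canonicalᵇ : ℕ → List State → Bool
canonicalᵇ n ss =
  allᵇ (λ k → leqStateLexᵇ ss (rotate k ss) ∧ leqStateLexᵇ ss (rotate k (swapColors ss)))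
       (upTo n)

-- Finite enumeration. In a cycle of length n every coordinate is ≤ n
-- (a coordinate decreases by one per beat until it reaches 1, and the
-- walk returns to its start after n beats), so it suffices to enumerate
-- states with coordinates in {1,…,n}.

range1 : ℕ → List ℕ
range1 n = applyUpTo suc n

statesUpTo : ℕ → List State
statesUpTo n = concatMap (λ x → map (λ y → (x , y)) (range1 n)) (range1 n)

seqs : ℕ → List State → List (List State)
seqs zero    A = [] ∷ []
seqs (suc k) A = concatMap (λ a → map (a ∷_) (seqs k A)) A

countᵇ : {A : Set} → (A → Bool) → List A → ℕ
countᵇ p []       = 0
countᵇ p (a ∷ as) = if p a then suc (countᵇ p as) else countᵇ p as

C′ : ℕ → ℕ
C′ n = countᵇ (λ ss → isCycleᵇ n ss ∧ canonicalᵇ n ss) (seqs n (statesUpTo n))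

-- q_t = 1/2 ∏_{i=2}^t (i-1)/(2^i - i - 1)   (rational).
-- For i ≥ 2 we have 2^i ≥ i + 2, so 2^i - i - 1 = suc (2^i ∸ (i + 2)).

factor : ℕ → ℚ
factor i = (+ (i ∸ 1)) / suc (2 ^ i ∸ (i + 2))

prodFactors : ℕ → ℚ
prodFactors zero          = ℚ.1ℚ
prodFactors (suc zero)    = ℚ.1ℚ
prodFactors (suc (suc k)) = prodFactors (suc k) ℚ.* factor (suc (suc k))

q : ℕ → ℚ
q t = ℚ.½ ℚ.* prodFactors t

fromℕℚ : ℕ → ℚ
fromℕℚ k = (+ k) / 1

γpartial : ℕ → ℚ
γpartial zero    = ℚ.0ℚ
γpartial (suc T) = γpartial T ℚ.+ ℚ.½ ℚ.* (fromℕℚ (suc T) ℚ.* (q (suc T) ℚ.* q (suc T)))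

n2ⁿ : ℕ → ℚ
n2ⁿ n = fromℕℚ (n * 2 ^ n)

-- A state (x , y) lies on the diagonal y − x, and a closed walk with distinct states
-- meets every diagonal in at most one segment.  So a cycle is a cyclic sequence of
-- distinct nonzero integers in which a positive entry is followed by a smaller positive
-- one or by any negative one, and symmetrically: maximal positive and negative runs
-- alternate, and the period is the sum of the maxima of |·| over the runs.
--
-- Write a_t(m) for the number of lists of t disjoint finite sets of positive integers,
-- the sum of their maxima being m, in which the first set has the largest maximum.
-- Adding the integer 1 last gives
--   a_t(m) = (t + 1) a_t(m − t) + (t − 1) a_{t−1}(m − t)   (t ≥ 2),
-- so that b_t(m) = a_t(m) / 2^m ≤ q_t, and Σ_m (q_t − b_t(m)) < ∞ by the same recursion.
-- Rotating a cycle so that its largest positive diagonal comes first shows that there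
-- are E(n) = Σ_t Σ_m t a_t(m) a_t(n − m) cycles of length n up to rotation, whence
-- E(n) / 2^n = n Σ_t t q_t² + o(n).  Interchanging the colors identifies them in pairs,
-- except for the cycles h ++ swap h; as every state has at most three predecessors,
-- there are only O(n² 3^{n/2}) = O(2^n) of those.

module Submission where

-- Adding 1 last means: raise every entry by one, then leave 1 out, put it at the end of one of the
-- t runs, or make it a run of its own. The first two kinds give t + 1 choices. The third gives t -
-- 1 for t ≥ 2, as the singleton cannot be the dominating first run. Raising the maxima, plus the
-- new 1 if there is one, costs t. After division by 2^m the value q_t is the fixed point: (2^t - t
-- - 1) q_t = (t - 1) q_{t-1}.
--
-- The factor t in E(n) arises because rotating a cycle normalises only its positive runs; the
-- negative family stays unrestricted, and unrestricted families are t times as many.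
--
-- No quotient by the color swap is formed. Twice C′ is squeezed between the number of codes and
-- that number plus the size of a list covering the symmetric cycles, each time by an injection out
-- of a duplicate-free list. An error O(2^n) is harmless against n 2^n, so the covering list may be
-- crude.
--
-- The upper bound uses b_t ≤ q_t for all t at once. The bound on Σ_m (q_t - b_t(m)) is obtained for
-- each t separately, so the lower bound keeps finitely many t and leaves the rest to the geometric
-- tail of Σ t q_t².

-- Duplicate-free lists, comparison of lengths, and rotations.

module ListCounting where
  open import Defs using (countᵇ)
  open import Data.Nat using (ℕ; zero; suc; _+_; _*_; _≤_; _<_; z≤n; s≤s)
  open import Data.Nat.Properties
  open import Data.Bool using (Bool; true; false; T?)
  open import Data.Product using (∃; ∃₂; _×_; _,_)
  open import Data.Sum using (_⊎_; inj₁; inj₂)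
  open import Data.Empty using (⊥; ⊥-elim)
  open import Data.List using (List; []; _∷_; _++_; map; length; filter; concatMap;
      cartesianProduct)
  open import Data.List.Properties using (length-map; length-++; ++-assoc; ++-identityʳ; map-++;
      ∷-injective; ∷-injectiveʳ)
  open import Data.List.Relation.Binary.Permutation.Propositional using (_↭_)
  open import Data.List.Relation.Binary.Permutation.Propositional.Properties using (++-comm)
  open import Data.List.Membership.Propositional using (_∈_; _∉_)
  open import Data.List.Membership.Propositional.Properties
    using (∈-∃++; ∈-++⁺ˡ; ∈-++⁺ʳ; ∈-++⁻)
  open import Data.List.Relation.Unary.Any using (here; there)
  open import Data.List.Relation.Unary.All as All using (All; []; _∷_)
  open import Data.List.Relation.Unary.AllPairs using ([]; _∷_)
  open import Data.List.Relation.Unary.Unique.Propositional using (Unique)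
  import Data.List.Relation.Unary.Unique.Propositional.Properties as Unq
  open import Relation.Binary.PropositionalEquality
  open import Function using (_∘_)

  private variable
    A B : Set

  Unique-∉ : {x : A} {xs : List A} → Unique (x ∷ xs) → x ∉ xs
  Unique-∉ (px ∷ _) x∈ = All.lookup px x∈ refl

  ∉-Unique : {x : A} {xs : List A} → x ∉ xs → Unique xs → Unique (x ∷ xs)
  ∉-Unique x∉ u = All.tabulate (λ y∈ x≡y → x∉ (subst (_∈ _) (sym x≡y) y∈)) ∷ u

  Unique-tail : {x : A} {xs : List A} → Unique (x ∷ xs) → Unique xs
  Unique-tail (_ ∷ u) = u

  Unique-++⁻ : (xs : List A) {ys : List A} → Unique (xs ++ ys) →
    Unique xs × Unique ys × (∀ {x} → x ∈ xs → x ∉ ys)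
  Unique-++⁻ [] u = [] , u , λ ()
  Unique-++⁻ (x ∷ xs) u with Unique-++⁻ xs (Unique-tail u)
  ... | uxs , uys , d = ∉-Unique (λ x∈ → Unique-∉ u (∈-++⁺ˡ x∈)) uxs , uys , disj
    where
    disj : ∀ {y} → y ∈ (x ∷ xs) → y ∉ _
    disj (here refl) y∈ = Unique-∉ u (∈-++⁺ʳ xs y∈)
    disj (there y∈xs) y∈ = d y∈xs y∈

  -- Induction on `xs`: the chosen partner of the head is cut out of `ys`, and injectivity keeps the
  -- partners of the tail away from it. A relation rather than a function is used because the
  -- assignments below come with existential witnesses.
  injection⇒≤ : (R : A → B → Set) (xs : List A) (ys : List B) → Unique xs →
    (∀ {x} → x ∈ xs → ∃ λ y → y ∈ ys × R x y) →
    (∀ {x x′ y} → x ∈ xs → x′ ∈ xs → R x y → R x′ y → x ≡ x′) →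
    length xs ≤ length ys
  injection⇒≤ R [] ys u tot inj = z≤n
  injection⇒≤ R (x ∷ xs) ys u tot inj with tot (here refl)
  ... | y , y∈ , r with ∈-∃++ y∈
  ... | as , bs , refl = subst (suc (length xs) ≤_) len
          (s≤s (injection⇒≤ R xs (as ++ bs) (Unique-tail u) tot′ (λ p q → inj (there p) (there q))))
    where
    len : suc (length (as ++ bs)) ≡ length (as ++ y ∷ bs)
    len = trans (cong suc (length-++ as)) (trans (sym (+-suc (length as) (length bs)))
        (sym (length-++ as)))
    tot′ : ∀ {x′} → x′ ∈ xs → ∃ λ y′ → y′ ∈ (as ++ bs) × R x′ y′
    tot′ {x′} x′∈ with tot (there x′∈)
    ... | y′ , y′∈ , r′ with ∈-++⁻ as y′∈
    ... | inj₁ p = y′ , ∈-++⁺ˡ p , r′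
    ... | inj₂ (there p) = y′ , ∈-++⁺ʳ as p , r′
    ... | inj₂ (here refl) =
      ⊥-elim (Unique-∉ u (subst (_∈ xs) (sym (inj (here refl) (there x′∈) r r′)) x′∈))

  countᵇ≡length-filter : (p : A → Bool) (xs : List A) →
    countᵇ p xs ≡ length (filter (T? ∘ p) xs)
  countᵇ≡length-filter p [] = refl
  countᵇ≡length-filter p (x ∷ xs) with p x
  ... | true  = cong suc (countᵇ≡length-filter p xs)
  ... | false = countᵇ≡length-filter p xs

  collect : (ℕ → List A) → ℕ → List A
  collect f zero    = []
  collect f (suc n) = collect f n ++ f n

  ∈-collect⁺ : (f : ℕ → List A) {n i : ℕ} {x : A} → i < n → x ∈ f i → x ∈ collect f n
  ∈-collect⁺ f {suc n} {i} i<n x∈ with m≤n⇒m<n∨m≡n i<n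
  ... | inj₁ (s≤s i<n′) = ∈-++⁺ˡ (∈-collect⁺ f i<n′ x∈)
  ... | inj₂ refl = ∈-++⁺ʳ (collect f n) x∈

  ∈-collect⁻ : (f : ℕ → List A) (n : ℕ) {x : A} → x ∈ collect f n → ∃ λ i → i < n × x ∈ f i
  ∈-collect⁻ f (suc n) x∈ with ∈-++⁻ (collect f n) x∈
  ... | inj₂ p = n , n<1+n n , p
  ... | inj₁ p with ∈-collect⁻ f n p
  ... | i , i<n , q = i , m<n⇒m<1+n i<n , q

  Unique-collect : (f : ℕ → List A) (n : ℕ) → (∀ i → Unique (f i)) →
    (∀ {i j x} → x ∈ f i → x ∈ f j → i ≡ j) → Unique (collect f n)
  Unique-collect f zero u d = []
  Unique-collect f (suc n) u d = Unq.++⁺ (Unique-collect f n u d) (u n) disj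
    where
    disj : ∀ {x} → x ∈ collect f n × x ∈ f n → ⊥
    disj (p , q) with ∈-collect⁻ f n p
    ... | i , i<n , r = <-irrefl (d r q) i<n

  ∈-concatMap⁺ : (g : A → List B) {xs : List A} {x : A} {y : B} →
    x ∈ xs → y ∈ g x → y ∈ concatMap g xs
  ∈-concatMap⁺ g (here refl) q = ∈-++⁺ˡ q
  ∈-concatMap⁺ g {x′ ∷ _} (there p) q = ∈-++⁺ʳ (g x′) (∈-concatMap⁺ g p q)

  ∈-concatMap⁻ : (g : A → List B) (xs : List A) {y : B} →
    y ∈ concatMap g xs → ∃ λ x → x ∈ xs × y ∈ g x
  ∈-concatMap⁻ g (x ∷ xs) p with ∈-++⁻ (g x) p
  ... | inj₁ q = x , here refl , q
  ... | inj₂ q with ∈-concatMap⁻ g xs q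
  ... | x′ , r , t = x′ , there r , t

  Unique-concatMap : (f : A → List B) (xs : List A) → Unique xs →
    (∀ {x} → x ∈ xs → Unique (f x)) →
    (∀ {x x′ y} → x ∈ xs → x′ ∈ xs → y ∈ f x → y ∈ f x′ → x ≡ x′) →
    Unique (concatMap f xs)
  Unique-concatMap f [] u uf d = []
  Unique-concatMap {A} {B} f (x ∷ xs) u uf d =
    Unq.++⁺ (uf (here refl)) (Unique-concatMap f xs (Unique-tail u) (uf ∘ there)
        (λ p q → d (there p) (there q))) disj
    where
    disj : ∀ {y} → y ∈ f x × y ∈ concatMap f xs → ⊥
    disj (p , q) with ∈-concatMap⁻ f xs q
    ... | x′ , x′∈ , r = Unique-∉ u (subst (_∈ xs) (sym (d (here refl) (there x′∈) p r)) x′∈)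

  length-concatMap : (f : A → List B) (k : ℕ) (xs : List A) →
    (∀ {x} → x ∈ xs → length (f x) ≡ k) → length (concatMap f xs) ≡ length xs * k
  length-concatMap f k [] h = refl
  length-concatMap f k (x ∷ xs) h =
    trans (length-++ (f x)) (cong₂ _+_ (h (here refl)) (length-concatMap f k xs (h ∘ there)))

  Rot : List A → List A → Set
  Rot xs ys = ∃₂ λ u v → xs ≡ u ++ v × ys ≡ v ++ u

  Rot-refl : {xs : List A} → Rot xs xs
  Rot-refl {xs = xs} = [] , xs , refl , sym (++-identityʳ xs)

  Rot-sym : {xs ys : List A} → Rot xs ys → Rot ys xs
  Rot-sym (u , v , p , q) = v , u , q , p

  -- Of two cuts of one list, one lies to the left of the other; `e` is the stretch between them.
  ++-split : (a c : List A) {b d : List A} → a ++ b ≡ c ++ d →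
    (∃ λ e → a ≡ c ++ e × d ≡ e ++ b) ⊎ (∃ λ e → c ≡ a ++ e × b ≡ e ++ d)
  ++-split [] c p = inj₂ (c , refl , p)
  ++-split (x ∷ a) [] p = inj₁ (x ∷ a , refl , sym p)
  ++-split (x ∷ a) (y ∷ c) p with ∷-injective p
  ... | refl , p′ with ++-split a c p′
  ... | inj₁ (e , q , r) = inj₁ (e , cong (x ∷_) q , r)
  ... | inj₂ (e , q , r) = inj₂ (e , cong (x ∷_) q , r)

  Rot-trans : {xs ys zs : List A} → Rot xs ys → Rot ys zs → Rot xs zs
  Rot-trans (u , v , refl , refl) (w , z , p , refl) with ++-split v w p
  ... | inj₁ (e , refl , refl) = u ++ w , e , sym (++-assoc u w e) , ++-assoc e u w
  ... | inj₂ (e , refl , refl) = e , z ++ v , ++-assoc e z v , sym (++-assoc z v e)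

  Rot-map : (f : A → B) {xs ys : List A} → Rot xs ys → Rot (map f xs) (map f ys)
  Rot-map f (u , v , refl , refl) = map f u , map f v , map-++ f u v , map-++ f v u

  Rot-map⁻ : (f : A → B) {xs : List A} {zs : List B} → Rot (map f xs) zs →
    ∃ λ ys → zs ≡ map f ys × Rot xs ys
  Rot-map⁻ f {xs} (u , v , p , refl) with map-++⁻ xs u p
    where
    map-++⁻ : ∀ xs u {v} → map f xs ≡ u ++ v →
      ∃₂ λ a b → xs ≡ a ++ b × u ≡ map f a × v ≡ map f b
    map-++⁻ xs [] p = [] , xs , refl , refl , sym p
    map-++⁻ (x ∷ xs) (y ∷ u) p with ∷-injective p
    ... | refl , p′ with map-++⁻ xs u p′
    ... | a , b , refl , refl , r = x ∷ a , b , refl , refl , r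
  ... | a , b , refl , refl , refl = b ++ a , sym (map-++ f b a) , (a , b , refl , refl)

  Rot-↭ : {xs ys : List A} → Rot xs ys → xs ↭ ys
  Rot-↭ (u , v , refl , refl) = ++-comm u v

  -- A proper cut would bring a later entry to the front, so `x` would occur twice.
  Rot-head-injective : {x : A} {xs ys : List A} → Unique (x ∷ xs) → Rot (x ∷ xs) (x ∷ ys) → xs ≡ ys
  Rot-head-injective uq ([] , v , refl , q) =
    sym (trans (∷-injectiveʳ q) (++-identityʳ _))
  Rot-head-injective uq (x ∷ u , [] , p , refl) = trans (∷-injectiveʳ p) (++-identityʳ _)
  Rot-head-injective uq (x ∷ u , y ∷ v , refl , refl) = ⊥-elim (Unique-∉ uq (∈-++⁺ʳ u (here refl)))

  length-cartesianProduct : (xs : List A) (ys : List B) →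
    length (cartesianProduct xs ys) ≡ length xs * length ys
  length-cartesianProduct [] ys = refl
  length-cartesianProduct (x ∷ xs) ys =
    trans (length-++ (map (x ,_) ys)) (cong₂ _+_ (length-map (x ,_) ys)
        (length-cartesianProduct xs ys))

-- The lexicographic order on lists of states as a total order.

module LexOrder where
  open import Defs
  open import Data.Nat using (_<_; _≡ᵇ_; _<ᵇ_)
  open import Data.Nat.Properties
  open import Data.Bool using (Bool; T; _∧_; _∨_)
  open import Data.Bool.Properties using (T-∧; T-∨)
  open import Data.Product using (∃; _×_; _,_)
  open import Data.Sum using (_⊎_; inj₁; inj₂)
  open import Data.Empty using (⊥; ⊥-elim)
  open import Data.List using (List; []; _∷_)
  open import Data.List.Membership.Propositional using (_∈_)
  open import Data.List.Relation.Unary.Any using (here; there)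
  open import Relation.Binary.PropositionalEquality
  open import Relation.Binary.Definitions using (tri<; tri≈; tri>)
  open import Function.Bundles using (Equivalence)

  T-∧⁻ : ∀ {a b} → T (a ∧ b) → T a × T b
  T-∧⁻ = Equivalence.to T-∧

  T-∧⁺ : ∀ {a b} → T a → T b → T (a ∧ b)
  T-∧⁺ p q = Equivalence.from T-∧ (p , q)

  T-∨⁻ : ∀ {a b} → T (a ∨ b) → T a ⊎ T b
  T-∨⁻ = Equivalence.to T-∨

  T-∨⁺ : ∀ {a b} → T a ⊎ T b → T (a ∨ b)
  T-∨⁺ = Equivalence.from T-∨

  infix 4 _≺_ _≼_

  _≺_ : State → State → Set
  (x , y) ≺ (x′ , y′) = x < x′ ⊎ (x ≡ x′ × y < y′)

  data _≼_ : List State → List State → Set where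
    []≼ : ∀ {ts} → [] ≼ ts
    <∷  : ∀ {s t ss ts} → s ≺ t → s ∷ ss ≼ t ∷ ts
    ≡∷  : ∀ {s ss ts} → ss ≼ ts → s ∷ ss ≼ s ∷ ts

  leq⇒≼ : ∀ ss ts → T (leqStateLexᵇ ss ts) → ss ≼ ts
  leq⇒≼ [] ts h = []≼
  leq⇒≼ ((x , y) ∷ ss) ((x′ , y′) ∷ ts) h with T-∨⁻ {x <ᵇ x′} h
  ... | inj₁ p = <∷ (inj₁ (<ᵇ⇒< x x′ p))
  ... | inj₂ p with T-∧⁻ {x ≡ᵇ x′} p
  ... | e , r with ≡ᵇ⇒≡ x x′ e | T-∨⁻ {y <ᵇ y′} r
  ... | refl | inj₁ l = <∷ (inj₂ (refl , <ᵇ⇒< y y′ l))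
  ... | refl | inj₂ l with T-∧⁻ {y ≡ᵇ y′} l
  ... | f , g with ≡ᵇ⇒≡ y y′ f
  ... | refl = ≡∷ (leq⇒≼ ss ts g)

  ≼⇒leq : ∀ {ss ts} → ss ≼ ts → T (leqStateLexᵇ ss ts)
  ≼⇒leq []≼ = _
  ≼⇒leq (<∷ {x , y} {x′ , y′} (inj₁ p)) = T-∨⁺ (inj₁ (<⇒<ᵇ p))
  ≼⇒leq (<∷ {x , y} {_ , y′} (inj₂ (refl , p))) =
    T-∨⁺ {x <ᵇ x} (inj₂ (T-∧⁺ (≡⇒≡ᵇ x x refl) (T-∨⁺ (inj₁ (<⇒<ᵇ p)))))
  ≼⇒leq (≡∷ {x , y} p) =
    T-∨⁺ {x <ᵇ x} (inj₂ (T-∧⁺ (≡⇒≡ᵇ x x refl) (T-∨⁺ {y <ᵇ y}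
        (inj₂ (T-∧⁺ (≡⇒≡ᵇ y y refl) (≼⇒leq p))))))

  ≺-trans : ∀ {s t u} → s ≺ t → t ≺ u → s ≺ u
  ≺-trans (inj₁ p) (inj₁ q) = inj₁ (<-trans p q)
  ≺-trans (inj₁ p) (inj₂ (refl , q)) = inj₁ p
  ≺-trans (inj₂ (refl , p)) (inj₁ q) = inj₁ q
  ≺-trans (inj₂ (refl , p)) (inj₂ (refl , q)) = inj₂ (refl , <-trans p q)

  ≺-irrefl : ∀ {s} → s ≺ s → ⊥
  ≺-irrefl (inj₁ p) = <-irrefl refl p
  ≺-irrefl (inj₂ (_ , p)) = <-irrefl refl p

  ≺-compare : ∀ s t → s ≺ t ⊎ s ≡ t ⊎ t ≺ s
  ≺-compare (x , y) (x′ , y′) with <-cmp x x′ | <-cmp y y′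
  ... | tri< p _ _ | _ = inj₁ (inj₁ p)
  ... | tri> _ _ p | _ = inj₂ (inj₂ (inj₁ p))
  ... | tri≈ _ refl _ | tri< p _ _ = inj₁ (inj₂ (refl , p))
  ... | tri≈ _ refl _ | tri≈ _ refl _ = inj₂ (inj₁ refl)
  ... | tri≈ _ refl _ | tri> _ _ p = inj₂ (inj₂ (inj₂ (refl , p)))

  ≼-trans : ∀ {ss ts us} → ss ≼ ts → ts ≼ us → ss ≼ us
  ≼-trans []≼ q = []≼
  ≼-trans (<∷ p) (<∷ q) = <∷ (≺-trans p q)
  ≼-trans (<∷ p) (≡∷ q) = <∷ p
  ≼-trans (≡∷ p) (<∷ q) = <∷ q
  ≼-trans (≡∷ p) (≡∷ q) = ≡∷ (≼-trans p q)

  ≼-antisym : ∀ {ss ts} → ss ≼ ts → ts ≼ ss → ss ≡ ts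
  ≼-antisym []≼ []≼ = refl
  ≼-antisym (<∷ p) (<∷ q) = ⊥-elim (≺-irrefl (≺-trans p q))
  ≼-antisym (<∷ p) (≡∷ q) = ⊥-elim (≺-irrefl p)
  ≼-antisym (≡∷ p) (<∷ q) = ⊥-elim (≺-irrefl q)
  ≼-antisym (≡∷ p) (≡∷ q) = cong (_ ∷_) (≼-antisym p q)

  ≼-total : ∀ ss ts → ss ≼ ts ⊎ ts ≼ ss
  ≼-total [] ts = inj₁ []≼
  ≼-total (s ∷ ss) [] = inj₂ []≼
  ≼-total (s ∷ ss) (t ∷ ts) with ≺-compare s t
  ... | inj₁ p = inj₁ (<∷ p)
  ... | inj₂ (inj₂ p) = inj₂ (<∷ p)
  ... | inj₂ (inj₁ refl) with ≼-total ss ts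
  ... | inj₁ p = inj₁ (≡∷ p)
  ... | inj₂ p = inj₂ (≡∷ p)

  ≼-refl : ∀ {ss} → ss ≼ ss
  ≼-refl {[]} = []≼
  ≼-refl {s ∷ ss} = ≡∷ ≼-refl

  ≼-minimum : ∀ x (xs : List (List State)) →
    ∃ λ m → m ∈ (x ∷ xs) × (∀ {y} → y ∈ (x ∷ xs) → m ≼ y)
  ≼-minimum x [] = x , here refl , λ { (here refl) → ≼-refl }
  ≼-minimum x (x′ ∷ xs) with ≼-minimum x′ xs
  ... | m , m∈ , h with ≼-total x m
  ... | inj₁ p = x , here refl , λ { (here refl) → ≼-refl ; (there q) → ≼-trans p (h q) }
  ... | inj₂ p = m , there m∈ , λ { (here refl) → p ; (there q) → h q }

-- Families of descending runs and the moves that add a new smallest entry.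

module Runs where
  open ListCounting
  open import Data.Nat using (ℕ; zero; suc; _+_; _>_; z≤n; s≤s)
  open import Data.Nat.Properties
  open import Data.Product using (∃; _×_; _,_; proj₁; proj₂)
  open import Data.Sum using (_⊎_; inj₁; inj₂)
  open import Data.Empty using (⊥-elim)
  open import Data.List using (List; []; _∷_; _++_; _∷ʳ_; map; length; concatMap)
  open import Data.List.Properties using (++-assoc; length-map; map-++; ∷-injective)
  open import Data.List.Membership.Propositional using (_∈_; _∉_)
  open import Data.List.Membership.Propositional.Properties
    using (∈-++⁺ˡ; ∈-++⁺ʳ; ∈-map⁺; ∈-map⁻)
  open import Data.List.Relation.Unary.Any using (here; there)
  open import Data.List.Relation.Unary.All as All using (All; []; _∷_)
  open import Data.List.Relation.Unary.AllPairs using ([]; _∷_)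
  open import Data.List.Relation.Unary.Unique.Propositional using (Unique)
  import Data.List.Relation.Unary.Unique.Propositional.Properties as Unq
  open import Data.List.Relation.Binary.Permutation.Propositional using
      (_↭_; refl; trans; ↭-sym; ↭⇒↭ₛ; ↭-refl; ↭-trans)
  import Data.List.Relation.Binary.Permutation.Propositional.Properties as Perm
  import Data.List.Relation.Binary.Permutation.Setoid.Properties as PermS
  open import Relation.Binary.PropositionalEquality as ≡ using (_≡_; _≢_; refl; sym; cong; cong₂;
      subst; setoid)
  open import Relation.Nullary using (¬_)
  open import Function using (_∘_)

  private variable
    A : Set

  Unique-resp-↭ : {xs ys : List A} → xs ↭ ys → Unique xs → Unique ys
  Unique-resp-↭ {A} p = PermS.Unique-resp-↭ (setoid A) (↭⇒↭ₛ p)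

  -- The starting point is an index and not a member of the list. Taking the last element of the
  -- list itself as the start turns a chain into a closed one.
  data Chain (R : A → A → Set) : A → List A → Set where
    []  : ∀ {x} → Chain R x []
    _∷_ : ∀ {x y ys} → R x y → Chain R y ys → Chain R x (y ∷ ys)

  -- A run is a nonempty list, given by head and tail.  Entry k stands for the
  -- diagonal of offset k + 1, so that the weight of a run is one more than its head.
  Run : Set
  Run = ℕ × List ℕ

  entries : Run → List ℕ
  entries (x , xs) = x ∷ xs

  Descending : Run → Set
  Descending (x , xs) = Chain _>_ x xs

  Family : Set
  Family = List Run

  support : Family → List ℕ
  support = concatMap entries

  weight : Family → ℕ
  weight []              = 0
  weight ((x , _) ∷ As) = suc x + weight As

  Valid : Family → Set
  Valid As = All Descending As × Unique (support As)

  shiftRun : Run → Run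
  shiftRun (x , xs) = suc x , map suc xs

  shift : Family → Family
  shift = map shiftRun

  appends : Family → List Family
  appends []               = []
  appends ((x , xs) ∷ As) = ((x , xs ∷ʳ 0) ∷ As) ∷ map ((x , xs) ∷_) (appends As)

  stays : Family → List Family
  stays As = As ∷ appends As

  inserts : Family → List Family
  inserts []       = ((0 , []) ∷ []) ∷ []
  inserts (r ∷ As) = ((0 , []) ∷ r ∷ As) ∷ map (r ∷_) (inserts As)

  length-shift : ∀ As → length (shift As) ≡ length As
  length-shift = length-map shiftRun

  length-appends : ∀ As → length (appends As) ≡ length As
  length-appends [] = refl
  length-appends (r ∷ As) = cong suc (≡.trans (length-map _ (appends As)) (length-appends As))

  length-inserts : ∀ As → length (inserts As) ≡ suc (length As)
  length-inserts [] = refl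
  length-inserts (r ∷ As) = cong suc (≡.trans (length-map _ (inserts As)) (length-inserts As))

  support-shift : ∀ As → support (shift As) ≡ map suc (support As)
  support-shift [] = refl
  support-shift ((x , xs) ∷ As) =
    cong (suc x ∷_) (≡.trans (cong (map suc xs ++_) (support-shift As))
        (sym (map-++ suc xs (support As))))

  -- Each run contributes its maximum, which grows by one: the origin of the index m - t in the
  -- recursion.
  weight-shift : ∀ As → weight (shift As) ≡ length As + weight As
  weight-shift [] = refl
  weight-shift ((x , _) ∷ As) = cong suc (≡.trans (cong (suc x +_) (weight-shift As)) lemma)
    where
    lemma : suc x + (length As + weight As) ≡ length As + (suc x + weight As)
    lemma = ≡.trans (sym (+-assoc (suc x) (length As) _))
              (≡.trans (cong (_+ weight As) (+-comm (suc x) (length As)))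
                  (+-assoc (length As) (suc x) _))

  length-∈-appends : ∀ As {B} → B ∈ appends As → length B ≡ length As
  length-∈-appends (r ∷ As) (here refl) = refl
  length-∈-appends (r ∷ As) (there p) with ∈-map⁻ _ p
  ... | B , B∈ , refl = cong suc (length-∈-appends As B∈)

  length-∈-inserts : ∀ As {B} → B ∈ inserts As → length B ≡ suc (length As)
  length-∈-inserts [] (here refl) = refl
  length-∈-inserts (r ∷ As) (here refl) = refl
  length-∈-inserts (r ∷ As) (there p) with ∈-map⁻ _ p
  ... | B , B∈ , refl = cong suc (length-∈-inserts As B∈)

  weight-∈-appends : ∀ As {B} → B ∈ appends As → weight B ≡ weight As
  weight-∈-appends (r ∷ As) (here refl) = refl
  weight-∈-appends (r ∷ As) (there p) with ∈-map⁻ _ p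
  ... | B , B∈ , refl = cong (suc (proj₁ r) +_) (weight-∈-appends As B∈)

  weight-∈-inserts : ∀ As {B} → B ∈ inserts As → weight B ≡ suc (weight As)
  weight-∈-inserts [] (here refl) = refl
  weight-∈-inserts (r ∷ As) (here refl) = refl
  weight-∈-inserts (r ∷ As) (there p) with ∈-map⁻ _ p
  ... | B , B∈ , refl = ≡.trans (cong (suc (proj₁ r) +_) (weight-∈-inserts As B∈))
      (+-suc (suc (proj₁ r)) (weight As))

  support-∈-appends : ∀ As {B} → B ∈ appends As → support B ↭ 0 ∷ support As
  support-∈-appends ((x , xs) ∷ As) (here refl) =
    ≡.subst (_↭ 0 ∷ x ∷ xs ++ support As) (cong (x ∷_) (sym (++-assoc′ xs)))
      (Perm.shift 0 (x ∷ xs) (support As))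
    where
    ++-assoc′ : ∀ ys → (ys ∷ʳ 0) ++ support As ≡ ys ++ 0 ∷ support As
    ++-assoc′ ys = ++-assoc ys (0 ∷ []) (support As)
  support-∈-appends ((x , xs) ∷ As) (there p) with ∈-map⁻ _ p
  ... | B , B∈ , refl = ↭-trans (Perm.++⁺ˡ (x ∷ xs) (support-∈-appends As B∈))
      (Perm.shift 0 (x ∷ xs) (support As))

  support-∈-inserts : ∀ As {B} → B ∈ inserts As → support B ↭ 0 ∷ support As
  support-∈-inserts [] (here refl) = ↭-refl
  support-∈-inserts (r ∷ As) (here refl) = ↭-refl
  support-∈-inserts ((x , xs) ∷ As) (there p) with ∈-map⁻ _ p
  ... | B , B∈ , refl = ↭-trans (Perm.++⁺ˡ (x ∷ xs) (support-∈-inserts As B∈))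
      (Perm.shift 0 (x ∷ xs) (support As))

  Chain-shift : ∀ {x xs} → Chain _>_ x xs → Chain _>_ (suc x) (map suc xs)
  Chain-shift [] = []
  Chain-shift (p ∷ c) = s≤s p ∷ Chain-shift c

  Chain-shift-∷ʳ : ∀ {x xs} → Chain _>_ x xs → Chain _>_ (suc x) (map suc xs ∷ʳ 0)
  Chain-shift-∷ʳ [] = s≤s z≤n ∷ []
  Chain-shift-∷ʳ (p ∷ c) = s≤s p ∷ Chain-shift-∷ʳ c

  Descending-shift : ∀ {As} → All Descending As → All Descending (shift As)
  Descending-shift [] = []
  Descending-shift (d ∷ ds) = Chain-shift d ∷ Descending-shift ds

  Descending-appends : ∀ As {B} → All Descending As → B ∈ appends (shift As) → All Descending B
  Descending-appends (r ∷ As) (d ∷ ds) (here refl) = Chain-shift-∷ʳ d ∷ Descending-shift ds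
  Descending-appends (r ∷ As) (d ∷ ds) (there p) with ∈-map⁻ _ p
  ... | B , B∈ , refl = Chain-shift d ∷ Descending-appends As ds B∈

  Descending-inserts : ∀ As {B} → All Descending As → B ∈ inserts (shift As) → All Descending B
  Descending-inserts [] ds (here refl) = [] ∷ []
  Descending-inserts (r ∷ As) (d ∷ ds) (here refl) = [] ∷ Chain-shift d ∷ Descending-shift ds
  Descending-inserts (r ∷ As) (d ∷ ds) (there p) with ∈-map⁻ _ p
  ... | B , B∈ , refl = Chain-shift d ∷ Descending-inserts As ds B∈

  0∉map-suc : ∀ {xs} → 0 ∉ map suc xs
  0∉map-suc p with ∈-map⁻ suc p
  ... | _ , _ , ()

  Unique-shift : ∀ {As} → Unique (support As) → Unique (support (shift As))
  Unique-shift {As} u = subst Unique (sym (support-shift As)) (Unq.map⁺ suc-injective u)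

  Unique-unshift : ∀ {As} → Unique (support (shift As)) → Unique (support As)
  Unique-unshift {As} u = map⁻ (support As) (subst Unique (support-shift As) u)
    where
    map⁻ : ∀ xs → Unique (map suc xs) → Unique xs
    map⁻ [] _ = []
    map⁻ (x ∷ xs) u = ∉-Unique (λ p → Unique-∉ u (∈-map⁺ suc p)) (map⁻ xs (Unique-tail u))

  Unique-0∷shift : ∀ As → Unique (support As) → Unique (0 ∷ support (shift As))
  Unique-0∷shift As u = ∉-Unique (λ p → 0∉map-suc (subst (0 ∈_) (support-shift As) p))
      (Unique-shift {As} u)

  Valid-stays : ∀ As {B} → Valid As → B ∈ stays (shift As) → Valid B
  Valid-stays As (ds , u) (here refl) = Descending-shift ds , Unique-shift {As} u
  Valid-stays As (ds , u) (there p) = Descending-appends As ds p ,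
    Unique-resp-↭ (↭-sym (support-∈-appends (shift As) p)) (Unique-0∷shift As u)

  Valid-inserts : ∀ As {B} → Valid As → B ∈ inserts (shift As) → Valid B
  Valid-inserts As (ds , u) p = Descending-inserts As ds p ,
    Unique-resp-↭ (↭-sym (support-∈-inserts (shift As) p)) (Unique-0∷shift As u)

  data RunView : Run → Set where
    shifted  : ∀ r → Descending r → RunView (shiftRun r)
    appended : ∀ x xs → Descending (x , xs) → RunView (suc x , map suc xs ∷ʳ 0)
    single   : RunView (0 , [])

  -- A strictly decreasing list can contain 0 only as its last entry, so the run is entirely
  -- positive, or ends in 0 after positive entries, or is 0 alone.
  runView : ∀ r → Descending r → RunView r
  runView (zero , []) [] = single
  runView (suc x , []) [] = shifted (x , []) []
  runView (suc x , y ∷ ys) (p ∷ c) with runView (y , ys) c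
  ... | shifted (y′ , ys′) d = shifted (x , y′ ∷ ys′) (≤-pred p ∷ d)
  ... | appended y′ ys′ d = appended x (y′ ∷ ys′) (≤-pred p ∷ d)
  ... | single = appended x [] []

  allShifted : ∀ As → All Descending As → 0 ∉ support As →
    ∃ λ As′ → As ≡ shift As′ × All Descending As′
  allShifted [] _ _ = [] , refl , []
  allShifted (r ∷ As) (d ∷ ds) 0∉ with allShifted As ds (0∉ ∘ ∈-++⁺ʳ (entries r)) | runView r d
  ... | As′ , refl , ds′ | shifted r′ d′ = r′ ∷ As′ , refl , d′ ∷ ds′
  ... | As′ , refl , ds′ | appended x xs d′ = ⊥-elim
      (0∉ (there (∈-++⁺ˡ {xs = map suc xs ∷ʳ 0} (∈-++⁺ʳ (map suc xs) (here refl)))))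
  ... | As′ , refl , ds′ | single = ⊥-elim (0∉ (here refl))

  -- By disjointness at most one run contains 0. That run decides the move, and all runs after it
  -- are positive and can be lowered by `allShifted`.
  familyView : ∀ As → All Descending As → Unique (support As) →
    ∃ λ As′ → All Descending As′ × (As ∈ stays (shift As′) ⊎ As ∈ inserts (shift As′))
  familyView [] [] u = [] , [] , inj₁ (here refl)
  familyView (r ∷ As) (d ∷ ds) u with Unique-++⁻ (entries r) u
  ... | _ , uAs , disj with runView r d
  ... | shifted r′ d′ with familyView As ds uAs
  ...   | As′ , ds′ , inj₁ (here refl) = r′ ∷ As′ , d′ ∷ ds′ , inj₁ (here refl)
  ...   | As′ , ds′ , inj₁ (there p) = r′ ∷ As′ , d′ ∷ ds′ , inj₁ (there (there (∈-map⁺ _ p)))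
  ...   | As′ , ds′ , inj₂ p = r′ ∷ As′ , d′ ∷ ds′ , inj₂ (there (∈-map⁺ _ p))
  familyView (_ ∷ As) (d ∷ ds) u | _ , uAs , disj | appended x xs d′
    with allShifted As ds (disj (there (∈-++⁺ʳ (map suc xs) (here refl))))
  ... | As′ , refl , ds′ = (x , xs) ∷ As′ , d′ ∷ ds′ , inj₁ (there (here refl))
  familyView (_ ∷ As) (d ∷ ds) u | _ , uAs , disj | single
    with allShifted As ds (disj (here refl))
  ... | [] , refl , ds′ = [] , ds′ , inj₂ (here refl)
  ... | r′ ∷ As′ , refl , ds′ = r′ ∷ As′ , ds′ , inj₂ (here refl)

  Unique-stays⁻ : ∀ As {B} → Unique (support B) → B ∈ stays (shift As) → Unique (support As)
  Unique-stays⁻ As u (here refl) = Unique-unshift {As} u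
  Unique-stays⁻ As u (there p) = Unique-unshift {As}
      (Unique-tail (Unique-resp-↭ (support-∈-appends (shift As) p) u))

  Unique-inserts⁻ : ∀ As {B} → Unique (support B) → B ∈ inserts (shift As) → Unique (support As)
  Unique-inserts⁻ As u p = Unique-unshift {As} (Unique-tail
      (Unique-resp-↭ (support-∈-inserts (shift As) p) u))

  unshiftList : List ℕ → List ℕ
  unshiftList []           = []
  unshiftList (zero ∷ xs)  = unshiftList xs
  unshiftList (suc x ∷ xs) = x ∷ unshiftList xs

  unshiftRun : List ℕ → Family → Family
  unshiftRun []       As = As
  unshiftRun (x ∷ xs) As = (x , xs) ∷ As

  -- A common left inverse of all the moves: zeros are deleted, the other entries lowered, and a run
  -- that becomes empty disappears. The source of a move can thus be read off from its result.
  unshift : Family → Family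
  unshift []       = []
  unshift (r ∷ As) = unshiftRun (unshiftList (entries r)) (unshift As)

  unshiftList-map : ∀ xs → unshiftList (map suc xs) ≡ xs
  unshiftList-map [] = refl
  unshiftList-map (x ∷ xs) = cong (x ∷_) (unshiftList-map xs)

  unshiftList-∷ʳ : ∀ xs → unshiftList (map suc xs ∷ʳ 0) ≡ xs
  unshiftList-∷ʳ [] = refl
  unshiftList-∷ʳ (x ∷ xs) = cong (x ∷_) (unshiftList-∷ʳ xs)

  unshift-shift : ∀ As → unshift (shift As) ≡ As
  unshift-shift [] = refl
  unshift-shift ((x , xs) ∷ As) = cong₂ (λ ys Bs → (x , ys) ∷ Bs) (unshiftList-map xs)
      (unshift-shift As)

  unshift-stays : ∀ As {B} → B ∈ stays (shift As) → unshift B ≡ As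
  unshift-stays As (here refl) = unshift-shift As
  unshift-stays As (there p) = go As p
    where
    go : ∀ As {B} → B ∈ appends (shift As) → unshift B ≡ As
    go ((x , xs) ∷ As) (here refl) = cong₂ (λ ys Bs → (x , ys) ∷ Bs) (unshiftList-∷ʳ xs)
        (unshift-shift As)
    go ((x , xs) ∷ As) (there p) with ∈-map⁻ _ p
    ... | B , B∈ , refl = cong₂ (λ ys Bs → (x , ys) ∷ Bs) (unshiftList-map xs) (go As B∈)

  unshift-inserts : ∀ As {B} → B ∈ inserts (shift As) → unshift B ≡ As
  unshift-inserts [] (here refl) = refl
  unshift-inserts (r ∷ As) (here refl) = unshift-shift (r ∷ As)
  unshift-inserts ((x , xs) ∷ As) (there p) with ∈-map⁻ _ p
  ... | B , B∈ , refl = cong₂ (λ ys Bs → (x , ys) ∷ Bs) (unshiftList-map xs) (unshift-inserts As B∈)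

  ∷-injʳ : ∀ {r : Run} {As Bs} → r ∷ As ≡ r ∷ Bs → As ≡ Bs
  ∷-injʳ p = proj₂ (∷-injective p)

  Unique-appends : ∀ As → Unique (appends As)
  Unique-appends [] = []
  Unique-appends ((x , xs) ∷ As) = ∉-Unique x∉ (Unq.map⁺ ∷-injʳ (Unique-appends As))
    where
    ∷ʳ≢ : ∀ (ys : List ℕ) → ys ∷ʳ 0 ≢ ys
    ∷ʳ≢ (y ∷ ys) p = ∷ʳ≢ ys (proj₂ (∷-injective p))
    x∉ : ((x , xs ∷ʳ 0) ∷ As) ∉ map ((x , xs) ∷_) (appends As)
    x∉ p with ∈-map⁻ _ p
    ... | B , _ , e = ∷ʳ≢ xs (cong proj₂ (proj₁ (∷-injective e)))

  Unique-stays : ∀ As → Unique (stays As)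
  Unique-stays As = ∉-Unique (λ p → Perm-≢ (support-∈-appends As p)) (Unique-appends As)
    where
    Perm-≢ : ∀ {xs} → ¬ (xs ↭ 0 ∷ xs)
    Perm-≢ p = 1+n≢n (sym (Perm.↭-length p))

  -- The shift matters: in a family that already has the run `(0 , [])`, inserting another one
  -- before or after it gives the same list.
  Unique-inserts : ∀ As → Unique (inserts (shift As))
  Unique-inserts [] = [] ∷ []
  Unique-inserts (r ∷ As) = ∉-Unique x∉ (Unq.map⁺ ∷-injʳ (Unique-inserts As))
    where
    x∉ : ((0 , []) ∷ shift (r ∷ As)) ∉ map (shiftRun r ∷_) (inserts (shift As))
    x∉ p with ∈-map⁻ _ p
    ... | B , _ , e = 0≢1+n (cong proj₁ (proj₁ (∷-injective e)))

-- Enumeration of families with given number of runs and weight, and the recursion for their number.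

module Enumeration where
  open ListCounting
  open Runs
  open import Data.Nat using (ℕ; zero; suc; _+_; _*_; _∸_; _≤_; z≤n; s≤s; _≤?_)
  open import Data.Nat.Properties
  open import Data.Product using (∃; ∃₂; _×_; _,_; proj₁; proj₂)
  open import Data.Sum using (_⊎_; inj₁; inj₂)
  open import Data.Unit using (⊤)
  open import Data.Empty using (⊥; ⊥-elim)
  open import Data.List using (List; []; _∷_; _++_; map; length; concatMap)
  open import Data.List.Properties using (length-++; length-map)
  open import Data.List.Membership.Propositional using (_∈_)
  open import Data.List.Membership.Propositional.Properties
    using (∈-++⁺ˡ; ∈-++⁺ʳ; ∈-++⁻; ∈-map⁻)
  open import Data.List.Relation.Unary.Any using (here; there)
  open import Data.List.Relation.Unary.All as All using (All; []; _∷_)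
  import Data.List.Relation.Unary.All.Properties as All
  open import Data.List.Relation.Unary.AllPairs using ([]; _∷_)
  open import Data.List.Relation.Unary.Unique.Propositional using (Unique)
  import Data.List.Relation.Unary.Unique.Propositional.Properties as Unq
  open import Data.List.Relation.Binary.Permutation.Propositional using (_↭_; ↭-sym)
  import Data.List.Relation.Binary.Permutation.Propositional.Properties as Perm
  open import Relation.Binary.PropositionalEquality
  open import Relation.Nullary using (Dec; yes; no)
  open import Function using (_∘_)
  open import Data.Nat.Tactic.RingSolver using (solve-∀)

  when : {P : Set} {A : Set} → Dec P → List A → List A
  when (yes _) xs = xs
  when (no _)  xs = []

  -- A constraint on families, together with the places where a new run may be
  -- inserted so that the constraint is preserved.
  record Discipline : Set₁ where
    field
      Good       : Family → Set
      ins        : Family → List Family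
      insCount   : ℕ → ℕ
      good-[]    : Good []
      good-stays : ∀ {As B} → Good As → B ∈ stays (shift As) → Good B
      good-ins   : ∀ {As B} → Good As → B ∈ ins (shift As) → B ∈ inserts (shift As) × Good B
      stays⁻     : ∀ {As B} → Good B → B ∈ stays (shift As) → Good As
      inserts⁻   : ∀ {As B} → Good B → B ∈ inserts (shift As) → B ∈ ins (shift As) × Good As
      unique-ins : ∀ As → Unique (ins (shift As))
      length-ins : ∀ As → length (ins As) ≡ insCount (length As)

  length-stays : ∀ As {B} → B ∈ stays As → length B ≡ length As
  length-stays As (here refl) = refl
  length-stays As (there p) = length-∈-appends As p

  weight-stays : ∀ As {B} → B ∈ stays As → weight B ≡ weight As
  weight-stays As (here refl) = refl
  weight-stays As (there p) = weight-∈-appends As p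

  module Families (D : Discipline) where
    open Discipline D

    IsFamily : ℕ → ℕ → Family → Set
    IsFamily s m As = length As ≡ s × weight As ≡ m × Valid As × Good As

    extend : List Family → List Family → List Family
    extend Fs Gs = concatMap (stays ∘ shift) Fs ++ concatMap (ins ∘ shift) Gs

    -- `f` is fuel. A move lowers `m` by `suc s`, so any `f ≥ m` yields the same list, as
    -- `bounded-irrelevant` confirms. The guard cuts off weights smaller than the number of runs.
    bounded : ℕ → ℕ → ℕ → List Family
    bounded f       zero    zero    = [] ∷ []
    bounded f       zero    (suc m) = []
    bounded zero    (suc s) m       = []
    bounded (suc f) (suc s) m       =
      when (suc s ≤? m) (extend (bounded f (suc s) (m ∸ suc s)) (bounded f s (m ∸ suc s)))

    families : ℕ → ℕ → List Family
    families s m = bounded m s m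

    ∈-extend⁻ : ∀ Fs Gs {B} → B ∈ extend Fs Gs →
      (∃ λ As → As ∈ Fs × B ∈ stays (shift As)) ⊎ (∃ λ As → As ∈ Gs × B ∈ ins (shift As))
    ∈-extend⁻ Fs Gs p with ∈-++⁻ (concatMap (stays ∘ shift) Fs) p
    ... | inj₁ q = inj₁ (∈-concatMap⁻ (stays ∘ shift) Fs q)
    ... | inj₂ q = inj₂ (∈-concatMap⁻ (ins ∘ shift) Gs q)

    sound : ∀ f s m {B} → B ∈ bounded f s m → IsFamily s m B
    sound f zero zero (here refl) = refl , refl , ([] , []) , good-[]
    sound (suc f) (suc s) m p with suc s ≤? m
    ... | yes s<m with ∈-extend⁻ (bounded f (suc s) (m ∸ suc s)) _ p
    ...   | inj₁ (As , As∈ , q) with sound f (suc s) (m ∸ suc s) As∈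
    ...     | len , wt , v , g = trans (length-stays (shift As) q) (trans (length-shift As) len)
                    , trans (weight-stays (shift As) q) (trans (weight-shift As)
                        (trans (cong₂ _+_ len wt) (m+[n∸m]≡n s<m)))
                    , Valid-stays As v q , good-stays g q
    sound (suc f) (suc s) m p | yes s<m | inj₂ (As , As∈ , q) with sound f s (m ∸ suc s) As∈
    ... | len , wt , v , g with good-ins g q
    ... | q′ , gB = trans (length-∈-inserts (shift As) q′) (cong suc (trans (length-shift As) len))
                  , trans (weight-∈-inserts (shift As) q′) (trans (cong suc (weight-shift As))
                      (trans (cong₂ (λ a b → suc (a + b)) len wt) (m+[n∸m]≡n s<m)))
                  , Valid-inserts As v q′ , gB

    length≤weight : ∀ As → length As ≤ weight As
    length≤weight [] = z≤n
    length≤weight ((x , _) ∷ As) = s≤s (≤-trans (length≤weight As) (m≤n+m _ x))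

    complete : ∀ f s m {B} → m ≤ f → IsFamily s m B → B ∈ bounded f s m
    complete f zero zero {[]} m≤f (refl , refl , _) = here refl
    complete zero (suc s) .zero {r ∷ B} z≤n (_ , () , _)
    complete (suc f) (suc s) m {B} m≤f (len₀ , refl , (ds , u) , g) with suc s ≤? weight B
    ... | no ¬p = ⊥-elim (¬p (subst (_≤ weight B) len₀ (length≤weight B)))
    ... | yes s<m with familyView B ds u
    ...   | As , ds′ , inj₁ p = ∈-++⁺ˡ (∈-concatMap⁺ (stays ∘ shift) (complete f (suc s) _ small
              (len , wt , (ds′ , Unique-stays⁻ As u p) , stays⁻ g p)) p)
      where
      small : weight B ∸ suc s ≤ f
      small = ≤-trans (∸-monoˡ-≤ (suc s) m≤f) (m∸n≤m f s)
      len : length As ≡ suc s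
      len = trans (sym (length-shift As)) (trans (sym (length-stays (shift As) p)) len₀)
      wt : weight As ≡ weight B ∸ suc s
      wt = sym (trans (cong (_∸ suc s) (trans (weight-stays (shift As) p)
          (trans (weight-shift As) (cong (_+ weight As) len)))) (m+n∸m≡n (suc s) (weight As)))
    ...   | As , ds′ , inj₂ p with inserts⁻ g p
    ...     | p′ , g′ = ∈-++⁺ʳ (concatMap (stays ∘ shift) (bounded f (suc s) _))
                (∈-concatMap⁺ (ins ∘ shift) (complete f s _ small
                    (len , wt , (ds′ , Unique-inserts⁻ As u p) , g′)) p′)
      where
      small : weight B ∸ suc s ≤ f
      small = ≤-trans (∸-monoˡ-≤ (suc s) m≤f) (m∸n≤m f s)
      len : length As ≡ s
      len = suc-injective (trans (cong suc (sym (length-shift As)))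
          (trans (sym (length-∈-inserts (shift As) p)) len₀))
      wt : weight As ≡ weight B ∸ suc s
      wt = sym (trans (cong (_∸ suc s) (trans (weight-∈-inserts (shift As) p)
          (cong suc (trans (weight-shift As) (cong (_+ weight As) len)))))
          (m+n∸m≡n (suc s) (weight As)))

    Unique-bounded : ∀ f s m → Unique (bounded f s m)
    Unique-bounded f zero zero = [] ∷ []
    Unique-bounded f zero (suc m) = []
    Unique-bounded zero (suc s) m = []
    Unique-bounded (suc f) (suc s) m with suc s ≤? m
    ... | no _ = []
    ... | yes _ = Unq.++⁺
        (Unique-concatMap _ Fs (Unique-bounded f (suc s) m′) (λ {As} _ → Unique-stays (shift As))
          (λ {As} {As′} _ _ p q → trans (sym (unshift-stays As p)) (unshift-stays As′ q)))
        (Unique-concatMap _ Gs (Unique-bounded f s m′) (λ {As} _ → unique-ins As)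
          (λ {As} {As′} a a′ p q → trans (sym (unshift-ins a p)) (unshift-ins a′ q)))
        disj
      where
      m′ = m ∸ suc s
      Fs = bounded f (suc s) m′
      Gs = bounded f s m′
      unshift-ins : ∀ {As B} → As ∈ Gs → B ∈ ins (shift As) → unshift B ≡ As
      unshift-ins {As} a p = unshift-inserts As
          (proj₁ (good-ins (proj₂ (proj₂ (proj₂ (sound f s m′ a)))) p))
      -- A family reached in both ways would unshift to a family with `suc s` runs and also with `s`
      -- runs.
      disj : ∀ {B} → B ∈ concatMap (stays ∘ shift) Fs × B ∈ concatMap (ins ∘ shift) Gs → ⊥
      disj (p , q) with ∈-extend⁻ Fs [] (∈-++⁺ˡ p) | ∈-extend⁻ [] Gs q
      ... | inj₁ (As , a , r) | inj₂ (As′ , a′ , r′) = 1+n≢n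
          (trans (sym (proj₁ (sound f (suc s) m′ a)))
        (trans (cong length (trans (sym (unshift-stays As r)) (unshift-ins a′ r′)))
            (proj₁ (sound f s m′ a′))))

    number : ℕ → ℕ → ℕ
    number s m = length (families s m)

    bounded-irrelevant : ∀ f f′ s m → m ≤ f → m ≤ f′ → bounded f s m ≡ bounded f′ s m
    bounded-irrelevant f f′ zero zero p q = refl
    bounded-irrelevant f f′ zero (suc m) p q = refl
    bounded-irrelevant zero zero (suc s) m p q = refl
    bounded-irrelevant zero (suc f′) (suc s) .zero z≤n q = refl
    bounded-irrelevant (suc f) zero (suc s) .zero p z≤n = refl
    bounded-irrelevant (suc f) (suc f′) (suc s) m p q =
      cong₂ (λ Fs Gs → when (suc s ≤? m) (extend Fs Gs))
        (bounded-irrelevant f f′ (suc s) (m ∸ suc s) (small p) (small q))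
        (bounded-irrelevant f f′ s (m ∸ suc s) (small p) (small q))
      where
      small : ∀ {f} → m ≤ suc f → m ∸ suc s ≤ f
      small {f} p = ≤-trans (∸-monoˡ-≤ (suc s) p) (m∸n≤m f s)

    number-small : ∀ s m → m ≤ s → number (suc s) m ≡ 0
    number-small s zero m≤s = refl
    number-small s (suc m) m≤s with suc s ≤? suc m
    ... | yes p = ⊥-elim (<-irrefl refl (≤-trans p m≤s))
    ... | no _ = refl

    -- The factor `suc (suc s)` counts one family left as it is and `suc s` places to append 0;
    -- `insCount s` counts the places for a new run. For `dominated` and t = `suc s` this is the
    -- recursion for a_t.
    number-rec : ∀ s m → number (suc s) (suc s + m) ≡ number (suc s) m * suc (suc s) + number s m *
        insCount s
    number-rec s m with suc s ≤? suc (s + m)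
    ... | no ¬p = ⊥-elim (¬p (m≤m+n (suc s) m))
    ... | yes _ rewrite m+n∸m≡n s m =
      trans (length-++ (concatMap (stays ∘ shift) Fs))
        (cong₂ _+_
          (trans (length-concatMap _ (suc (suc s)) Fs
              (λ {As} p → cong suc (trans (length-appends (shift As))
              (trans (length-shift As) (proj₁ (sound (s + m) (suc s) m p))))))
            (cong (λ F → length F * suc (suc s)) (bounded-irrelevant (s + m) m (suc s) m
                (m≤n+m m s) ≤-refl)))
          (trans (length-concatMap _ (insCount s) Gs (λ {As} p → trans (length-ins (shift As))
              (cong insCount (trans (length-shift As) (proj₁ (sound (s + m) s m p))))))
            (cong (λ F → length F * insCount s) (bounded-irrelevant (s + m) m s m (m≤n+m m s)
                ≤-refl))))
      where
      Fs = bounded (s + m) (suc s) m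
      Gs = bounded (s + m) s m

    ∈-families⁻ : ∀ {s m B} → B ∈ families s m → IsFamily s m B
    ∈-families⁻ {s} {m} = sound m s m

    ∈-families⁺ : ∀ {s m B} → IsFamily s m B → B ∈ families s m
    ∈-families⁺ {s} {m} = complete m s m ≤-refl

    Unique-families : ∀ s m → Unique (families s m)
    Unique-families s m = Unique-bounded m s m

  unrestricted : Discipline
  unrestricted = record
    { Good = λ _ → ⊤ ; ins = inserts ; insCount = suc ; good-[] = _
    ; good-stays = _ ; good-ins = λ _ p → p , _ ; stays⁻ = _ ; inserts⁻ = λ _ p → p , _
    ; unique-ins = Unique-inserts ; length-ins = length-inserts }

  -- All entries are compared with the first maximum, not only the heads of the other runs, so that
  -- the condition depends on the support up to permutation and passes through every move
  -- (`All-0∷shift`).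
  Dominated : Family → Set
  Dominated []       = ⊤
  Dominated (r ∷ As) = All (_≤ proj₁ r) (support (r ∷ As))

  -- A new run consisting of 0 cannot stand in front of positive runs that it would have to
  -- dominate, which leaves one place fewer. Only in the empty family is it allowed to come first,
  -- hence the exceptional value `laterCount 0 = 1`.
  laterInserts : Family → List Family
  laterInserts []       = ((0 , []) ∷ []) ∷ []
  laterInserts (r ∷ As) = map (r ∷_) (inserts As)

  laterCount : ℕ → ℕ
  laterCount zero    = 1
  laterCount (suc s) = suc s

  All-0∷shift : ∀ {x} As {xs} → xs ↭ 0 ∷ support (shift As) → All (_≤ x) (support As) → All
      (_≤ suc x) xs
  All-0∷shift As p h = Perm.All-resp-↭ (↭-sym p) (z≤n ∷ subst (All _) (sym (support-shift As))
      (All.map⁺ (All.map s≤s h)))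

  All-0∷shift⁻ : ∀ {x} As {xs} → xs ↭ 0 ∷ support (shift As) → All (_≤ suc x) xs → All (_≤ x)
      (support As)
  All-0∷shift⁻ As p h = All.map ≤-pred (All.map⁻ (subst (All _) (support-shift As)
      (All.tail (Perm.All-resp-↭ p h))))

  dominated : Discipline
  dominated = record
    { Good = Dominated ; ins = laterInserts ; insCount = laterCount ; good-[] = _
    ; good-stays = λ {As} → good-stays As ; good-ins = λ {As} → good-ins As
    ; stays⁻ = λ {As} → stays⁻ As ; inserts⁻ = λ {As} → inserts⁻ As
    ; unique-ins = unique ; length-ins = len }
    where
    head-appends : ∀ r As {B} → B ∈ appends (r ∷ As) → ∃₂ λ xs Bs → B ≡ (proj₁ r , xs) ∷ Bs
    head-appends r As (here refl) = _ , _ , refl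
    head-appends r As (there p) with ∈-map⁻ _ p
    ... | B , _ , refl = _ , _ , refl
    good-stays : ∀ As {B} → Dominated As → B ∈ stays (shift As) → Dominated B
    good-stays [] g (here refl) = _
    good-stays (r ∷ As) g (here refl) = subst (All _) (sym (support-shift (r ∷ As)))
        (All.map⁺ (All.map s≤s g))
    good-stays (r ∷ As) g (there p) with head-appends (shiftRun r) (shift As) p
    ... | xs , Bs , refl = All-0∷shift (r ∷ As) (support-∈-appends (shift (r ∷ As)) p) g
    good-ins : ∀ As {B} → Dominated As → B ∈ laterInserts (shift As) → B ∈ inserts (shift As) ×
        Dominated B
    good-ins [] g (here refl) = here refl , z≤n ∷ []
    good-ins (r ∷ As) g p with ∈-map⁻ _ p
    ... | B , B∈ , refl = there p , All-0∷shift (r ∷ As) (support-∈-inserts (shift (r ∷ As))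
        (there p)) g
    stays⁻ : ∀ As {B} → Dominated B → B ∈ stays (shift As) → Dominated As
    stays⁻ [] g p = _
    stays⁻ (r ∷ As) g (here refl) = All.map ≤-pred
        (All.map⁻ (subst (All _) (support-shift (r ∷ As)) g))
    stays⁻ (r ∷ As) g (there p) with head-appends (shiftRun r) (shift As) p
    ... | xs , Bs , refl = All-0∷shift⁻ (r ∷ As) (support-∈-appends (shift (r ∷ As)) p) g
    inserts⁻ : ∀ As {B} → Dominated B → B ∈ inserts (shift As) → B ∈ laterInserts (shift As) ×
        Dominated As
    inserts⁻ [] g (here refl) = here refl , _
    inserts⁻ (r ∷ As) (_ ∷ () ∷ _) (here refl)
    inserts⁻ (r ∷ As) g (there p) with ∈-map⁻ _ p
    ... | B , B∈ , refl = p , All-0∷shift⁻ (r ∷ As) (support-∈-inserts (shift (r ∷ As)) (there p)) g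
    unique : ∀ As → Unique (laterInserts (shift As))
    unique [] = [] ∷ []
    unique (r ∷ As) = Unq.map⁺ ∷-injʳ (Unique-inserts As)
    len : ∀ As → length (laterInserts As) ≡ laterCount (length As)
    len [] = refl
    len (r ∷ As) = trans (length-map _ (inserts As)) (length-inserts As)

  module Free = Families unrestricted
  module Dom  = Families dominated

  -- Combinatorially, exactly one of the `suc s` cyclic shifts of the runs brings the largest
  -- maximum to the front. The proof compares recursions instead: they differ only in the number of
  -- insertions, t against t - 1, and t · (t - 1) a_{t-1} is both t times the dominated term and the
  -- unrestricted term for (t - 1) a_{t-1}.
  number-free : ∀ s m → Free.number (suc s) m ≡ suc s * Dom.number (suc s) m
  number-free s m = go m s m ≤-refl
    where
    open ≡-Reasoning
    go : ∀ f s m → m ≤ f → Free.number (suc s) m ≡ suc s * Dom.number (suc s) m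
    go f s m m≤f with suc s ≤? m
    ... | no ¬p = trans (Free.number-small s m (≤-pred (≰⇒> ¬p)))
                    (sym (trans (cong (suc s *_) (Dom.number-small s m (≤-pred (≰⇒> ¬p))))
                        (*-zeroʳ s)))
    go zero s .zero z≤n | yes ()
    go (suc f) s m m≤f | yes p = subst (λ k → Free.number (suc s) k ≡ suc s * Dom.number (suc s) k)
        (m+[n∸m]≡n p)
        (step s (m ∸ suc s) (go f) (≤-trans (∸-monoˡ-≤ (suc s) m≤f) (m∸n≤m f s)))
      where
      step : ∀ s k → (∀ s m → m ≤ f → Free.number (suc s) m ≡ suc s * Dom.number (suc s) m) → k ≤ f
          →
        Free.number (suc s) (suc s + k) ≡ suc s * Dom.number (suc s) (suc s + k)
      step zero k ih k≤f = begin
        Free.number 1 (1 + k)                            ≡⟨ Free.number-rec 0 k ⟩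
        Free.number 1 k * 2 + Free.number 0 k * 1        ≡⟨ cong₂ (λ a b → a * 2 + b * 1)
            (trans (ih 0 k k≤f) (*-identityˡ _)) (zero-runs k) ⟩
        Dom.number 1 k * 2 + Dom.number 0 k * 1          ≡⟨ sym (Dom.number-rec 0 k) ⟩
        Dom.number 1 (1 + k)                             ≡⟨ sym (*-identityˡ _) ⟩
        1 * Dom.number 1 (1 + k)                         ∎
        where
        zero-runs : ∀ k → Free.number 0 k ≡ Dom.number 0 k
        zero-runs zero = refl
        zero-runs (suc k) = refl
      step (suc s) k ih k≤f = begin
        Free.number (2 + s) (2 + s + k)
          ≡⟨ Free.number-rec (suc s) k ⟩
        Free.number (2 + s) k * (3 + s) + Free.number (suc s) k * (2 + s)
          ≡⟨ cong₂ (λ a b → a * (3 + s) + b * (2 + s)) (ih (suc s) k k≤f) (ih s k k≤f) ⟩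
        (2 + s) * Dom.number (2 + s) k * (3 + s) + (suc s * Dom.number (suc s) k) * (2 + s)
          ≡⟨ arith s (Dom.number (2 + s) k) (Dom.number (suc s) k) ⟩
        (2 + s) * (Dom.number (2 + s) k * (3 + s) + Dom.number (suc s) k * suc s)
          ≡⟨ cong ((2 + s) *_) (sym (Dom.number-rec (suc s) k)) ⟩
        (2 + s) * Dom.number (2 + s) (2 + s + k) ∎
        where
        arith : ∀ s a b → (2 + s) * a * (3 + s) + (suc s * b) * (2 + s) ≡ (2 + s) *
            (a * (3 + s) + b * suc s)
        arith = solve-∀

-- Walks in the state graph as sequences of diagonals.

module Diagonals where
  open ListCounting
  open Runs
  open import Data.Nat using (ℕ; zero; suc; _+_; _∸_; _<_; _>_; s≤s)
  open import Data.Nat.Properties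
  open import Data.Nat.Tactic.RingSolver using (solve-∀)
  open import Data.Bool using (Bool; true; false; not)
  open import Data.Product using (∃; ∃₂; _×_; _,_; proj₁; proj₂)
  open import Data.Sum using (inj₁; inj₂)
  open import Data.Unit using (⊤)
  open import Data.Empty using (⊥; ⊥-elim)
  open import Data.List using (List; []; _∷_; _++_; map; length)
  open import Data.List.Properties using (length-++; map-++; ∷-injective; ++-assoc)
  open import Data.List.Membership.Propositional using (_∈_)
  open import Data.List.Membership.Propositional.Properties
    using (∈-++⁺ʳ; ∈-++⁻)
  open import Data.List.Relation.Unary.Any using (here; there)
  open import Data.List.Relation.Unary.All as All using (All; []; _∷_)
  open import Data.List.Relation.Unary.AllPairs using ([]; _∷_)
  open import Data.List.Relation.Unary.Unique.Propositional using (Unique)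
  import Data.List.Relation.Unary.Unique.Propositional.Properties as Unq
  open import Data.List.Relation.Binary.Permutation.Propositional using
      (_↭_; ↭-refl; ↭-trans; ↭-reflexive)
  import Data.List.Relation.Binary.Permutation.Propositional.Properties as Perm
  open import Relation.Binary.PropositionalEquality

  private variable
    A : Set

  last : A → List A → A
  last x []       = x
  last x (y ∷ ys) = last y ys

  last-∈ : (x : A) (xs : List A) → last x xs ∈ (x ∷ xs)
  last-∈ x [] = here refl
  last-∈ x (y ∷ ys) = there (last-∈ y ys)

  last-++ : (x : A) (xs ys : List A) → last x (xs ++ ys) ≡ last (last x xs) ys
  last-++ x [] ys = refl
  last-++ x (y ∷ xs) ys = last-++ y xs ys

  -- The valid states (x , y) with y − x = d + 1 form the diagonal (true , d), those
  -- with x − y = d + 1 the diagonal (false , d); ((c , d) , k) is the state whose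
  -- smaller coordinate is k + 1.
  Diagonal Point : Set
  Diagonal = Bool × ℕ
  Point    = Diagonal × ℕ

  -- At level 0 of a diagonal of offset d + 1 one ball lands, and one beat later the other is d + 1
  -- beats from landing. With `keep` the thrown ball is still the lower one, so d + 1 = k + e + 2.
  -- With `turn` it goes above, and the other ball, now the lower one, fixes the level d.
  data Throw : Diagonal → Diagonal → ℕ → Set where
    keep : ∀ {c} k e → Throw (c , suc (k + e)) (c , e) k
    turn : ∀ {c c′ d e} → c′ ≡ not c → Throw (c , d) (c′ , e) d

  data Step : Point → Point → Set where
    down  : ∀ {d k} → Step (d , suc k) (d , k)
    throw : ∀ {d e k} → Throw d e k → Step (d , 0) (e , k)

  height : Diagonal → Diagonal → ℕ
  height (true  , d) (true  , e) = d ∸ suc e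
  height (false , d) (false , e) = d ∸ suc e
  height (true  , d) (false , e) = d
  height (false , d) (true  , e) = d

  -- The level at which a diagonal is entered is a function of the two diagonals. A cycle therefore
  -- carries no more information than its cyclic sequence of diagonals.
  Throw-height : ∀ {d e k} → Throw d e k → k ≡ height d e
  Throw-height {true , _} (keep k e) = sym (m+n∸n≡m k e)
  Throw-height {false , _} (keep k e) = sym (m+n∸n≡m k e)
  Throw-height {true , _} (turn refl) = refl
  Throw-height {false , _} (turn refl) = refl

  Link : Diagonal → Diagonal → Set
  Link d e = Throw d e (height d e)

  Link-keep : ∀ c {d e} → d > e → Link (c , d) (c , e)
  Link-keep c {suc d} {e} (s≤s e≤d) with subst (λ z → Throw (c , suc z) (c , e) (d ∸ e))
      (m∸n+n≡m e≤d) (keep (d ∸ e) e)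
  Link-keep true  _ | t = t
  Link-keep false _ | t = t

  Link-keep⁻ : ∀ c {d e} → Link (c , d) (c , e) → d > e
  Link-keep⁻ c l = go l
    where
    not≢ : ∀ c → c ≢ not c
    not≢ true ()
    not≢ false ()
    go : ∀ {d e k} → Throw (c , d) (c , e) k → d > e
    go (keep k e) = s≤s (m≤n+m e k)
    go (turn p) = ⊥-elim (not≢ c p)

  Link-turn : ∀ c {d e} → Link (c , d) (not c , e)
  Link-turn true = turn refl
  Link-turn false = turn refl

  falling : Diagonal → ℕ → List Point
  falling d zero    = []
  falling d (suc k) = (d , k) ∷ falling d k

  -- `p` is the diagonal from which the first one is entered; it is needed to know the level of
  -- entry.
  expand : Diagonal → List Diagonal → List Point
  expand p []       = []
  expand p (d ∷ ds) = (d , height p d) ∷ falling d (height p d) ++ expand d ds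

  -- In an expanded list each visit to a diagonal ends at level 0 and has just one such point, so
  -- these points recover the sequence.
  compress : List Point → List Diagonal
  compress [] = []
  compress ((d , zero) ∷ ps)  = d ∷ compress ps
  compress ((d , suc _) ∷ ps) = compress ps

  compress-expand : ∀ p ds → compress (expand p ds) ≡ ds
  compress-expand p [] = refl
  compress-expand p (d ∷ ds) = go (height p d)
    where
    go : ∀ k → compress ((d , k) ∷ falling d k ++ expand d ds) ≡ d ∷ ds
    go zero = cong (d ∷_) (compress-expand d ds)
    go (suc k) = go k

  Chain-expand : ∀ {d} k ds → Chain Link d ds → Chain Step (d , k) (falling d k ++ expand d ds)
  Chain-expand (suc k) ds c = down ∷ Chain-expand k ds c
  Chain-expand zero [] [] = []
  Chain-expand {d} zero (e ∷ ds) (l ∷ c) = throw l ∷ Chain-expand (height d e) ds c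

  last-expand : ∀ d k ds → last (d , k) (falling d k ++ expand d ds) ≡ (last d ds , 0)
  last-expand d (suc k) ds = last-expand d k ds
  last-expand d zero [] = refl
  last-expand d zero (e ∷ ds) = last-expand e (height d e) ds

  -- The hypothesis on the last point says that the walk does not break off in the middle of a
  -- descent; without a complete last segment it would not be an expansion.
  contract : ∀ d k ps → Chain Step (d , k) ps → proj₂ (last (d , k) ps) ≡ 0 →
    ∃ λ ds → ps ≡ falling d k ++ expand d ds × Chain Link d ds × last d ds ≡ proj₁ (last (d , k) ps)
  contract d .0 [] [] refl = [] , refl , [] , refl
  contract d (suc k) (_ ∷ ps) (down ∷ c) e with contract d k ps c e
  ... | ds , refl , l , p = ds , refl , l , p
  contract d zero ((d′ , k′) ∷ ps) (throw t ∷ c) e with contract d′ k′ ps c e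
  ... | ds , refl , l , p with Throw-height t
  ... | refl = d′ ∷ ds , refl , t ∷ l , p

  ∈-falling : ∀ {d k p} → p ∈ falling d k → proj₁ p ≡ d × proj₂ p < k
  ∈-falling {k = suc k} (here refl) = refl , ≤-refl
  ∈-falling {k = suc k} (there p) with ∈-falling p
  ... | e , l = e , m<n⇒m<1+n l

  ∈-expand : ∀ {p ds x} → x ∈ expand p ds → proj₁ x ∈ ds
  ∈-expand {p} {d ∷ ds} (here refl) = here refl
  ∈-expand {p} {d ∷ ds} (there x∈) with ∈-++⁻ (falling d (height p d)) x∈
  ... | inj₁ q = here (proj₁ (∈-falling q))
  ... | inj₂ q = there (∈-expand q)

  landing-∈-expand : ∀ {p ds d} → d ∈ ds → (d , 0) ∈ expand p ds
  landing-∈-expand {p} {d ∷ ds} (here refl) = go (height p d)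
    where
    go : ∀ k → (d , 0) ∈ ((d , k) ∷ falling d k ++ expand d ds)
    go zero = here refl
    go (suc k) = there (go k)
  landing-∈-expand {p} {d ∷ ds} (there q) = there (∈-++⁺ʳ (falling d (height p d))
      (landing-∈-expand q))

  Unique-falling : ∀ d k → Unique ((d , k) ∷ falling d k)
  Unique-falling d k = ∉-Unique (λ p → <-irrefl refl (proj₂ (∈-falling p))) (go k)
    where
    go : ∀ k → Unique (falling d k)
    go zero = []
    go (suc k) = Unique-falling d k

  Unique-expand : ∀ p ds → Unique ds → Unique (expand p ds)
  Unique-expand p [] u = []
  Unique-expand p (d ∷ ds) u = Unq.++⁺ (Unique-falling d (height p d))
      (Unique-expand d ds (Unique-tail u)) disj
    where
    disj : ∀ {x} → x ∈ ((d , height p d) ∷ falling d (height p d)) × x ∈ expand d ds → ⊥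
    disj (here refl , q) = Unique-∉ u (∈-expand q)
    disj (there r , q) = Unique-∉ u (subst (_∈ ds) (proj₁ (∈-falling r)) (∈-expand q))

  -- Two visits to one diagonal would both run down to its point of level 0.
  Unique-expand⁻ : ∀ p ds → Unique (expand p ds) → Unique ds
  Unique-expand⁻ p [] u = []
  Unique-expand⁻ p (d ∷ ds) u with Unique-++⁻ ((d , height p d) ∷ falling d (height p d)) u
  ... | _ , u′ , disj = ∉-Unique
      (λ d∈ → disj (landing (height p d)) (landing-∈-expand d∈)) (Unique-expand⁻ d ds u′)
    where
    landing : ∀ k → (d , 0) ∈ ((d , k) ∷ falling d k)
    landing zero = here refl
    landing (suc k) = there (landing k)

  turns : Diagonal → List Diagonal → ℕ
  turns p [] = 0
  turns (true  , _) ((true  , e) ∷ ds) = turns (true , e) ds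
  turns (false , _) ((false , e) ∷ ds) = turns (false , e) ds
  turns (true  , _) ((false , e) ∷ ds) = suc e + turns (false , e) ds
  turns (false , _) ((true  , e) ∷ ds) = suc e + turns (true , e) ds

  length-falling : ∀ d k → length (falling d k) ≡ k
  length-falling d zero = refl
  length-falling d (suc k) = cong suc (length-falling d k)

  -- The time spent on d_i, entered from d_{i-1}, is d_{i-1} − d_i within a run and the
  -- offset of d_{i-1} at a change of color, so the sum telescopes to the heads of the runs.
  length-expand : ∀ {p} ds → Chain Link p ds →
    length (expand p ds) + proj₂ (last p ds) ≡ proj₂ p + turns p ds
  length-expand {p} [] [] = sym (+-identityʳ _)
  length-expand {p} (d ∷ ds) (l ∷ c) = begin
    suc (length (falling d h ++ expand d ds)) + v
      ≡⟨ cong (λ z → suc z + v) (trans (length-++ (falling d h)) (cong (_+ length (expand d ds))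
          (length-falling d h))) ⟩
    suc (h + length (expand d ds) + v)
      ≡⟨ cong suc (+-assoc h _ v) ⟩
    suc h + (length (expand d ds) + v)
      ≡⟨ cong (suc h +_) (length-expand ds c) ⟩
    suc h + (proj₂ d + turns d ds)
      ≡⟨ sym (+-assoc (suc h) (proj₂ d) _) ⟩
    suc h + proj₂ d + turns d ds
      ≡⟨ go d ds l ⟩
    proj₂ p + turns p (d ∷ ds) ∎
    where
    open ≡-Reasoning
    h = height p d
    v = proj₂ (last d ds)
    go : ∀ {p k} d ds → Throw p d k → suc k + proj₂ d + turns d ds ≡ proj₂ p + turns p (d ∷ ds)
    go (true , e) ds (keep k .e) = refl
    go (false , e) ds (keep k .e) = refl
    go {true , k} (false , e) ds (turn refl) = trans (cong (_+ turns (false , e) ds)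
        (sym (+-suc k e))) (+-assoc k (suc e) _)
    go {false , k} (true , e) ds (turn refl) = trans (cong (_+ turns (true , e) ds)
        (sym (+-suc k e))) (+-assoc k (suc e) _)

  colored : Bool → List ℕ → List Diagonal
  colored c = map (c ,_)

  interleave : Family → Family → List Diagonal
  interleave ((x , xs) ∷ As) ((y , ys) ∷ Bs) =
    (true , x) ∷ colored true xs ++ (false , y) ∷ colored false ys ++ interleave As Bs
  interleave _ _ = []

  last-colored : ∀ c x xs → last (c , x) (colored c xs) ≡ (c , last x xs)
  last-colored c x [] = refl
  last-colored c x (y ∷ xs) = last-colored c y xs

  Chain-colored : ∀ c {x} xs {ds} → Chain _>_ x xs → Chain Link (c , last x xs) ds →
    Chain Link (c , x) (colored c xs ++ ds)
  Chain-colored c [] [] l = l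
  Chain-colored c (y ∷ xs) (p ∷ ch) l = Link-keep c p ∷ Chain-colored c xs ch l

  Chain-interleave : ∀ {v} As Bs → All Descending As → All Descending Bs →
    Chain Link (false , v) (interleave As Bs)
  Chain-interleave [] [] _ _ = []
  Chain-interleave [] (B ∷ Bs) _ _ = []
  Chain-interleave (A ∷ As) [] _ _ = []
  Chain-interleave ((x , xs) ∷ As) ((y , ys) ∷ Bs) (d ∷ ds) (e ∷ es) =
    Link-turn false ∷ Chain-colored true xs d (Link-turn true ∷ Chain-colored false ys e
        (Chain-interleave As Bs ds es))

  turns-colored : ∀ c x xs ds → turns (c , x) (colored c xs ++ ds) ≡ turns (c , last x xs) ds
  turns-colored c x [] ds = refl
  turns-colored true x (y ∷ xs) ds = turns-colored true y xs ds
  turns-colored false x (y ∷ xs) ds = turns-colored false y xs ds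

  turns-interleave : ∀ v As Bs → length As ≡ length Bs →
    turns (false , v) (interleave As Bs) ≡ weight As + weight Bs
  turns-interleave v [] [] _ = refl
  turns-interleave v ((x , xs) ∷ As) ((y , ys) ∷ Bs) len = begin
    suc x + turns (true , x) (colored true xs ++ (false , y) ∷ rest)
      ≡⟨ cong (suc x +_) (turns-colored true x xs _) ⟩
    suc x + (suc y + turns (false , y) rest)
      ≡⟨ cong (λ z → suc x + (suc y + z)) (trans (turns-colored false y ys _)
          (turns-interleave _ As Bs (suc-injective len))) ⟩
    suc x + (suc y + (weight As + weight Bs))
      ≡⟨ arith (suc x) (suc y) (weight As) (weight Bs) ⟩
    suc x + weight As + (suc y + weight Bs) ∎
    where
    open ≡-Reasoning
    rest = colored false ys ++ interleave As Bs
    arith : ∀ a b c d → a + (b + (c + d)) ≡ a + c + (b + d)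
    arith = solve-∀

  mutual
    -- The sequence is parsed from the right, with `ys` the remainder of the run to which `v`
    -- belongs; the caller adds the head of that run. Ending in color `false` gives every `true` run
    -- its `false` partner, so both families get the same number of runs.
    split-false : ∀ {v} ds → Chain Link (false , v) ds → proj₁ (last (false , v) ds) ≡ false →
      ∃ λ ys → ∃₂ λ As Bs → Chain _>_ v ys × ds ≡ colored false ys ++ interleave As Bs ×
        length As ≡ length Bs × All Descending As × All Descending Bs
    split-false [] [] e = [] , [] , [] , [] , refl , refl , [] , []
    split-false ((false , w) ∷ ds) (l ∷ c) e with split-false ds c e
    ... | ys , As , Bs , ch , refl , len , dA , dB = w ∷ ys , As , Bs , Link-keep⁻ false l ∷ ch ,
        refl , len , dA , dB
    split-false ((true , w) ∷ ds) (l ∷ c) e with split-true ds c e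
    ... | xs , As , (y , ys) , Bs , ch , refl , len , dA , dB , dBs =
      [] , (w , xs) ∷ As , (y , ys) ∷ Bs , [] , refl , cong suc len , ch ∷ dA , dB ∷ dBs

    split-true : ∀ {v} ds → Chain Link (true , v) ds → proj₁ (last (true , v) ds) ≡ false →
      ∃₂ λ xs As → ∃₂ λ B Bs → Chain _>_ v xs ×
        ds ≡ colored true xs ++ colored false (entries B) ++ interleave As Bs ×
        length As ≡ length Bs × All Descending As × Descending B × All Descending Bs
    split-true [] [] ()
    split-true ((true , w) ∷ ds) (l ∷ c) e with split-true ds c e
    ... | xs , As , B , Bs , ch , refl , r = w ∷ xs , As , B , Bs , Link-keep⁻ true l ∷ ch , refl ,
        r
    split-true ((false , w) ∷ ds) (l ∷ c) e with split-false ds c e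
    ... | ys , As , Bs , ch , refl , len , dA , dB = [] , As , (w , ys) , Bs , [] , refl , len , dA
        , ch , dB

  interleave-↭ : ∀ As Bs → length As ≡ length Bs →
    interleave As Bs ↭ colored true (support As) ++ colored false (support Bs)
  interleave-↭ [] [] _ = ↭-refl
  interleave-↭ ((x , xs) ∷ As) ((y , ys) ∷ Bs) len =
    subst₂ (λ l r → (true , x) ∷ colored true xs ++ b ++ interleave As Bs ↭ (true , x) ∷ l ++
        (false , y) ∷ r)
      (sym (map-++ (true ,_) xs (support As))) (sym (map-++ (false ,_) ys (support Bs)))
      (↭-trans (Perm.++⁺ˡ ((true , x) ∷ colored true xs)
          (↭-trans (Perm.++⁺ˡ b (interleave-↭ As Bs (suc-injective len)))
            (Perm.shifts b (colored true (support As)))))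
        (↭-reflexive (cong ((true , x) ∷_) (sym
            (++-assoc (colored true xs) (colored true (support As)) _)))))
    where
    b = (false , y) ∷ colored false ys

  Avoids : Bool → List Diagonal → Set
  Avoids c []             = ⊤
  Avoids c ((c′ , _) ∷ _) = c ≢ c′

  -- A block of color `c` stops exactly where the other color begins, so both decompositions cut at
  -- the same place.
  colored-cut : ∀ c xs xs′ {r r′} → Avoids c r → Avoids c r′ →
    colored c xs ++ r ≡ colored c xs′ ++ r′ → xs ≡ xs′ × r ≡ r′
  colored-cut c [] [] a a′ e = refl , e
  colored-cut c [] (x ∷ xs′) {[]} a a′ ()
  colored-cut c [] (x ∷ xs′) {d ∷ r} a a′ e = ⊥-elim (a (sym (cong proj₁ (proj₁ (∷-injective e)))))
  colored-cut c (x ∷ xs) [] {r′ = []} a a′ ()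
  colored-cut c (x ∷ xs) [] {r′ = d ∷ r′} a a′ e = ⊥-elim (a′ (cong proj₁ (proj₁ (∷-injective e))))
  colored-cut c (x ∷ xs) (x′ ∷ xs′) a a′ e with ∷-injective e
  ... | refl , e′ with colored-cut c xs xs′ a a′ e′
  ... | refl , q = refl , q

  interleave-injective : ∀ As Bs As′ Bs′ → length As ≡ length Bs → length As′ ≡ length Bs′ →
    interleave As Bs ≡ interleave As′ Bs′ → As ≡ As′ × Bs ≡ Bs′
  interleave-injective [] [] [] [] _ _ e = refl , refl
  interleave-injective [] [] (_ ∷ _) (_ ∷ _) _ _ ()
  interleave-injective (_ ∷ _) (_ ∷ _) [] [] _ _ ()
  interleave-injective ((x , xs) ∷ As) ((y , ys) ∷ Bs) ((x′ , xs′) ∷ As′) ((y′ , ys′) ∷ Bs′) l l′ e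
    with ∷-injective e
  ... | refl , e₁ with colored-cut true xs xs′ (λ ()) (λ ()) e₁
  ... | refl , e₂ with ∷-injective e₂
  ... | refl , e₃ with colored-cut false ys ys′ (avoid As Bs) (avoid As′ Bs′) e₃
    where
    avoid : ∀ As Bs → Avoids false (interleave As Bs)
    avoid [] [] = _
    avoid [] (_ ∷ _) = _
    avoid (_ ∷ _) [] = _
    avoid (_ ∷ _) (_ ∷ _) ()
  ... | refl , e₄ with interleave-injective As Bs As′ Bs′ (suc-injective l) (suc-injective l′) e₄
  ... | refl , refl = refl , refl

-- Cycles up to rotation correspond to pairs of families.

module Codes where
  open ListCounting
  open Runs
  open Enumeration
  open Diagonals
  open import Data.Nat using (ℕ; zero; suc; _+_; _∸_; _≤_; _<_; _>_; s≤s)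
  open import Data.Nat.Properties
  open import Data.Bool using (Bool; true; false; not)
  open import Data.Bool.Properties using (not-involutive)
  open import Data.Product using (∃; ∃₂; _×_; _,_; proj₁; proj₂)
  open import Data.Sum using (_⊎_; inj₁; inj₂)
  open import Data.Unit using (⊤)
  open import Data.Empty using (⊥; ⊥-elim)
  open import Data.List using (List; []; _∷_; _++_; map; length; cartesianProduct)
  open import Data.List.Properties using (length-map; ++-identityʳ)
  open import Data.List.Membership.Propositional using (_∈_)
  open import Data.List.Membership.Propositional.Properties
    using (∈-++⁺ˡ; ∈-++⁻; ∈-map⁺; ∈-map⁻; ∈-∃++; ∈-cartesianProduct⁺; ∈-cartesianProduct⁻)
  open import Data.List.Relation.Unary.Any using (here; there)
  open import Data.List.Relation.Unary.All as All using (All; []; _∷_)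
  import Data.List.Relation.Unary.All.Properties as All
  open import Data.List.Relation.Unary.AllPairs using ([]; _∷_)
  open import Data.List.Relation.Unary.Unique.Propositional using (Unique)
  import Data.List.Relation.Unary.Unique.Propositional.Properties as Unq
  open import Data.List.Relation.Binary.Permutation.Propositional using (↭-sym)
  import Data.List.Relation.Binary.Permutation.Propositional.Properties as Perm
  open import Relation.Binary.PropositionalEquality
  open import Relation.Binary.Definitions using (tri<; tri≈; tri>)
  open import Relation.Nullary using (¬_)

  private variable
    A : Set
    R : A → A → Set

  Chain-++⁺ : ∀ {x : A} xs {ys} → Chain R x xs → Chain R (last x xs) ys → Chain R x (xs ++ ys)
  Chain-++⁺ [] [] d = d
  Chain-++⁺ (x ∷ xs) (r ∷ c) d = r ∷ Chain-++⁺ xs c d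

  Chain-++⁻ : ∀ {x : A} xs {ys} → Chain R x (xs ++ ys) → Chain R x xs × Chain R (last x xs) ys
  Chain-++⁻ [] c = [] , c
  Chain-++⁻ (x ∷ xs) (r ∷ c) with Chain-++⁻ xs c
  ... | d , e = r ∷ d , e

  Closed : List Point → Set
  Closed []       = ⊥
  Closed (p ∷ ps) = Chain Step p ps × Step (last p ps) p

  record Cycle (n : ℕ) (ps : List Point) : Set where
    constructor cycle
    field
      length≡  : length ps ≡ n
      distinct : Unique ps
      closed   : Closed ps

  Closed-Rot : ∀ {ps qs} → Rot ps qs → Closed ps → Closed qs
  Closed-Rot ([] , v , refl , refl) c = subst Closed (sym (++-identityʳ v)) c
  Closed-Rot (p ∷ u , [] , refl , refl) c = subst Closed (++-identityʳ (p ∷ u)) c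
  Closed-Rot (p ∷ u , q ∷ v , refl , refl) (c , s) with Chain-++⁻ u c
  ... | cu , (st ∷ cv) =
    Chain-++⁺ v cv (subst (λ z → Step z p) (last-++ p u (q ∷ v)) s ∷ cu)
    , subst (λ z → Step z q) (sym (last-++ q v (p ∷ u))) st

  Cycle-Rot : ∀ {n ps qs} → Rot ps qs → Cycle n ps → Cycle n qs
  Cycle-Rot r (cycle l u c) =
    cycle (trans (sym (Perm.↭-length (Rot-↭ r))) l) (Unique-resp-↭ (Rot-↭ r) u) (Closed-Rot r c)

  swapPoint : Point → Point
  swapPoint ((c , d) , k) = (not c , d) , k

  swapPoint-involutive : ∀ p → swapPoint (swapPoint p) ≡ p
  swapPoint-involutive ((c , d) , k) = cong (λ c → (c , d) , k) (not-involutive c)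

  swapPoint-injective : ∀ {p q} → swapPoint p ≡ swapPoint q → p ≡ q
  swapPoint-injective {p} {q} e =
    trans (sym (swapPoint-involutive p)) (trans (cong swapPoint e) (swapPoint-involutive q))

  map-swap-involutive : ∀ ps → map swapPoint (map swapPoint ps) ≡ ps
  map-swap-involutive [] = refl
  map-swap-involutive (p ∷ ps) = cong₂ _∷_ (swapPoint-involutive p) (map-swap-involutive ps)

  Step-swap : ∀ {p q} → Step p q → Step (swapPoint p) (swapPoint q)
  Step-swap down = down
  Step-swap (throw (keep k e)) = throw (keep k e)
  Step-swap (throw (turn refl)) = throw (turn refl)

  last-map : {A B : Set} (f : A → B) (x : A) (xs : List A) → last (f x) (map f xs) ≡ f (last x xs)
  last-map f x [] = refl
  last-map f x (y ∷ ys) = last-map f y ys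

  Cycle-swap : ∀ {n ps} → Cycle n ps → Cycle n (map swapPoint ps)
  Cycle-swap {ps = p ∷ ps} (cycle l u (c , s)) =
    cycle (trans (length-map swapPoint (p ∷ ps)) l) (Unq.map⁺ swapPoint-injective u)
      (chain c , subst (λ z → Step z (swapPoint p)) (sym (last-map swapPoint p ps)) (Step-swap s))
    where
    chain : ∀ {p ps} → Chain Step p ps → Chain Step (swapPoint p) (map swapPoint ps)
    chain [] = []
    chain (s ∷ c) = Step-swap s ∷ chain c

  -- On color `true` this is the lexicographic order by offset and then level, and every point of
  -- color `false` counts as below. Since level falls along a segment, the maximum of a cycle is the
  -- first point of its segment on the largest `true` diagonal.
  Below : ℕ → ℕ → Point → Set
  Below a k ((false , _) , _) = ⊤
  Below a k ((true  , e) , j) = e < a ⊎ (e ≡ a × j ≤ k)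

  record Normal (ps : List Point) : Set where
    constructor normal
    field
      {offset}  : ℕ
      {level}   : ℕ
      {rest}    : List Point
      shape     : ps ≡ ((true , offset) , level) ∷ rest
      below     : All (Below offset level) ps

  -- Both heads are maxima of the same set of points, so they agree; a rotation of a duplicate-free
  -- list is determined by its head.
  Normal-unique : ∀ {ps qs} → Unique ps → Rot ps qs → Normal ps → Normal qs → ps ≡ qs
  Normal-unique u r (normal {a} {k} refl b) (normal {a′} {k′} refl b′)
    with All.lookup b (Perm.∈-resp-↭ (↭-sym (Rot-↭ r)) (here refl))
       | All.lookup b′ (Perm.∈-resp-↭ (Rot-↭ r) (here refl))
  ... | inj₁ p | inj₁ q = ⊥-elim (<-asym p q)
  ... | inj₁ p | inj₂ (refl , _) = ⊥-elim (<-irrefl refl p)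
  ... | inj₂ (refl , _) | inj₁ q = ⊥-elim (<-irrefl refl q)
  ... | inj₂ (refl , p) | inj₂ (_ , q) with ≤-antisym p q
  ... | refl = cong (_ ∷_) (Rot-head-injective u r)

  IsFalse : Point → Set
  IsFalse ((c , _) , _) = c ≡ false

  Below-trans : ∀ {a k a′ k′} → Below a′ k′ ((true , a) , k) → ∀ {p} → Below a k p → Below a′ k′ p
  Below-trans h {(false , _) , _} _ = _
  Below-trans (inj₁ p) {(true , _) , _} (inj₁ q) = inj₁ (<-trans q p)
  Below-trans (inj₁ p) {(true , _) , _} (inj₂ (refl , _)) = inj₁ p
  Below-trans (inj₂ (refl , p)) {(true , _) , _} (inj₁ q) = inj₁ q
  Below-trans (inj₂ (refl , p)) {(true , _) , _} (inj₂ (refl , q)) = inj₂ (refl , ≤-trans q p)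

  Below-total : ∀ a k a′ k′ → Below a k ((true , a′) , k′) ⊎ Below a′ k′ ((true , a) , k)
  Below-total a k a′ k′ with <-cmp a a′ | ≤-total k k′
  ... | tri< p _ _ | _ = inj₂ (inj₁ p)
  ... | tri> _ _ p | _ = inj₁ (inj₁ p)
  ... | tri≈ _ refl _ | inj₁ p = inj₂ (inj₂ (refl , p))
  ... | tri≈ _ refl _ | inj₂ p = inj₁ (inj₂ (refl , p))

  maximum : ∀ ps → All IsFalse ps ⊎ (∃₂ λ a k → ((true , a) , k) ∈ ps × All (Below a k) ps)
  maximum [] = inj₁ []
  maximum (((false , e) , j) ∷ ps) with maximum ps
  ... | inj₁ f = inj₁ (refl ∷ f)
  ... | inj₂ (a , k , p , b) = inj₂ (a , k , there p , _ ∷ b)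
  maximum (((true , e) , j) ∷ ps) with maximum ps
  ... | inj₁ f = inj₂ (e , j , here refl , inj₂ (refl , ≤-refl) ∷ All.map
      (λ { {(false , _) , _} refl → _ }) f)
  ... | inj₂ (a , k , p , b) with Below-total a k e j
  ... | inj₁ q = inj₂ (a , k , there p , q ∷ b)
  ... | inj₂ q = inj₂ (e , j , here refl , inj₂ (refl , ≤-refl) ∷ All.map
      (λ {x} → Below-trans q {x}) b)

  -- As long as the orange ball stays above the blue one, its height drops at every beat.
  ¬all-false : ∀ ps → Closed ps → ¬ All IsFalse ps
  ¬all-false (p ∷ ps) (c , s) f =
    <-irrefl refl (≤-trans (drop s (All.lookup f (last-∈ p ps)) (All.lookup f (here refl)))
        (drops c f))
    where
    top : Point → ℕ
    top ((_ , d) , k) = k + d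
    drop : ∀ {p q} → Step p q → IsFalse p → IsFalse q → top q < top p
    drop down _ _ = ≤-refl
    drop (throw (keep k e)) _ _ = ≤-refl
    drop (throw (turn refl)) refl ()
    drops : ∀ {p ps} → Chain Step p ps → All IsFalse (p ∷ ps) → top (last p ps) ≤ top p
    drops [] _ = ≤-refl
    drops (s ∷ c) (f ∷ g ∷ fs) = ≤-trans (drops c (g ∷ fs)) (<⇒≤ (drop s f g))

  normalise : ∀ {ps} → Closed ps → ∃ λ qs → Rot ps qs × Normal qs
  normalise {ps} c with maximum ps
  ... | inj₁ f = ⊥-elim (¬all-false ps c f)
  ... | inj₂ (a , k , p , b) with ∈-∃++ p
  ... | u , v , refl = _ ∷ v ++ u , (u , _ ∷ v , refl , refl)
        , normal refl (Perm.All-resp-↭ (Perm.++-comm u (((true , a) , k) ∷ v)) b)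

  Code : Set
  Code = Family × Family

  record IsCode (n : ℕ) (code : Code) : Set where
    constructor isCode
    As = proj₁ code
    Bs = proj₂ code
    field
      {runs}    : ℕ
      lengthˡ   : length As ≡ suc runs
      lengthʳ   : length Bs ≡ suc runs
      weights   : weight As + weight Bs ≡ n
      validˡ    : Valid As
      validʳ    : Valid Bs
      dominates : Dominated As

  -- Letting `s` run below `n` covers everything, since `suc s` runs already weigh at least `suc s`.
  codes : ℕ → List Code
  codes n = collect (λ s → collect (λ m → cartesianProduct (Dom.families (suc s) m)
      (Free.families (suc s) (n ∸ m))) (suc n)) n

  ∈-codes⁺ : ∀ {n x} → IsCode n x → x ∈ codes n
  ∈-codes⁺ {n} {As , Bs} (isCode {s} lA lB refl vA vB d) =
    ∈-collect⁺ _ s<n (∈-collect⁺ _ (s≤s (m≤m+n (weight As) (weight Bs)))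
      (∈-cartesianProduct⁺ (Dom.∈-families⁺ (lA , refl , vA , d))
        (Free.∈-families⁺ (lB , sym (m+n∸m≡n (weight As) (weight Bs)) , vB , _))))
    where
    s<n : s < n
    s<n = ≤-trans (subst (_≤ weight As) lA (Dom.length≤weight As)) (m≤m+n (weight As) (weight Bs))

  ∈-codes⁻ : ∀ {n x} → x ∈ codes n → IsCode n x
  ∈-codes⁻ {n} p with ∈-collect⁻ _ n p
  ... | s , _ , q with ∈-collect⁻ _ (suc n) q
  ... | m , s≤s m≤n , r with ∈-cartesianProduct⁻ (Dom.families (suc s) m)
      (Free.families (suc s) (n ∸ m)) r
  ... | pA , pB with Dom.∈-families⁻ {suc s} {m} pA | Free.∈-families⁻ {suc s} {n ∸ m} pB
  ... | lA , wA , vA , d | lB , wB , vB , _ = isCode lA lB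
      (trans (cong₂ _+_ wA wB) (m+[n∸m]≡n m≤n)) vA vB d

  Unique-codes : ∀ n → Unique (codes n)
  Unique-codes n = Unique-collect _ n
    (λ s → Unique-collect _ (suc n)
      (λ m → Unq.cartesianProduct⁺ (Dom.Unique-families (suc s) m)
          (Free.Unique-families (suc s) (n ∸ m)))
      (λ {i} {j} p q → trans (sym (proj₂ (left s i p))) (proj₂ (left s j q))))
    (λ {i} {j} p q → suc-injective (trans (sym (len i p)) (len j q)))
    where
    product : ℕ → ℕ → List Code
    product s m = cartesianProduct (Dom.families (suc s) m) (Free.families (suc s) (n ∸ m))
    left : ∀ s m {x} → x ∈ product s m → length (proj₁ x) ≡ suc s × weight (proj₁ x) ≡ m
    left s m p with ∈-cartesianProduct⁻ (Dom.families (suc s) m) (Free.families (suc s) (n ∸ m)) p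
    ... | pA , _ with Dom.∈-families⁻ {suc s} {m} pA
    ... | l , w , _ = l , w
    len : ∀ s {x} → x ∈ collect (product s) (suc n) → length (proj₁ x) ≡ suc s
    len s p with ∈-collect⁻ _ (suc n) p
    ... | m , _ , q = proj₁ (left s m q)

  diagonals : Code → List Diagonal
  diagonals (As , Bs) = interleave As Bs

  -- The walk is entered from its own last diagonal, which makes it close up. The default
  -- `(true , 0)` would only be returned for an empty list.
  points : Code → List Point
  points x = expand (last (true , 0) (diagonals x)) (diagonals x)

  points-injective : ∀ {n x y} → IsCode n x → IsCode n y → points x ≡ points y → x ≡ y
  points-injective {x = As , Bs} {As′ , Bs′} (isCode lA lB _ _ _ _) (isCode lA′ lB′ _ _ _ _) e
    with interleave-injective As Bs As′ Bs′ (trans lA (sym lB)) (trans lA′ (sym lB′))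
      (trans (sym (compress-expand _ _)) (trans (cong compress e) (compress-expand _ _)))
  ... | refl , refl = refl

  Unique-interleave⁺ : ∀ As Bs → length As ≡ length Bs → Unique (support As) → Unique (support Bs) →
    Unique (interleave As Bs)
  Unique-interleave⁺ As Bs len uA uB = Unique-resp-↭ (↭-sym (interleave-↭ As Bs len))
    (Unq.++⁺ (Unq.map⁺ (cong proj₂) uA) (Unq.map⁺ (cong proj₂) uB) disj)
    where
    disj : ∀ {x} → x ∈ colored true (support As) × x ∈ colored false (support Bs) → ⊥
    disj (p , q) with ∈-map⁻ _ p | ∈-map⁻ _ q
    ... | _ , _ , refl | _ , _ , ()

  Unique-map⁻ : {A B : Set} (f : A → B) (xs : List A) → Unique (map f xs) → Unique xs
  Unique-map⁻ f [] _ = []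
  Unique-map⁻ f (x ∷ xs) u = ∉-Unique (λ p → Unique-∉ u (∈-map⁺ f p))
      (Unique-map⁻ f xs (Unique-tail u))

  Unique-interleave⁻ : ∀ As Bs → length As ≡ length Bs → Unique (interleave As Bs) →
    Unique (support As) × Unique (support Bs)
  Unique-interleave⁻ As Bs len u with Unique-++⁻ (colored true (support As))
      (Unique-resp-↭ (interleave-↭ As Bs len) u)
  ... | uA , uB , _ = Unique-map⁻ _ _ uA , Unique-map⁻ _ _ uB

  last-interleave : ∀ d As Bs → length As ≡ length Bs → proj₁ d ≡ false → proj₁
      (last d (interleave As Bs)) ≡ false
  last-interleave d [] [] _ e = e
  last-interleave d ((x , xs) ∷ As) ((y , ys) ∷ Bs) len e =
    subst (λ z → proj₁ z ≡ false)
      (sym (trans (last-++ (true , x) (colored true xs) _) (last-++ (false , y) (colored false ys)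
          _)))
      (last-interleave _ As Bs (suc-injective len) (cong proj₁ (last-colored false y ys)))

  support<weight : ∀ As → All Descending As → All (_< weight As) (support As)
  support<weight [] [] = []
  support<weight ((x , xs) ∷ As) (d ∷ ds) =
    All.++⁺ {xs = x ∷ xs} (All.map (λ p → s≤s (≤-trans p (m≤m+n x _))) (≤-refl ∷ below d))
      (All.map (λ p → ≤-trans p (m≤n+m _ (suc x))) (support<weight As ds))
    where
    below : ∀ {x xs} → Chain _>_ x xs → All (_≤ x) xs
    below [] = []
    below (p ∷ c) = <⇒≤ p ∷ All.map (λ q → ≤-trans q (<⇒≤ p)) (below c)

  -- The larger coordinate of the state is at most n.
  Within : ℕ → Point → Set
  Within n ((_ , d) , k) = suc (suc (k + d)) ≤ n

  OffsetWithin : ℕ → ℕ → Diagonal → Set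
  OffsetWithin a b (true  , d) = d < a
  OffsetWithin a b (false , d) = d < b

  -- On entry after a `keep` the larger coordinate equals the offset of the previous diagonal. After
  -- a `turn` it is the sum of the offsets of two diagonals of different colors, one at most `a` and
  -- the other at most `b`. It then only falls. This places the cycle of a code among the states
  -- enumerated by `C′`.
  expand-within : ∀ {a b p} ds → Chain Link p ds → All (OffsetWithin a b) (p ∷ ds) →
    All (Within (a + b)) (expand p ds)
  expand-within [] [] _ = []
  expand-within {a} {b} {p} (d ∷ ds) (l ∷ c) (wp ∷ w ∷ ws) =
    here-within ∷ All.++⁺ (fall (height p d) here-within) (expand-within ds c (w ∷ ws))
    where
    entry : ∀ {p d k} → Throw p d k → OffsetWithin a b p → OffsetWithin a b d → Within (a + b)
        (d , k)
    entry {true , _} (keep k e) w _ = ≤-trans w (m≤m+n a b)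
    entry {false , _} (keep k e) w _ = ≤-trans w (m≤n+m b a)
    entry {true , p} {d = _ , e} (turn refl) w w′ = subst (_≤ a + b) (cong suc (+-suc p e))
        (+-mono-≤ w w′)
    entry {false , p} {d = _ , e} (turn refl) w w′ =
      subst (_≤ a + b) (cong suc (trans (+-suc e p) (cong suc (+-comm e p)))) (+-mono-≤ w′ w)
    here-within = entry l wp w
    fall : ∀ k {n} → Within n (d , k) → All (Within n) (falling d k)
    fall zero w = []
    fall (suc k) w = ≤-trans (n≤1+n _) w ∷ fall k (≤-trans (n≤1+n _) w)

  module _ {n} (x : Code) (c : IsCode n x) where
    open IsCode c

    private
      len : length As ≡ length Bs
      len = trans lengthˡ (sym lengthʳ)

      final : Diagonal
      final = last (true , 0) (diagonals x)

      final-false : proj₁ final ≡ false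
      final-false with As | Bs | lengthˡ | lengthʳ | len
      ... | (x , xs) ∷ As | (y , ys) ∷ Bs | _ | _ | l = last-interleave (false , 0) ((x , xs) ∷ As)
          ((y , ys) ∷ Bs) l refl

      chain : Chain Link final (diagonals x)
      chain with final | final-false
      ... | false , v | refl = Chain-interleave As Bs (proj₁ validˡ) (proj₁ validʳ)

      turns≡ : turns final (diagonals x) ≡ n
      turns≡ with final | final-false
      ... | false , v | refl = trans (turns-interleave v As Bs len) weights

      distinct-diagonals : Unique (diagonals x)
      distinct-diagonals = Unique-interleave⁺ As Bs len (proj₂ validˡ) (proj₂ validʳ)

      last-nonempty : ∀ {d e : Diagonal} {ds} → ds ≢ [] → last d ds ≡ last e ds
      last-nonempty {ds = []} ne = ⊥-elim (ne refl)
      last-nonempty {ds = _ ∷ _} ne = refl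

      nonempty : diagonals x ≢ []
      nonempty with As | Bs | lengthˡ | lengthʳ
      ... | _ ∷ _ | _ ∷ _ | _ | _ = λ ()

    Cycle-points : Cycle n (points x)
    Cycle-points = cycle
      -- `final` is both the diagonal from which the list is entered and its last entry, so its
      -- offset occurs on both sides of `length-expand` and cancels.
      (+-cancelʳ-≡ (proj₂ final) _ _ (trans (cong (λ z → length (points x) + proj₂ z)
          (last-nonempty nonempty))
        (trans (length-expand (diagonals x) chain) (trans (+-comm (proj₂ final) _)
            (cong (_+ proj₂ final) turns≡)))))
      (Unique-expand final (diagonals x) distinct-diagonals)
      (closed′ (diagonals x) nonempty chain)
      where
      closed′ : ∀ ds → ds ≢ [] → Chain Link (last (true , 0) ds) ds → Closed
          (expand (last (true , 0) ds) ds)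
      closed′ [] ne c = ⊥-elim (ne refl)
      closed′ (d ∷ ds) _ (l ∷ c) = Chain-expand (height (last d ds) d) ds c
        , subst (λ z → Step z (d , height (last d ds) d))
            (sym (last-expand d (height (last d ds) d) ds)) (throw l)

    points-within : All (Within n) (points x)
    points-within = subst (λ m → All (Within m) (points x)) weights
      (expand-within (diagonals x) chain (lastAll (diagonals x) nonempty diag ∷ diag))
      where
      diag : All (OffsetWithin (weight As) (weight Bs)) (diagonals x)
      diag = Perm.All-resp-↭ (↭-sym (interleave-↭ As Bs len))
        (All.++⁺ (All.map⁺ (support<weight As (proj₁ validˡ)))
            (All.map⁺ (support<weight Bs (proj₁ validʳ))))
      lastAll : ∀ {P : Diagonal → Set} ds → ds ≢ [] → All P ds → P (last (true , 0) ds)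
      lastAll [] ne _ = ⊥-elim (ne refl)
      lastAll (d ∷ ds) _ a = All.lookup a (last-∈ d ds)

    Normal-points : Normal (points x)
    Normal-points with As | Bs | lengthˡ | lengthʳ | len | dominates | distinct-diagonals
    ... | (a , xs) ∷ As′ | (y , ys) ∷ Bs′ | _ | _ | l | dom | u =
      normal refl (inj₂ (refl , ≤-refl) ∷ All.++⁺ (All.tabulate falls) (All.tabulate others))
      where
      ds = colored true xs ++ (false , y) ∷ colored false ys ++ interleave As′ Bs′
      h = height (last (true , a) ds) (true , a)
      falls : ∀ {p} → p ∈ falling (true , a) h → Below a h p
      falls p with ∈-falling p
      ... | refl , j<h = inj₂ (refl , <⇒≤ j<h)
      others : ∀ {p} → p ∈ expand (true , a) ds → Below a h p
      others {(false , _) , _} p = _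
      others {(true , e) , _} p with ∈-expand p
      ... | q with ∈-++⁻ (colored true (support ((a , xs) ∷ As′)))
                   (Perm.∈-resp-↭ (interleave-↭ ((a , xs) ∷ As′) ((y , ys) ∷ Bs′) l) (there q))
      ... | inj₂ r with ∈-map⁻ _ r
      ...   | _ , _ , ()
      others {(true , e) , _} p | q | inj₁ r with ∈-map⁻ _ r
      ... | _ , r′ , refl with m≤n⇒m<n∨m≡n (All.lookup dom r′)
      ... | inj₁ e<a = inj₁ e<a
      ... | inj₂ refl = ⊥-elim (Unique-∉ u q)

  -- The head is entered neither by `down` nor by `keep`, since both would come from a larger point
  -- of color `true`. So it is entered by `turn` from color `false`: the list starts at the
  -- beginning of a `true` run and ends with a complete `false` run, as `split-true` requires.
  encode : ∀ {n ps} → Cycle n ps → Normal ps → ∃ λ x → IsCode n x × points x ≡ ps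
  encode {n} (cycle len u (c , s)) (normal {a} {k} {rest} refl b) = go (last ((true , a) , k) rest)
      refl s
    where
    head : Point
    head = (true , a) , k
    go : ∀ p → last head rest ≡ p → Step p head → ∃ λ x → IsCode n x × points x ≡ head ∷ rest
    go .(_ , suc k) e down with subst (Below a k) e (All.lookup b (last-∈ head rest))
    ... | inj₁ l = ⊥-elim (<-irrefl refl l)
    ... | inj₂ (_ , l) = ⊥-elim (<-irrefl refl l)
    go .((true , suc (k + a)) , 0) e (throw (keep .k .a)) with subst (Below a k) e
        (All.lookup b (last-∈ head rest))
    ... | inj₁ l = ⊥-elim (<-irrefl refl (≤-trans (s≤s (m≤n+m a k)) (<⇒≤ l)))
    ... | inj₂ (l , _) = ⊥-elim (<-irrefl (sym l) (s≤s (m≤n+m a k)))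
    go ((true , _) , 0) e (throw (turn ()))
    go ((false , v) , 0) e (throw (turn refl)) with contract (true , a) k rest c (cong proj₂ e)
    ... | ds , refl , links , lst with split-true ds links (cong proj₁ (trans lst (cong proj₁ e)))
    ... | xs , As , (y , ys) , Bs , ch , refl , l , dA , dB , dBs = (As′ , Bs′) , code , points≡
      where
      As′ = (a , xs) ∷ As
      Bs′ = (y , ys) ∷ Bs
      final≡ : last (true , a) ds ≡ (false , v)
      final≡ = trans lst (cong proj₁ e)
      points≡ : points (As′ , Bs′) ≡ head ∷ rest
      points≡ = cong (λ f → expand f ((true , a) ∷ ds)) final≡
      link : Chain Link (false , v) ((true , a) ∷ ds)
      link = turn refl ∷ links
      l′ : length As′ ≡ length Bs′
      l′ = cong suc l
      uniq = Unique-interleave⁻ As′ Bs′ l′ (Unique-expand⁻ (false , v) ((true , a) ∷ ds) u)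
      lengths : length (head ∷ rest) + v ≡ v + turns (false , v) ((true , a) ∷ ds)
      lengths = trans (cong (λ z → length (head ∷ rest) + proj₂ z) (sym final≡))
          (length-expand ((true , a) ∷ ds) link)
      wts : weight As′ + weight Bs′ ≡ n
      wts = trans (sym (turns-interleave v As′ Bs′ l′))
        (trans (+-cancelˡ-≡ v _ _ (trans (sym lengths) (+-comm _ v))) len)
      dom : All (_≤ a) (support As′)
      dom = All.tabulate below
        where
        below : ∀ {e} → e ∈ support As′ → e ≤ a
        below {e} p with All.lookup b (landing-∈-expand {false , v} {(true , a) ∷ ds} {true , e}
          (Perm.∈-resp-↭ (↭-sym (interleave-↭ As′ Bs′ l′)) (∈-++⁺ˡ (∈-map⁺ (true ,_) p))))
        ... | inj₁ q = <⇒≤ q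
        ... | inj₂ (refl , _) = ≤-refl
      code : IsCode n (As′ , Bs′)
      code = isCode refl (cong suc (sym l)) wts (ch ∷ dA , proj₁ uniq) (dB ∷ dBs , proj₂ uniq) dom

-- Translation between points and the boolean tests on states.

module States where
  open import Defs
  open ListCounting
  open LexOrder
  open Runs using (Chain; []; _∷_)
  open Diagonals
  open Codes
  open import Data.Nat using (ℕ; zero; suc; _+_; _∸_; _≤_; _<_; z≤n; s≤s; _≡ᵇ_; _<ᵇ_)
  open import Data.Nat.Properties
  open import Data.Bool using (Bool; true; false; not; T; _∧_; _∨_)
  open import Data.Product using (∃; _×_; _,_; proj₁; proj₂)
  open import Data.Sum using (_⊎_; inj₁; inj₂)
  open import Data.Empty using (⊥-elim)
  open import Data.List using (List; []; _∷_; _++_; map; length; upTo; take; drop)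
  open import Data.List.Properties using (length-map; ∷-injective; ++-identityʳ; take++drop≡id)
  open import Data.List.Membership.Propositional using (_∈_)
  open import Data.List.Membership.Propositional.Properties
    using (∈-map⁺; ∈-map⁻; ∈-upTo⁺; ∈-applyUpTo⁺; ∈-applyUpTo⁻)
  open import Data.List.Relation.Unary.Any using (here; there)
  open import Data.List.Relation.Unary.All as All using (All; []; _∷_)
  import Data.List.Relation.Unary.All.Properties as All
  open import Data.List.Relation.Unary.AllPairs using ([]; _∷_)
  open import Data.List.Relation.Unary.Unique.Propositional using (Unique)
  import Data.List.Relation.Unary.Unique.Propositional.Properties as Unq
  open import Relation.Binary.PropositionalEquality
  open import Relation.Binary.Definitions using (tri<; tri≈; tri>)
  open import Relation.Nullary using (¬_)
  open import Function using (_∘_)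

  toState : Point → State
  toState ((true  , d) , k) = suc k , suc (suc (k + d))
  toState ((false , d) , k) = suc (suc (k + d)) , suc k

  toState-injective : ∀ {p q} → toState p ≡ toState q → p ≡ q
  toState-injective {(true , d) , k} {(true , e) , j} eq with cong proj₁ eq
  ... | refl with +-cancelˡ-≡ k d e (suc-injective (suc-injective (cong proj₂ eq)))
  ... | refl = refl
  toState-injective {(false , d) , k} {(false , e) , j} eq with cong proj₂ eq
  ... | refl with +-cancelˡ-≡ k d e (suc-injective (suc-injective (cong proj₁ eq)))
  ... | refl = refl
  toState-injective {(true , d) , k} {(false , e) , j} eq =
    ⊥-elim (<-irrefl (suc-injective (trans (cong proj₁ eq) (cong suc refl)))
      (≤-trans (s≤s (≤-trans (m≤m+n k d) (n≤1+n _))) (≤-trans (≤-reflexive (cong proj₂ eq))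
          (s≤s (m≤m+n j e)))))
  toState-injective {(false , d) , k} {(true , e) , j} eq =
    ⊥-elim (<-irrefl (suc-injective (cong proj₂ eq))
      (≤-trans (s≤s (≤-trans (m≤m+n k d) (n≤1+n _))) (≤-trans (≤-reflexive (cong proj₁ eq))
          (s≤s (m≤m+n j e)))))

  toState-swap : ∀ ps → swapColors (map toState ps) ≡ map toState (map swapPoint ps)
  toState-swap [] = refl
  toState-swap (((true  , d) , k) ∷ ps) = cong (_ ∷_) (toState-swap ps)
  toState-swap (((false , d) , k) ∷ ps) = cong (_ ∷_) (toState-swap ps)

  T-not : ∀ {b} → T (not b) → ¬ T b
  T-not {false} _ ()

  T-not⁺ : ∀ {b} → ¬ T b → T (not b)
  T-not⁺ {false} _ = _
  T-not⁺ {true} h = h _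

  valid-toState : ∀ p → T (validᵇ (toState p))
  valid-toState ((true , d) , k) = T-not⁺ λ t → m≢1+m+n k (≡ᵇ⇒≡ k (suc (k + d)) t)
  valid-toState ((false , d) , k) = T-not⁺ λ t → m≢1+m+n k (sym (≡ᵇ⇒≡ (suc (k + d)) k t))

  fromState : ∀ s → T (validᵇ s) → ∃ λ p → s ≡ toState p
  fromState (suc x , suc y) v with <-cmp x y
  ... | tri≈ _ refl _ = ⊥-elim (T-not v (≡⇒≡ᵇ x x refl))
  ... | tri< p _ _ with m≤n⇒∃[o]m+o≡n p
  ... | o , refl = ((true , o) , x) , refl
  fromState (suc x , suc y) v | tri> _ _ p with m≤n⇒∃[o]m+o≡n p
  ... | o , refl = ((false , o) , y) , refl

  Step⇒stepᵇ : ∀ {p q} → Step p q → T (stepᵇ (toState p) (toState q))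
  Step⇒stepᵇ {p} {q} s = T-∧⁺ (valid-toState p) (T-∧⁺ (valid-toState q) (go s))
    where
    same : ∀ k → T (k ≡ᵇ k)
    same k = ≡⇒≡ᵇ k k refl
    go : ∀ {p q} → Step p q →
      let (x , y) = toState p ; (x′ , y′) = toState q in
      T (((1 <ᵇ x) ∧ (1 <ᵇ y) ∧ (x′ ≡ᵇ x ∸ 1) ∧ (y′ ≡ᵇ y ∸ 1))
        ∨ ((x ≡ᵇ 1) ∧ (y′ ≡ᵇ y ∸ 1)) ∨ ((y ≡ᵇ 1) ∧ (x′ ≡ᵇ x ∸ 1)))
    go (down {true , d} {k}) = T-∨⁺ (inj₁ (T-∧⁺ (same k) (same (k + d))))
    go (down {false , d} {k}) = T-∨⁺ (inj₁ (T-∧⁺ (same (k + d)) (same k)))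
    go (throw (keep {true} k e)) = T-∨⁺ (inj₁ (same (k + e)))
    go (throw (keep {false} k e)) = same (k + e)
    go (throw (turn {true} {d = d} refl)) = T-∨⁺ (inj₁ (same d))
    go (throw (turn {false} {d = d} refl)) = same d

  stepᵇ⇒Step : ∀ p q → T (stepᵇ (toState p) (toState q)) → Step p q
  stepᵇ⇒Step p q t = go p q (proj₂ (T-∧⁻ {validᵇ (toState q)}
      (proj₂ (T-∧⁻ {validᵇ (toState p)} t))))
    where
    step-down : ∀ {c d k} q → toState q ≡ toState ((c , d) , k) → Step ((c , d) , suc k) q
    step-down q e with toState-injective {q} e
    ... | refl = down
    move : State → State → Bool
    move (x , y) (x′ , y′) = ((1 <ᵇ x) ∧ (1 <ᵇ y) ∧ (x′ ≡ᵇ x ∸ 1) ∧ (y′ ≡ᵇ y ∸ 1))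
        ∨ ((x ≡ᵇ 1) ∧ (y′ ≡ᵇ y ∸ 1)) ∨ ((y ≡ᵇ 1) ∧ (x′ ≡ᵇ x ∸ 1))
    -- Once color and level are known, the tests for landing balls compute and a single alternative
    -- survives, in some cases followed by `∨ false`.
    T-∨-false : ∀ {b} → T (b ∨ false) → T b
    T-∨-false {true} _ = _
    go : ∀ p q → T (move (toState p) (toState q)) → Step p q
    go ((true , d) , suc k) q t with T-∧⁻ {proj₁ (toState q) ≡ᵇ suc k} (T-∨-false t)
    ... | a , b = step-down q (cong₂ _,_ (≡ᵇ⇒≡ _ _ a) (≡ᵇ⇒≡ _ _ b))
    go ((false , d) , suc k) q t with T-∧⁻ {proj₁ (toState q) ≡ᵇ suc (suc (k + d))} (T-∨-false t)
    ... | a , b = step-down q (cong₂ _,_ (≡ᵇ⇒≡ _ _ a) (≡ᵇ⇒≡ _ _ b))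
    go ((true , d) , zero) ((true , e) , j) t with ≡ᵇ⇒≡ (suc (j + e)) d (T-∨-false t)
    ... | refl = throw (keep j e)
    go ((true , d) , zero) ((false , e) , j) t with ≡ᵇ⇒≡ j d (T-∨-false t)
    ... | refl = throw (turn refl)
    go ((false , d) , zero) ((false , e) , j) t with ≡ᵇ⇒≡ (suc (j + e)) d t
    ... | refl = throw (keep j e)
    go ((false , d) , zero) ((true , e) , j) t with ≡ᵇ⇒≡ j d t
    ... | refl = throw (turn refl)

  eqState⇒≡ : ∀ s t → T (eqStateᵇ s t) → s ≡ t
  eqState⇒≡ (x , y) (x′ , y′) t with T-∧⁻ {x ≡ᵇ x′} t
  ... | a , b = cong₂ _,_ (≡ᵇ⇒≡ _ _ a) (≡ᵇ⇒≡ _ _ b)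

  ≡⇒eqState : ∀ s → T (eqStateᵇ s s)
  ≡⇒eqState (x , y) = T-∧⁺ (≡⇒≡ᵇ x x refl) (≡⇒≡ᵇ y y refl)

  elem⇒∈ : ∀ s ss → T (elemᵇ s ss) → s ∈ ss
  elem⇒∈ s (t ∷ ts) h with T-∨⁻ {eqStateᵇ s t} h
  ... | inj₁ p = here (eqState⇒≡ s t p)
  ... | inj₂ p = there (elem⇒∈ s ts p)

  ∈⇒elem : ∀ {s ss} → s ∈ ss → T (elemᵇ s ss)
  ∈⇒elem {s} (here refl) = T-∨⁺ (inj₁ (≡⇒eqState s))
  ∈⇒elem {s} {t ∷ ss} (there p) = T-∨⁺ {eqStateᵇ s t} (inj₂ (∈⇒elem p))

  distinct⇒Unique : ∀ ss → T (distinctᵇ ss) → Unique ss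
  distinct⇒Unique [] _ = []
  distinct⇒Unique (s ∷ ss) t with T-∧⁻ {not (elemᵇ s ss)} t
  ... | a , b = ∉-Unique (λ p → T-not a (∈⇒elem p)) (distinct⇒Unique ss b)

  Unique⇒distinct : ∀ ss → Unique ss → T (distinctᵇ ss)
  Unique⇒distinct [] _ = _
  Unique⇒distinct (s ∷ ss) u =
    T-∧⁺ (T-not⁺ (λ t → Unique-∉ u (elem⇒∈ s ss t))) (Unique⇒distinct ss (Unique-tail u))

  allᵇ⇒All : {A : Set} (p : A → Bool) (xs : List A) → T (allᵇ p xs) → All (T ∘ p) xs
  allᵇ⇒All p [] _ = []
  allᵇ⇒All p (x ∷ xs) t with T-∧⁻ {p x} t
  ... | a , b = a ∷ allᵇ⇒All p xs b

  All⇒allᵇ : {A : Set} (p : A → Bool) {xs : List A} → All (T ∘ p) xs → T (allᵇ p xs)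
  All⇒allᵇ p [] = _
  All⇒allᵇ p (a ∷ as) = T-∧⁺ a (All⇒allᵇ p as)

  chain⇒Chain : ∀ f p ps → T (chainᵇ (toState f) (map toState (p ∷ ps))) → Chain Step p ps × Step
      (last p ps) f
  chain⇒Chain f p [] t = [] , stepᵇ⇒Step p f t
  chain⇒Chain f p (q ∷ ps) t with T-∧⁻ {stepᵇ (toState p) (toState q)} t
  ... | a , b with chain⇒Chain f q ps b
  ... | c , s = stepᵇ⇒Step p q a ∷ c , s

  Chain⇒chain : ∀ f p ps → Chain Step p ps → Step (last p ps) f → T
      (chainᵇ (toState f) (map toState (p ∷ ps)))
  Chain⇒chain f p [] [] s = Step⇒stepᵇ s
  Chain⇒chain f p (q ∷ ps) (r ∷ c) s = T-∧⁺ (Step⇒stepᵇ r) (Chain⇒chain f q ps c s)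

  fromStates : ∀ ss → All (T ∘ validᵇ) ss → ∃ λ ps → ss ≡ map toState ps
  fromStates [] [] = [] , refl
  fromStates (s ∷ ss) (v ∷ vs) with fromState s v | fromStates ss vs
  ... | p , refl | ps , refl = p ∷ ps , refl

  isCycle⇒Cycle : ∀ n ss → T (isCycleᵇ n ss) → ∃ λ ps → ss ≡ map toState ps × Cycle n ps
  isCycle⇒Cycle n ss t with T-∧⁻ {length ss ≡ᵇ n} t
  ... | l , t₁ with T-∧⁻ {allᵇ validᵇ ss} t₁
  ... | v , t₂ with T-∧⁻ {distinctᵇ ss} t₂
  ... | d , c with fromStates ss (allᵇ⇒All validᵇ ss v)
  ... | p ∷ ps , refl = p ∷ ps , refl ,
    cycle (trans (sym (length-map toState (p ∷ ps))) (≡ᵇ⇒≡ _ _ l))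
      (Unique-map⁻ toState (p ∷ ps) (distinct⇒Unique (map toState (p ∷ ps)) d))
          (chain⇒Chain p p ps c)

  Cycle⇒isCycle : ∀ {n ps} → Cycle n ps → T (isCycleᵇ n (map toState ps))
  Cycle⇒isCycle {n} {p ∷ ps} (cycle l u (c , s)) =
    T-∧⁺ {length (map toState (p ∷ ps)) ≡ᵇ n} (≡⇒≡ᵇ _ _ (trans (length-map toState (p ∷ ps)) l))
      (T-∧⁺ {allᵇ validᵇ (map toState (p ∷ ps))}
          (All⇒allᵇ validᵇ (All.map⁺ (All.tabulate {xs = p ∷ ps} (λ {x} _ → valid-toState x))))
        (T-∧⁺ {distinctᵇ (map toState (p ∷ ps))} (Unique⇒distinct _ (Unq.map⁺ toState-injective u))
            (Chain⇒chain p p ps c s)))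

  ∈-seqs⁺ : ∀ k {A ss} → length ss ≡ k → All (_∈ A) ss → ss ∈ seqs k A
  ∈-seqs⁺ zero {ss = []} _ _ = here refl
  ∈-seqs⁺ (suc k) {A} {s ∷ ss} l (a ∷ as) =
    ∈-concatMap⁺ (λ a → map (a ∷_) (seqs k A)) a (∈-map⁺ (s ∷_) (∈-seqs⁺ k (suc-injective l) as))

  ∈-seqs⁻ : ∀ k {A ss} → ss ∈ seqs k A → All (_∈ A) ss
  ∈-seqs⁻ zero (here refl) = []
  ∈-seqs⁻ (suc k) {A} p with ∈-concatMap⁻ (λ a → map (a ∷_) (seqs k A)) A p
  ... | a , a∈ , q with ∈-map⁻ (a ∷_) q
  ... | ss , r , refl = a∈ ∷ ∈-seqs⁻ k r

  Unique-seqs : ∀ k {A} → Unique A → Unique (seqs k A)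
  Unique-seqs zero u = [] ∷ []
  Unique-seqs (suc k) {A} u = Unique-concatMap _ A u
    (λ _ → Unq.map⁺ (λ e → proj₂ (∷-injective e)) (Unique-seqs k u))
    (λ {x} {x′} _ _ p q → head≡ (∈-map⁻ (x ∷_) p) (∈-map⁻ (x′ ∷_) q))
    where
    head≡ : ∀ {x x′ : State} {y : List State} {P Q : List State → Set} →
      (∃ λ z → P z × y ≡ x ∷ z) → (∃ λ z → Q z × y ≡ x′ ∷ z) → x ≡ x′
    head≡ (_ , _ , refl) (_ , _ , refl) = refl

  ∈-statesUpTo⁺ : ∀ {n x y} → x < n → y < n → (suc x , suc y) ∈ statesUpTo n
  ∈-statesUpTo⁺ {n} p q = ∈-concatMap⁺ (λ x → map (x ,_) (range1 n)) (∈-applyUpTo⁺ suc p)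
      (∈-map⁺ _ (∈-applyUpTo⁺ suc q))

  ∈-statesUpTo⁻ : ∀ {n x y} → (x , y) ∈ statesUpTo n → x ≤ n × y ≤ n
  ∈-statesUpTo⁻ {n} p with ∈-concatMap⁻ (λ x → map (x ,_) (range1 n)) (range1 n) p
  ... | x , x∈ , q with ∈-map⁻ _ q
  ... | y , y∈ , refl with ∈-applyUpTo⁻ suc x∈ | ∈-applyUpTo⁻ suc y∈
  ... | _ , i<n , refl | _ , j<n , refl = i<n , j<n

  Unique-statesUpTo : ∀ n → Unique (statesUpTo n)
  Unique-statesUpTo n = Unique-concatMap _ (range1 n) range! (λ _ → Unq.map⁺ (cong proj₂) range!)
    (λ _ _ p q → same (∈-map⁻ _ p) (∈-map⁻ _ q))
    where
    range! : Unique (range1 n)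
    range! = Unq.applyUpTo⁺₁ suc n (λ i<j _ e → <-irrefl (suc-injective e) i<j)
    same : ∀ {x x′ : ℕ} {s : State} {P Q : ℕ → Set} →
      (∃ λ y → P y × s ≡ (x , y)) → (∃ λ y → Q y × s ≡ (x′ , y)) → x ≡ x′
    same (_ , _ , refl) (_ , _ , refl) = refl

  Within⇒∈ : ∀ {n} p → Within n p → toState p ∈ statesUpTo n
  Within⇒∈ ((true , d) , k) w = ∈-statesUpTo⁺ (≤-trans (s≤s (≤-trans (m≤m+n k d) (n≤1+n _))) w) w
  Within⇒∈ ((false , d) , k) w = ∈-statesUpTo⁺ w (≤-trans (s≤s (≤-trans (m≤m+n k d) (n≤1+n _))) w)

  ∈⇒Within : ∀ {n} p → toState p ∈ statesUpTo n → Within n p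
  ∈⇒Within ((true , d) , k) p = proj₂ (∈-statesUpTo⁻ p)
  ∈⇒Within ((false , d) , k) p = proj₁ (∈-statesUpTo⁻ p)

  Rot-rotate : ∀ k (ss : List State) → Rot ss (rotate k ss)
  Rot-rotate k ss = take k ss , drop k ss , sym (take++drop≡id k ss) , refl

  Rot⇒rotate : ∀ {ss ts : List State} → 0 < length ss → Rot ss ts → ∃ λ k → k < length ss × ts ≡
      rotate k ss
  -- A cut at the very end is a rotation by `length ss`, outside the tested range; the amount 0
  -- gives the same list.
  Rot⇒rotate {ss} l (u , [] , p , refl) = 0 , l , sym
      (trans (++-identityʳ ss) (trans p (++-identityʳ u)))
  Rot⇒rotate l (u , t ∷ v , refl , refl) = length u , len u , sym
      (cong₂ _++_ (drop-++ u) (take-++ u))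
    where
    len : ∀ u → length u < length (u ++ t ∷ v)
    len [] = s≤s z≤n
    len (x ∷ u) = s≤s (len u)
    drop-++ : ∀ u → drop (length u) (u ++ t ∷ v) ≡ t ∷ v
    drop-++ [] = refl
    drop-++ (x ∷ u) = drop-++ u
    take-++ : ∀ u → take (length u) (u ++ t ∷ v) ≡ u
    take-++ [] = refl
    take-++ (x ∷ u) = cong (x ∷_) (take-++ u)

  -- Membership in the orbit is expressed by `Rot`, so that composing symmetries needs no arithmetic
  -- with rotation amounts.
  Least : List State → Set
  Least ss = ∀ {ts} → Rot ss ts ⊎ Rot (swapColors ss) ts → ss ≼ ts

  canonical⇒Least : ∀ n ss → length ss ≡ n → 0 < n → T (canonicalᵇ n ss) → Least ss
  canonical⇒Least n ss refl pos t r = go r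
    where
    both : ∀ k → k < n → T (leqStateLexᵇ ss (rotate k ss)) × T
        (leqStateLexᵇ ss (rotate k (swapColors ss)))
    both k k<n = T-∧⁻ {leqStateLexᵇ ss (rotate k ss)} (All.lookup (allᵇ⇒All _ (upTo n) t)
        (∈-upTo⁺ k<n))
    go : ∀ {ts} → Rot ss ts ⊎ Rot (swapColors ss) ts → ss ≼ ts
    go (inj₁ r) with Rot⇒rotate pos r
    ... | k , k<n , refl = leq⇒≼ ss _ (proj₁ (both k k<n))
    go (inj₂ r) with Rot⇒rotate (subst (0 <_) (sym (length-map _ ss)) pos) r
    ... | k , k<n , refl = leq⇒≼ ss _ (proj₂ (both k (subst (k <_) (length-map _ ss) k<n)))

  Least⇒canonical : ∀ n ss → Least ss → T (canonicalᵇ n ss)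
  Least⇒canonical n ss h = All⇒allᵇ _ (All.tabulate {xs = upTo n} λ {k} _ →
    T-∧⁺ (≼⇒leq (h (inj₁ (Rot-rotate k ss)))) (≼⇒leq (h (inj₂ (Rot-rotate k (swapColors ss))))))

-- Two-sided comparison of twice the number of patterns with the number of codes.

module Orbits where
  open import Defs
  open ListCounting
  open LexOrder
  open Runs using (Chain; []; _∷_)
  open Diagonals
  open Codes
  open States
  open import Data.Nat using (ℕ; zero; suc; pred; _+_; _*_; _^_; _≤_; _<_; z≤n; s≤s; ⌊_/2⌋)
  open import Data.Nat.Properties as ℕ
  open import Data.Bool as Bool using (Bool; true; false; not; T?; _∧_)
  open import Data.Bool.Properties using (not-involutive)
  open import Data.Product using (∃; ∃₂; _×_; _,_; proj₁; proj₂)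
  import Data.Product.Properties as Prod
  open import Data.Sum using (_⊎_; inj₁; inj₂)
  open import Data.Empty using (⊥; ⊥-elim)
  open import Data.List using (List; []; _∷_; _++_; map; length; upTo; concatMap; filter;
      cartesianProduct)
  open import Data.List.Properties as List using (length-map; length-++; length-upTo; map-++;
      ∷-injective; ++-identityʳ; map-injective)
  open import Data.List.Membership.Propositional using (_∈_)
  open import Data.List.Membership.Propositional.Properties
    using (∈-map⁺; ∈-map⁻; ∈-++⁺ˡ; ∈-++⁺ʳ; ∈-++⁻; ∈-upTo⁺; ∈-filter⁺; ∈-filter⁻;
        ∈-cartesianProduct⁺)
  open import Data.List.Relation.Unary.Any using (here; there)
  open import Data.List.Relation.Unary.All as All using (All; []; _∷_)
  import Data.List.Relation.Unary.All.Properties as All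
  open import Data.List.Relation.Unary.Unique.Propositional using (Unique)
  import Data.List.Relation.Unary.Unique.Propositional.Properties as Unq
  import Data.List.Relation.Binary.Permutation.Propositional.Properties as Perm
  open import Relation.Binary.PropositionalEquality
  open import Relation.Binary.Definitions using (DecidableEquality)
  open import Relation.Nullary using (¬_; yes; no)
  open import Function using (_∘_)

  recolor : Bool → List Point → List Point
  recolor false ps = ps
  recolor true  ps = map swapPoint ps

  recolor-involutive : ∀ b ps → recolor b (recolor b ps) ≡ ps
  recolor-involutive false ps = refl
  recolor-involutive true  ps = map-swap-involutive ps

  Rot-recolor : ∀ b {ps qs} → Rot ps qs → Rot (recolor b ps) (recolor b qs)
  Rot-recolor false r = r
  Rot-recolor true  r = Rot-map swapPoint r

  Rot-recolor⁻ : ∀ b {ps qs} → Rot (recolor b ps) (recolor b qs) → Rot ps qs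
  Rot-recolor⁻ b r = subst₂ Rot (recolor-involutive b _) (recolor-involutive b _) (Rot-recolor b r)

  Cycle-recolor : ∀ b {n ps} → Cycle n ps → Cycle n (recolor b ps)
  Cycle-recolor false c = c
  Cycle-recolor true  c = Cycle-swap c

  Within-recolor : ∀ b {n ps} → All (Within n) ps → All (Within n) (recolor b ps)
  Within-recolor false w = w
  Within-recolor true  w = All.map⁺ w

  swap-recolor : ∀ b ps → ∃ λ b′ → map swapPoint (recolor b ps) ≡ recolor b′ ps
  swap-recolor false ps = true , refl
  swap-recolor true  ps = false , map-swap-involutive ps

  Canonical : List Point → Set
  Canonical ps = ∀ b {qs} → Rot (recolor b ps) qs → map toState ps ≼ map toState qs

  Canonical⇒Least : ∀ {ps} → Canonical ps → Least (map toState ps)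
  Canonical⇒Least {ps} c (inj₁ r) with Rot-map⁻ toState r
  ... | qs , refl , r′ = c false r′
  Canonical⇒Least {ps} c (inj₂ r) with Rot-map⁻ toState (subst (λ z → Rot z _) (toState-swap ps) r)
  ... | qs , refl , r′ = c true r′

  Least⇒Canonical : ∀ {ps} → Least (map toState ps) → Canonical ps
  Least⇒Canonical h false r = h (inj₁ (Rot-map toState r))
  Least⇒Canonical {ps} h true r = h (inj₂ (subst (λ z → Rot z _) (sym (toState-swap ps))
      (Rot-map toState r)))

  Canonical-unique : ∀ {ps qs} b → Canonical ps → Canonical qs → Rot (recolor b ps) qs → ps ≡ qs
  Canonical-unique {ps} {qs} b c c′ r = map-injective toState-injective
    (≼-antisym (c b r) (c′ b (subst (Rot (recolor b qs)) (recolor-involutive b ps)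
        (Rot-recolor b (Rot-sym r)))))

  module _ (ps : List Point) (pos : 0 < length ps) where
    private
      states : Bool → List State
      states b = map toState (recolor b ps)

      rotations : Bool → List (List State)
      rotations b = map (λ k → rotate k (states b)) (upTo (length (states b)))

      length-states : ∀ b → 0 < length (states b)
      length-states b = subst (0 <_) (sym (trans (length-map toState (recolor b ps)) (len b))) pos
        where
        len : ∀ b → length (recolor b ps) ≡ length ps
        len false = refl
        len true = length-map swapPoint ps

      orbit : List (List State)
      orbit = rotations false ++ rotations true

      ∈-orbit⁺ : ∀ b {ts} → Rot (states b) ts → ts ∈ orbit
      ∈-orbit⁺ b r with Rot⇒rotate (length-states b) r
      ∈-orbit⁺ false r | k , k<n , refl = ∈-++⁺ˡ (∈-map⁺ (λ k → rotate k (states false))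
          (∈-upTo⁺ k<n))
      ∈-orbit⁺ true r | k , k<n , refl = ∈-++⁺ʳ (rotations false)
          (∈-map⁺ (λ k → rotate k (states true)) (∈-upTo⁺ k<n))

      ∈-orbit⁻ : ∀ {ts} → ts ∈ orbit → ∃ λ b → Rot (states b) ts
      ∈-orbit⁻ p with ∈-++⁻ (rotations false) p
      ... | inj₁ q with ∈-map⁻ _ q
      ...   | k , _ , refl = false , Rot-rotate k (states false)
      ∈-orbit⁻ p | inj₂ q with ∈-map⁻ _ q
      ...   | k , _ , refl = true , Rot-rotate k (states true)

      least : ∃ λ m → m ∈ orbit × (∀ {ts} → ts ∈ orbit → m ≼ ts)
      least with orbit | ∈-orbit⁺ false Rot-refl
      ... | x ∷ xs | _ = ≼-minimum x xs

    -- The least member of the finite orbit of `ps` works: a rotation or recoloring of it lies in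
    -- that same orbit, because two recolorings compose to one.
    canonical-representative : ∃₂ λ b qs → Rot (recolor b ps) qs × Canonical qs
    canonical-representative with least
    ... | m , m∈ , min with ∈-orbit⁻ m∈
    ... | b , r with Rot-map⁻ toState r
    ... | qs , refl , r′ = b , qs , r′ , canon
      where
      canon : Canonical qs
      canon b′ s with recolor-recolor b′ b
        where
        recolor-recolor : ∀ b′ b → ∃ λ b″ → recolor b′ (recolor b ps) ≡ recolor b″ ps
        recolor-recolor false b = b , refl
        recolor-recolor true b = swap-recolor b ps
      ... | b″ , e = min (∈-orbit⁺ b″ (Rot-map toState
          (subst (λ z → Rot z _) e (Rot-trans (Rot-recolor b′ r′) s))))

  patterns : ℕ → List (List State)
  patterns n = filter (T? ∘ λ ss → isCycleᵇ n ss ∧ canonicalᵇ n ss) (seqs n (statesUpTo n))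

  length-patterns : ∀ n → length (patterns n) ≡ C′ n
  length-patterns n = sym (countᵇ≡length-filter _ (seqs n (statesUpTo n)))

  Unique-patterns : ∀ n → Unique (patterns n)
  Unique-patterns n = Unq.filter⁺ (T? ∘ λ ss → isCycleᵇ n ss ∧ canonicalᵇ n ss)
      (Unique-seqs n (Unique-statesUpTo n))

  record IsPattern (n : ℕ) (ps : List Point) : Set where
    constructor isPattern
    field
      isACycle  : Cycle n ps
      within    : All (Within n) ps
      canonical : Canonical ps

  Cycle-pos : ∀ {n ps} → Cycle n ps → 0 < length ps
  Cycle-pos {ps = _ ∷ _} _ = s≤s z≤n

  ∈-patterns⁺ : ∀ {n ps} → IsPattern n ps → map toState ps ∈ patterns n
  ∈-patterns⁺ {n} {ps} (isPattern c w k) = ∈-filter⁺ (T? ∘ λ ss → isCycleᵇ n ss ∧ canonicalᵇ n ss)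
    (∈-seqs⁺ n (trans (length-map toState ps) (Cycle.length≡ c))
        (All.map⁺ (All.map (λ {p} → Within⇒∈ p) w)))
    (T-∧⁺ {isCycleᵇ n (map toState ps)} (Cycle⇒isCycle c) (Least⇒canonical n _ (Canonical⇒Least k)))

  ∈-patterns⁻ : ∀ n {ss} → ss ∈ patterns n → ∃ λ ps → ss ≡ map toState ps × IsPattern n ps
  ∈-patterns⁻ n {ss} p with ∈-filter⁻ (T? ∘ λ ss → isCycleᵇ n ss ∧ canonicalᵇ n ss)
      {xs = seqs n (statesUpTo n)} p
  ... | ss∈ , t with T-∧⁻ {isCycleᵇ n ss} t
  ... | tc , tk with isCycle⇒Cycle n ss tc
  ... | ps , refl , c = ps , refl , isPattern c
      (All.map (λ {p} → ∈⇒Within p) (All.map⁻ (∈-seqs⁻ n ss∈)))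
      (Least⇒Canonical (canonical⇒Least n (map toState ps) len (subst (0 <_) (Cycle.length≡ c)
          (Cycle-pos c)) tk))
    where
    len : length (map toState ps) ≡ n
    len = trans (length-map toState ps) (Cycle.length≡ c)

  tag : Bool → List State → Bool × List State
  tag b ss = b , ss

  -- The pair `(b , ss)` stands for the rotation class of `ss` recolored by `b`. Counting both tags
  -- replaces a division by two.
  coloredPatterns : ℕ → List (Bool × List State)
  coloredPatterns n = map (tag false) (patterns n) ++ map (tag true) (patterns n)

  length-coloredPatterns : ∀ n → length (coloredPatterns n) ≡ C′ n + C′ n
  length-coloredPatterns n = trans (length-++ (map (tag false) (patterns n)))
    (cong₂ _+_ (half false) (half true))
    where
    half : ∀ b → length (map (tag b) (patterns n)) ≡ C′ n
    half b = trans (length-map (tag b) (patterns n)) (length-patterns n)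

  ∈-coloredPatterns⁺ : ∀ {n} b {ss} → ss ∈ patterns n → (b , ss) ∈ coloredPatterns n
  ∈-coloredPatterns⁺ false p = ∈-++⁺ˡ (∈-map⁺ _ p)
  ∈-coloredPatterns⁺ {n} true p = ∈-++⁺ʳ (map (tag false) (patterns n)) (∈-map⁺ _ p)

  ∈-coloredPatterns⁻ : ∀ n {b ss} → (b , ss) ∈ coloredPatterns n → ss ∈ patterns n
  ∈-coloredPatterns⁻ n p with ∈-++⁻ (map (tag false) (patterns n)) p
  ... | inj₁ q with ∈-map⁻ (tag false) q
  ...   | _ , r , refl = r
  ∈-coloredPatterns⁻ n p | inj₂ q with ∈-map⁻ (tag true) q
  ...   | _ , r , refl = r

  Unique-coloredPatterns : ∀ n → Unique (coloredPatterns n)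
  Unique-coloredPatterns n = Unq.++⁺ (Unq.map⁺ (cong proj₂) (Unique-patterns n))
      (Unq.map⁺ (cong proj₂) (Unique-patterns n)) disj
    where
    disj : ∀ {x} → x ∈ map (tag false) (patterns n) × x ∈ map (tag true) (patterns n) → ⊥
    disj (p , q) with ∈-map⁻ (tag false) p | ∈-map⁻ (tag true) q
    ... | _ , _ , refl | _ , _ , ()

  -- A code goes to the canonical form of its cycle, tagged with the recoloring that leads there.
  -- Tag and form determine the cycle up to rotation; then `Normal-unique` and `points-injective`
  -- give back the code.
  codes≤2C′ : ∀ n → length (codes n) ≤ C′ n + C′ n
  codes≤2C′ n = subst (length (codes n) ≤_) (length-coloredPatterns n)
    (injection⇒≤ Represents (codes n) (coloredPatterns n) (Unique-codes n) total
      (λ {x} {x′} {y} → injective {x} {x′} {y}))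
    where
    Represents : Code → Bool × List State → Set
    Represents x (b , ss) = ∃ λ qs → ss ≡ map toState qs × Rot (recolor b (points x)) qs
    total : ∀ {x} → x ∈ codes n → ∃ λ y → y ∈ coloredPatterns n × Represents x y
    total {x} p with ∈-codes⁻ {n} p
    ... | c with Cycle-points x c
    ... | cyc with canonical-representative (points x) (Cycle-pos cyc)
    ... | b , qs , r , k = (b , map toState qs) , ∈-coloredPatterns⁺ {n} b (∈-patterns⁺ pat) , qs ,
        refl , r
      where
      pat : IsPattern n qs
      pat = isPattern (Cycle-Rot r (Cycle-recolor b cyc))
        (Perm.All-resp-↭ (Rot-↭ r) (Within-recolor b (points-within x c))) k
    injective : ∀ {x x′ y} → x ∈ codes n → x′ ∈ codes n → Represents x y → Represents x′ y → x ≡ x′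
    injective {x} {x′} {b , _} p p′ (qs , e , r) (qs′ , e′ , r′)
      with map-injective toState-injective (trans (sym e) e′) | ∈-codes⁻ {n} p | ∈-codes⁻ {n} p′
    ... | refl | c | c′ = points-injective c c′
      (Normal-unique (Cycle.distinct (Cycle-points x c)) (Rot-recolor⁻ b {points x} {points x′}
          (Rot-trans r (Rot-sym r′)))
        (Normal-points x c) (Normal-points x′ c′))

  -- Swapping twice is the identity, so rotating twice by the length of `u` fixes a list without
  -- repetitions: the cut is in the middle or trivial. A trivial cut would make the swap fix a
  -- point. In the uneven cases the first point `w` of the overhang would occur twice.
  symmetric-halves : ∀ {ps} → Unique ps → 0 < length ps → Rot ps (map swapPoint ps) →
    ∃ λ h → ps ≡ h ++ map swapPoint h
  symmetric-halves uq pos (u , v , refl , e) = go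
      (++-split (map swapPoint u) v (trans (sym (map-++ swapPoint u v)) e))
    where
    swap≢ : ∀ p → swapPoint p ≢ p
    swap≢ ((true , _) , _) ()
    swap≢ ((false , _) , _) ()
    fixed-head : ∀ ps → 0 < length ps → map swapPoint ps ≢ ps
    fixed-head (p ∷ ps) _ e = swap≢ p (proj₁ (∷-injective e))
    go : (∃ λ w → map swapPoint u ≡ v ++ w × u ≡ w ++ map swapPoint v) ⊎
         (∃ λ w → v ≡ map swapPoint u ++ w × map swapPoint v ≡ w ++ u) →
         ∃ λ h → u ++ v ≡ h ++ map swapPoint h
    go (inj₂ ([] , q , _)) = u , cong (u ++_) (trans q (++-identityʳ _))
    go (inj₁ ([] , q , _)) = u , cong (u ++_) (trans (sym (++-identityʳ v)) (sym q))
    go (inj₂ (w ∷ ws , q , q′)) = ⊥-elim (case-u u refl)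
      where
      case-u : ∀ u′ → u ≡ u′ → ⊥
      case-u [] refl = fixed-head v pos (trans q′ (trans (++-identityʳ _) (sym q)))
      case-u (a ∷ u′) refl = proj₂ (proj₂ (Unique-++⁻ (a ∷ u′) uq)) (here refl)
        (subst (_∈ v) (swapPoint-involutive a) (subst (swapPoint (swapPoint a) ∈_) refl a∈v))
        where
        head≡ : swapPoint (swapPoint a) ≡ w
        head≡ = proj₁ (∷-injective (trans (sym (cong (map swapPoint) q)) q′))
        a∈v : swapPoint (swapPoint a) ∈ v
        a∈v = subst₂ _∈_ (sym head≡) (sym q) (∈-++⁺ʳ (map swapPoint (a ∷ u′)) (here refl))
    go (inj₁ (w ∷ ws , q , q′)) = ⊥-elim (case-v v refl)
      where
      case-v : ∀ v′ → v ≡ v′ → ⊥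
      case-v [] refl = fixed-head u (subst (λ z → 0 < length z) (++-identityʳ u) pos)
          (trans q (sym (trans q′ (++-identityʳ _))))
      case-v (b ∷ v′) refl = Unique-∉ (subst Unique q′ (proj₁ (Unique-++⁻ u uq)))
        (subst (_∈ (ws ++ map swapPoint v)) (trans (cong swapPoint (sym head≡))
            (swapPoint-involutive w))
          (∈-++⁺ʳ ws (here refl)))
        where
        head≡ : swapPoint w ≡ b
        head≡ = proj₁ (∷-injective (trans (sym (cong (map swapPoint) q′)) q))

  -- Walks are counted backwards: a throw has infinitely many continuations, but only three points
  -- can precede a given one.
  predecessors : Point → List Point
  predecessors ((c , d) , k) = ((c , d) , suc k) ∷ ((c , suc (k + d)) , 0) ∷ ((not c , k) , 0) ∷ []

  ∈-predecessors : ∀ {p q} → Step p q → p ∈ predecessors q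
  ∈-predecessors down = here refl
  ∈-predecessors (throw (keep k e)) = there (here refl)
  ∈-predecessors (throw (turn {c} refl)) = there
      (there (here (cong (λ c → (c , _) , 0) (sym (not-involutive c)))))

  pointsWithin : ℕ → List Point
  pointsWithin n = cartesianProduct (cartesianProduct (true ∷ false ∷ []) (upTo n)) (upTo n)

  ∈-pointsWithin : ∀ {n} p → Within n p → p ∈ pointsWithin n
  ∈-pointsWithin ((c , d) , k) w = ∈-cartesianProduct⁺
    (∈-cartesianProduct⁺ (color c) (∈-upTo⁺ (≤-trans (s≤s (≤-trans (m≤n+m d k) (n≤1+n _))) w)))
    (∈-upTo⁺ (≤-trans (s≤s (≤-trans (m≤m+n k d) (n≤1+n _))) w))
    where
    color : ∀ c → c ∈ (true ∷ false ∷ [])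
    color true = here refl
    color false = there (here refl)

  extendBack : List Point → List (List Point)
  extendBack []      = []
  extendBack (p ∷ h) = map (λ q → q ∷ p ∷ h) (predecessors p)

  walks : ℕ → ℕ → List (List Point)
  walks n zero    = map (_∷ []) (pointsWithin n)
  walks n (suc k) = concatMap extendBack (walks n k)

  ∈-walks : ∀ {n} p ps → Chain Step p ps → All (Within n) (p ∷ ps) → (p ∷ ps) ∈ walks n (length ps)
  ∈-walks p [] c (w ∷ _) = ∈-map⁺ (_∷ []) (∈-pointsWithin p w)
  ∈-walks p (q ∷ ps) (s ∷ c) (_ ∷ w) =
    ∈-concatMap⁺ extendBack (∈-walks q ps c w) (∈-map⁺ (λ r → r ∷ q ∷ ps) (∈-predecessors s))

  length-walks : ∀ n k → length (walks n k) ≤ 2 * n * n * 3 ^ k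
  length-walks n zero = ≤-reflexive (trans (length-map _ (pointsWithin n)) (trans
    (length-cartesianProduct (cartesianProduct (true ∷ false ∷ []) (upTo n)) (upTo n))
    (trans (cong₂ _*_ (trans (length-cartesianProduct (true ∷ false ∷ []) (upTo n))
        (cong (2 *_) (length-upTo n))) (length-upTo n))
      (sym (*-identityʳ (2 * n * n))))))
  length-walks n (suc k) = ≤-trans (grow (walks n k)) (≤-trans (*-monoˡ-≤ 3 (length-walks n k))
    (≤-reflexive (trans (*-assoc (2 * n * n) (3 ^ k) 3) (cong (2 * n * n *_) (*-comm (3 ^ k) 3)))))
    where
    grow : ∀ hs → length (concatMap extendBack hs) ≤ length hs * 3
    grow [] = z≤n
    grow (h ∷ hs) = subst (_≤ suc (length hs) * 3) (sym (length-++ (extendBack h)))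
        (+-mono-≤ (three h) (grow hs))
      where
      three : ∀ h → length (extendBack h) ≤ 3
      three [] = z≤n
      three (p ∷ h) = ≤-refl

  -- Half of such a cycle has ⌊n/2⌋ points, hence one step fewer. The list only has to cover the
  -- symmetric cycles; it contains many non-cycles.
  symmetric : ℕ → List (List State)
  symmetric n = map (λ h → map toState (h ++ map swapPoint h)) (walks n (pred ⌊ n /2⌋))

  ∈-symmetric : ∀ {n ps} → Cycle n ps → All (Within n) ps → Rot ps (map swapPoint ps) → map toState
      ps ∈ symmetric n
  ∈-symmetric {n} {ps} c w r with symmetric-halves (Cycle.distinct c) (Cycle-pos c) r
  ... | [] , refl = ⊥-elim (Cycle.closed c)
  ... | p ∷ h , refl = ∈-map⁺ (λ h → map toState (h ++ map swapPoint h))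
      (subst (λ k → (p ∷ h) ∈ walks n k) half
        (∈-walks p h (proj₁ (Chain-++⁻ h (proj₁ (Cycle.closed c)))) (All.++⁻ˡ (p ∷ h) w)))
    where
    half : length h ≡ pred ⌊ n /2⌋
    half = cong pred (trans (n≡⌊n+n/2⌋ (suc (length h))) (cong ⌊_/2⌋ (trans
      (sym (trans (length-++ (p ∷ h)) (cong (suc (length h) +_) (length-map swapPoint (p ∷ h)))))
          (Cycle.length≡ c))))

  _≟ᴾ_ : DecidableEquality (List Point)
  _≟ᴾ_ = List.≡-dec (Prod.≡-dec (Prod.≡-dec Bool._≟_ ℕ._≟_) ℕ._≟_)

  -- The copy tagged `false` goes to the code of the cycle, the copy tagged `true` to the code of
  -- the swapped cycle. If the two codes give the same points, the cycle is symmetric and the second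
  -- copy goes to `symmetric` instead. The negated clause in `Encodes` records the other case and
  -- separates the two copies of one pattern.
  2C′≤codes+symmetric : ∀ n → C′ n + C′ n ≤ length (codes n) + length (symmetric n)
  2C′≤codes+symmetric n = subst₂ _≤_ (length-coloredPatterns n)
    (trans (length-++ (map inj₁ (codes n))) (cong₂ _+_ (length-map inj₁ (codes n))
        (length-map inj₂ (symmetric n))))
    (injection⇒≤ Encodes (coloredPatterns n) (map inj₁ (codes n) ++ map inj₂ (symmetric n))
      (Unique-coloredPatterns n) total (λ p p′ → injective (∈-coloredPatterns⁻ n p)
          (∈-coloredPatterns⁻ n p′)))
    where
    Encodes : Bool × List State → Code ⊎ List State → Set
    Encodes (false , ss) (inj₁ x) = ∃ λ ps → ss ≡ map toState ps × Rot ps (points x)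
    Encodes (true , ss) (inj₁ x) = ∃ λ ps → ss ≡ map toState ps × Rot (map swapPoint ps) (points x)
        × ¬ Rot ps (points x)
    Encodes (false , ss) (inj₂ ts) = ⊥
    Encodes (true , ss) (inj₂ ts) = ss ≡ ts

    code : ∀ {ps} → Cycle n ps → ∃ λ x → IsCode n x × Rot ps (points x)
    code c with normalise (Cycle.closed c)
    ... | qs , r , nq with encode (Cycle-Rot r c) nq
    ... | x , isC , refl = x , isC , r

    total : ∀ {y} → y ∈ coloredPatterns n → ∃ λ z → z ∈ (map inj₁ (codes n) ++ map inj₂
        (symmetric n)) × Encodes y z
    total {b , ss} p with ∈-patterns⁻ n (∈-coloredPatterns⁻ n p)
    ... | ps , refl , isPattern c w k with code c
    total {false , _} p | ps , refl , isPattern c w k | x , isC , r =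
      inj₁ x , ∈-++⁺ˡ (∈-map⁺ inj₁ (∈-codes⁺ isC)) , ps , refl , r
    total {true , _} p | ps , refl , isPattern c w k | x , isC , r with code (Cycle-swap c)
    ... | x′ , isC′ , r′ with points x ≟ᴾ points x′
    ... | yes e = inj₂ (map toState ps) , ∈-++⁺ʳ (map inj₁ (codes n)) (∈-map⁺ inj₂ (∈-symmetric c w
                    (Rot-trans r (subst (λ z → Rot z _) (sym e) (Rot-sym r′))))) , refl
    ... | no ne = inj₁ x′ , ∈-++⁺ˡ (∈-map⁺ inj₁ (∈-codes⁺ isC′)) , ps , refl , r′ , λ s →
            ne (Normal-unique (Cycle.distinct (Cycle-points x isC)) (Rot-trans (Rot-sym r) s)
                (Normal-points x isC) (Normal-points x′ isC′))

    injective : ∀ {y y′ z} → proj₂ y ∈ patterns n → proj₂ y′ ∈ patterns n → Encodes y z → Encodes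
        y′ z → y ≡ y′
    injective p p′ e e′ with ∈-patterns⁻ n p | ∈-patterns⁻ n p′
    injective {false , _} {false , _} {inj₁ x} p p′ (ps , e , r) (ps′ , e′ , r′) | qs , f ,
        isPattern _ _ k | qs′ , f′ , isPattern _ _ k′
      with map-injective toState-injective (trans (sym e) f) | map-injective toState-injective
          (trans (sym e′) f′)
    ... | refl | refl with Canonical-unique false k k′ (Rot-trans r (Rot-sym r′))
    ... | refl = cong (false ,_) (trans e (sym e′))
    injective {true , _} {true , _} {inj₁ x} p p′ (ps , e , r , _) (ps′ , e′ , r′ , _) | qs , f ,
        isPattern _ _ k | qs′ , f′ , isPattern _ _ k′
      with map-injective toState-injective (trans (sym e) f) | map-injective toState-injective
          (trans (sym e′) f′)
    ... | refl | refl with Canonical-unique false k k′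
        (Rot-recolor⁻ true {qs} {qs′} (Rot-trans r (Rot-sym r′)))
    ... | refl = cong (true ,_) (trans e (sym e′))
    injective {false , _} {true , _} {inj₁ x} p p′ (ps , e , r) (ps′ , e′ , r′ , ne) | qs , f ,
        isPattern _ _ k | qs′ , f′ , isPattern _ _ k′
      with map-injective toState-injective (trans (sym e) f) | map-injective toState-injective
          (trans (sym e′) f′)
    ... | refl | refl with Canonical-unique true k′ k (Rot-trans r′ (Rot-sym r))
    ... | refl = ⊥-elim (ne r)
    injective {true , _} {false , _} {inj₁ x} p p′ (ps , e , r , ne) (ps′ , e′ , r′) | qs , f ,
        isPattern _ _ k | qs′ , f′ , isPattern _ _ k′
      with map-injective toState-injective (trans (sym e) f) | map-injective toState-injective
          (trans (sym e′) f′)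
    ... | refl | refl with Canonical-unique true k k′ (Rot-trans r (Rot-sym r′))
    ... | refl = ⊥-elim (ne r′)
    injective {true , _} {true , _} {inj₂ ts} p p′ refl refl | _ | _ = refl

-- Rational arithmetic: embedding of the naturals, powers of one half, finite sums, the Archimedean
-- property.

module Rationals where
  open import Defs using (fromℕℚ)
  open import Data.Nat as ℕ using (ℕ; zero; suc)
  import Data.Nat.Properties as ℕ
  open import Data.Integer as ℤ using (+_)
  import Data.Integer.Properties as ℤ
  open import Data.Rational
  open import Data.Rational.Properties
  open import Data.Rational.Unnormalised as ℚᵘ using (ℚᵘ; mkℚᵘ; *≡*; *≤*)
  import Data.Rational.Unnormalised.Properties as ℚᵘ
  open import Data.Maybe using (Maybe)
  open import Data.Product using (∃; _,_)
  open import Relation.Nullary.Decidable using (dec⇒maybe)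
  open import Relation.Binary.PropositionalEquality
  import Tactic.RingSolver.Core.AlmostCommutativeRing as ACR
  open import Tactic.RingSolver using (solve-∀)
  open import Level using (0ℓ)

  ℚ-ring : ACR.AlmostCommutativeRing 0ℓ 0ℓ
  ℚ-ring = ACR.fromCommutativeRing +-*-commutativeRing (λ x → dec⇒maybe (0ℚ ≟ x))

  toℚᵘ-ι : ∀ k → toℚᵘ (fromℕℚ k) ℚᵘ.≃ mkℚᵘ (+ k) 0
  toℚᵘ-ι k = toℚᵘ-fromℚᵘ (mkℚᵘ (+ k) 0)

  ι-+ : ∀ a b → fromℕℚ (a ℕ.+ b) ≡ fromℕℚ a + fromℕℚ b
  ι-+ a b = toℚᵘ-injective (ℚᵘ.≃-trans (toℚᵘ-ι (a ℕ.+ b))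
    (ℚᵘ.≃-trans (*≡* (cong (ℤ._* + 1) (trans (ℤ.pos-+ a b)
        (sym (cong₂ ℤ._+_ (ℤ.*-identityʳ (+ a)) (ℤ.*-identityʳ (+ b)))))))
    (ℚᵘ.≃-sym (ℚᵘ.≃-trans (toℚᵘ-homo-+ (fromℕℚ a) (fromℕℚ b)) (ℚᵘ.+-cong (toℚᵘ-ι a) (toℚᵘ-ι b))))))

  ι-* : ∀ a b → fromℕℚ (a ℕ.* b) ≡ fromℕℚ a * fromℕℚ b
  ι-* a b = toℚᵘ-injective (ℚᵘ.≃-trans (toℚᵘ-ι (a ℕ.* b))
    (ℚᵘ.≃-trans (*≡* (cong (ℤ._* + 1) (ℤ.pos-* a b)))
    (ℚᵘ.≃-sym (ℚᵘ.≃-trans (toℚᵘ-homo-* (fromℕℚ a) (fromℕℚ b)) (ℚᵘ.*-cong (toℚᵘ-ι a) (toℚᵘ-ι b))))))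

  ι-mono : ∀ {a b} → a ℕ.≤ b → fromℕℚ a ≤ fromℕℚ b
  ι-mono {a} {b} a≤b = toℚᵘ-cancel-≤ (ℚᵘ.≤-trans (ℚᵘ.≤-reflexive (toℚᵘ-ι a))
    (ℚᵘ.≤-trans (*≤* (ℤ.*-monoʳ-≤-nonNeg (+ 1) (ℤ.+≤+ a≤b)))
        (ℚᵘ.≤-reflexive (ℚᵘ.≃-sym (toℚᵘ-ι b)))))

  0≤ι : ∀ a → 0ℚ ≤ fromℕℚ a
  0≤ι a = ι-mono {0} {a} ℕ.z≤n

  /-*-ι : ∀ i d → ((+ i) / suc d) * fromℕℚ (suc d) ≡ fromℕℚ i
  /-*-ι i d = toℚᵘ-injective (ℚᵘ.≃-trans (toℚᵘ-homo-* ((+ i) / suc d) (fromℕℚ (suc d)))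
    (ℚᵘ.≃-trans (ℚᵘ.*-cong (toℚᵘ-fromℚᵘ (mkℚᵘ (+ i) d)) (toℚᵘ-ι (suc d)))
    (ℚᵘ.≃-trans (*≡* (trans (ℤ.*-identityʳ _) (cong (λ z → + i ℤ.* + z)
        (sym (ℕ.*-identityʳ (suc d))))))
      (ℚᵘ.≃-sym (toℚᵘ-ι i)))))

  *-monoˡ : ∀ {a b c} → 0ℚ ≤ a → b ≤ c → a * b ≤ a * c
  *-monoˡ {a} 0≤a = *-monoˡ-≤-nonNeg a {{nonNegative 0≤a}}

  *-monoʳ : ∀ {a b c} → 0ℚ ≤ a → b ≤ c → b * a ≤ c * a
  *-monoʳ {a} 0≤a = *-monoʳ-≤-nonNeg a {{nonNegative 0≤a}}

  *-nonNeg : ∀ {a b} → 0ℚ ≤ a → 0ℚ ≤ b → 0ℚ ≤ a * b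
  *-nonNeg {a} {b} p r = subst (_≤ a * b) (*-zeroʳ a) (*-monoˡ p r)

  *-mono : ∀ {a b c d} → 0ℚ ≤ a → 0ℚ ≤ d → a ≤ b → c ≤ d → a * c ≤ b * d
  *-mono p r s t = ≤-trans (*-monoˡ p t) (*-monoʳ r s)

  +-nonNeg : ∀ {a b} → 0ℚ ≤ a → 0ℚ ≤ b → 0ℚ ≤ a + b
  +-nonNeg {a} {b} p r = subst (_≤ a + b) (+-identityˡ 0ℚ) (+-mono-≤ p r)

  ≤-by : ∀ {a b} d → 0ℚ ≤ d → b ≡ a + d → a ≤ b
  ≤-by {a} d 0≤d e = subst₂ _≤_ (+-identityʳ a) (sym e) (+-monoʳ-≤ a 0≤d)

  0≤b-a : ∀ {a b} → a ≤ b → 0ℚ ≤ b - a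
  0≤b-a {a} {b} p = subst (_≤ b - a) (+-inverseʳ a) (+-monoˡ-≤ (- a) p)

  -- Normalising by multiplication with this power avoids dividing by 2^n.
  ½^ : ℕ → ℚ
  ½^ zero    = 1ℚ
  ½^ (suc n) = ½ * ½^ n

  0≤½ : 0ℚ ≤ ½
  0≤½ = toℚᵘ-cancel-≤ (*≤* (ℤ.+≤+ ℕ.z≤n))

  0≤½^ : ∀ n → 0ℚ ≤ ½^ n
  0≤½^ zero = 0≤ι 1
  0≤½^ (suc n) = *-nonNeg 0≤½ (0≤½^ n)

  ½^-+ : ∀ a b → ½^ (a ℕ.+ b) ≡ ½^ a * ½^ b
  ½^-+ zero b = sym (*-identityˡ _)
  ½^-+ (suc a) b = trans (cong (½ *_) (½^-+ a b)) (sym (*-assoc ½ (½^ a) (½^ b)))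

  ½^-2^ : ∀ n → ½^ n * fromℕℚ (2 ℕ.^ n) ≡ 1ℚ
  ½^-2^ zero = refl
  ½^-2^ (suc n) = trans (cong (½ * ½^ n *_) (ι-* 2 (2 ℕ.^ n)))
    (trans (arith (½^ n) (fromℕℚ (2 ℕ.^ n))) (½^-2^ n))
    where
    regroup : ∀ h t x y → (h * x) * (t * y) ≡ (h * t) * (x * y)
    regroup = solve-∀ ℚ-ring
    arith : ∀ x y → (½ * x) * (fromℕℚ 2 * y) ≡ x * y
    -- The constants are generalised to variables for the solver; afterwards `½ * fromℕℚ 2` computes
    -- to `1ℚ`. The same device recurs below.
    arith x y = trans (regroup ½ (fromℕℚ 2) x y) (*-identityˡ (x * y))

  sum : (ℕ → ℚ) → ℕ → ℚ
  sum f zero    = 0ℚ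
  sum f (suc n) = sum f n + f n

  sum-mono : ∀ {f g} n → (∀ i → i ℕ.< n → f i ≤ g i) → sum f n ≤ sum g n
  sum-mono zero h = ≤-refl
  sum-mono (suc n) h = +-mono-≤ (sum-mono n (λ i i<n → h i (ℕ.m<n⇒m<1+n i<n))) (h n ℕ.≤-refl)

  sum-cong : ∀ {f g} n → (∀ i → i ℕ.< n → f i ≡ g i) → sum f n ≡ sum g n
  sum-cong zero h = refl
  sum-cong (suc n) h = cong₂ _+_ (sum-cong n (λ i i<n → h i (ℕ.m<n⇒m<1+n i<n))) (h n ℕ.≤-refl)

  sum-*ˡ : ∀ c f n → sum (λ i → c * f i) n ≡ c * sum f n
  sum-*ˡ c f zero = sym (*-zeroʳ c)
  sum-*ˡ c f (suc n) = trans (cong (_+ c * f n) (sum-*ˡ c f n))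
      (sym (*-distribˡ-+ c (sum f n) (f n)))

  sum-+ : ∀ f g n → sum (λ i → f i + g i) n ≡ sum f n + sum g n
  sum-+ f g zero = refl
  sum-+ f g (suc n) = trans (cong (_+ (f n + g n)) (sum-+ f g n)) (arith (sum f n) (sum g n) (f n)
      (g n))
    where
    arith : ∀ a b c d → a + b + (c + d) ≡ (a + c) + (b + d)
    arith = solve-∀ ℚ-ring

  sum-const : ∀ c n → sum (λ _ → c) n ≡ fromℕℚ n * c
  sum-const c zero = sym (*-zeroˡ c)
  sum-const c (suc n) = trans (cong (_+ c) (sum-const c n))
    (trans (arith (fromℕℚ n) c) (cong (_* c) (sym (ι-+ 1 n))))
    where
    arith : ∀ a c → a * c + c ≡ (1ℚ + a) * c
    arith = solve-∀ ℚ-ring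

  sum-split : ∀ f a b → sum f (a ℕ.+ b) ≡ sum f a + sum (λ i → f (a ℕ.+ i)) b
  sum-split f a zero = trans (cong (sum f) (ℕ.+-identityʳ a)) (sym (+-identityʳ _))
  sum-split f a (suc b) = trans (cong (sum f) (ℕ.+-suc a b))
    (trans (cong (_+ f (a ℕ.+ b)) (sum-split f a b)) (+-assoc (sum f a) _ _))

  sum-nonNeg : ∀ {f} n → (∀ i → 0ℚ ≤ f i) → 0ℚ ≤ sum f n
  sum-nonNeg zero h = ≤-refl
  sum-nonNeg (suc n) h = +-nonNeg (sum-nonNeg n h) (h n)

  sum-mono-length : ∀ {f a b} → (∀ i → 0ℚ ≤ f i) → a ℕ.≤ b → sum f a ≤ sum f b
  sum-mono-length {f} {a} h a≤b with ℕ.m≤n⇒∃[o]m+o≡n a≤b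
  ... | o , refl = ≤-by (sum (λ i → f (a ℕ.+ i)) o) (sum-nonNeg o (λ i → h (a ℕ.+ i)))
      (sum-split f a o)

  sum-reverse : ∀ f n → sum (λ i → f (n ℕ.∸ i)) (suc n) ≡ sum f (suc n)
  sum-reverse f zero = refl
  sum-reverse f (suc n) = begin
    sum (λ i → f (suc n ℕ.∸ i)) (suc (suc n))
      ≡⟨ sum-split (λ i → f (suc n ℕ.∸ i)) 1 (suc n) ⟩
    (0ℚ + f (suc n)) + sum (λ i → f (n ℕ.∸ i)) (suc n)
      ≡⟨ cong₂ _+_ (+-identityˡ (f (suc n))) (sum-reverse f n) ⟩
    f (suc n) + sum f (suc n)
      ≡⟨ +-comm (f (suc n)) (sum f (suc n)) ⟩
    sum f (suc (suc n)) ∎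
    where open ≡-Reasoning

  ≤-ι : ∀ C → ∃ λ M → C ≤ fromℕℚ M
  ≤-ι C@(mkℚ n d _) = ℤ.∣ n ∣ , toℚᵘ-cancel-≤ (ℚᵘ.≤-trans (*≤* (begin
      n ℤ.* + 1                  ≡⟨ ℤ.*-identityʳ n ⟩
      n                          ≤⟨ n≤∣n∣ n ⟩
      + ℤ.∣ n ∣                  ≤⟨ ℤ.+≤+ (ℕ.m≤m*n ℤ.∣ n ∣ (suc d)) ⟩
      + (ℤ.∣ n ∣ ℕ.* suc d)      ≡⟨ ℤ.pos-* ℤ.∣ n ∣ (suc d) ⟩
      + ℤ.∣ n ∣ ℤ.* + suc d      ∎)) (ℚᵘ.≤-reflexive (ℚᵘ.≃-sym (toℚᵘ-ι ℤ.∣ n ∣))))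
    where
    open ℤ.≤-Reasoning
    n≤∣n∣ : ∀ n → n ℤ.≤ + ℤ.∣ n ∣
    n≤∣n∣ (+ n) = ℤ.≤-refl
    n≤∣n∣ (ℤ.-[1+ n ]) = ℤ.-≤+

  1≤-multiple : ∀ ε → 0ℚ < ε → ∃ λ k → 1ℚ ≤ ε * fromℕℚ k
  1≤-multiple ε@(mkℚ (+ suc p) d _) _ = suc d , toℚᵘ-cancel-≤ (ℚᵘ.≤-trans (*≤* (ℤ.+≤+ (begin
      1 ℕ.* (suc d ℕ.* 1)        ≡⟨ trans (ℕ.*-identityˡ _) (ℕ.*-identityʳ (suc d)) ⟩
      suc d                      ≤⟨ ℕ.m≤n*m (suc d) (suc p) ⟩
      suc p ℕ.* suc d            ≡⟨ sym (ℕ.*-identityʳ _) ⟩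
      suc p ℕ.* suc d ℕ.* 1      ∎)))
    (ℚᵘ.≤-reflexive (ℚᵘ.≃-sym (ℚᵘ.≃-trans (toℚᵘ-homo-* ε (fromℕℚ (suc d)))
        (ℚᵘ.*-congˡ {mkℚᵘ (+ suc p) d} (toℚᵘ-ι (suc d)))))))
    where open ℕ.≤-Reasoning
  1≤-multiple (mkℚ (+ zero) d _) (*<* (ℤ.+<+ ()))
  1≤-multiple (mkℚ ℤ.-[1+ n ] d _) (*<* ())

  archimedean : ∀ ε → 0ℚ < ε → ∀ C → ∃ λ N → ∀ n → N ℕ.≤ n → C ≤ ε * fromℕℚ n
  archimedean ε 0<ε C with ≤-ι C | 1≤-multiple ε 0<ε
  ... | M , C≤M | k , 1≤εk = k ℕ.* M , λ n N≤n → begin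
    C                              ≤⟨ C≤M ⟩
    fromℕℚ M                       ≡⟨ sym (*-identityˡ _) ⟩
    1ℚ * fromℕℚ M                  ≤⟨ *-monoʳ (0≤ι M) 1≤εk ⟩
    ε * fromℕℚ k * fromℕℚ M        ≡⟨ trans (*-assoc ε _ _) (cong (ε *_) (sym (ι-* k M))) ⟩
    ε * fromℕℚ (k ℕ.* M)           ≤⟨ *-monoˡ (<⇒≤ 0<ε) (ι-mono N≤n) ⟩
    ε * fromℕℚ n                   ∎
    where open ≤-Reasoning

-- The normalised counts b_t(m), their limits q_t, and the convolutions counting codes.

module Asymptotics where
  open import Defs using (fromℕℚ; factor; prodFactors; q; γpartial)
  open Enumeration using (module Dom; module Free; laterCount; number-free)
  open Codes using (codes)
  open ListCounting using (collect; length-cartesianProduct)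
  open Rationals
  open import Data.Nat as ℕ using (ℕ; zero; suc)
  import Data.Nat.Properties as ℕ
  open import Data.List using (List; length; cartesianProduct)
  open import Data.List.Properties using (length-++)
  import Data.Integer as ℤ
  open import Data.Rational
  open import Data.Rational.Properties
  import Data.Rational.Unnormalised as ℚᵘ
  open import Data.Product using (∃; _×_; _,_; proj₁; proj₂)
  open import Relation.Nullary using (Dec; yes; no)
  open import Relation.Binary.PropositionalEquality
  open import Tactic.RingSolver using (solve-∀)
  import Data.Nat.Tactic.RingSolver as ℕ-Solver

  B : ℕ → ℕ → ℚ
  B s m = fromℕℚ (Dom.number s m) * ½^ m

  -- With t = `suc s` these are the coefficients (t + 1)/2^t and (t - 1)/2^t of the recursion for
  -- b_t, except that `V 0` is 1/2 because the empty family admits one insertion.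
  U V : ℕ → ℚ
  U s = ½^ (suc s) * fromℕℚ (suc (suc s))
  V s = ½^ (suc s) * fromℕℚ (laterCount s)

  0≤B : ∀ s m → 0ℚ ≤ B s m
  0≤B s m = *-nonNeg (0≤ι (Dom.number s m)) (0≤½^ m)

  0≤U : ∀ s → 0ℚ ≤ U s
  0≤U s = *-nonNeg (0≤½^ (suc s)) (0≤ι (suc (suc s)))

  0≤V : ∀ s → 0ℚ ≤ V s
  0≤V s = *-nonNeg (0≤½^ (suc s)) (0≤ι (laterCount s))

  B-small : ∀ s m → m ℕ.≤ s → B (suc s) m ≡ 0ℚ
  B-small s m m≤s = trans (cong (λ z → fromℕℚ z * ½^ m) (Dom.number-small s m m≤s)) (*-zeroˡ (½^ m))

  B-rec : ∀ s m → B (suc s) (suc s ℕ.+ m) ≡ U s * B (suc s) m + V s * B s m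
  B-rec s m = begin
    fromℕℚ (Dom.number (suc s) (suc s ℕ.+ m)) * ½^ (suc s ℕ.+ m)
      ≡⟨ cong₂ _*_ (trans (cong fromℕℚ (Dom.number-rec s m))
          (trans (ι-+ (a ℕ.* suc (suc s)) (b ℕ.* laterCount s))
           (cong₂ _+_ (ι-* a (suc (suc s))) (ι-* b (laterCount s))))) (½^-+ (suc s) m) ⟩
    (fromℕℚ a * fromℕℚ (suc (suc s)) + fromℕℚ b * fromℕℚ (laterCount s)) * (½^ (suc s) * ½^ m)
      ≡⟨ arith (fromℕℚ a) (fromℕℚ (suc (suc s))) (fromℕℚ b) (fromℕℚ (laterCount s)) (½^ (suc s))
          (½^ m) ⟩
    U s * B (suc s) m + V s * B s m ∎
    where
    open ≡-Reasoning
    a = Dom.number (suc s) m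
    b = Dom.number s m
    arith : ∀ a x b y h k → (a * x + b * y) * (h * k) ≡ h * x * (a * k) + h * y * (b * k)
    arith = solve-∀ ℚ-ring

  t+2≤2^t : ∀ k → suc (suc (k ℕ.+ 2)) ℕ.≤ 2 ℕ.^ suc (suc k)
  t+2≤2^t zero = ℕ.≤-refl
  t+2≤2^t (suc k) = begin
    suc (suc (suc k ℕ.+ 2))                     ≤⟨ ℕ.m≤m+n _ (suc (k ℕ.+ 2)) ⟩
    suc (suc (suc k ℕ.+ 2)) ℕ.+ suc (k ℕ.+ 2)   ≡⟨ arith k ⟩
    2 ℕ.* suc (suc (k ℕ.+ 2))                   ≤⟨ ℕ.*-monoʳ-≤ 2 (t+2≤2^t k) ⟩
    2 ℕ.^ suc (suc (suc k))                     ∎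
    where
    open ℕ.≤-Reasoning
    arith : ∀ k → suc (suc (suc k ℕ.+ 2)) ℕ.+ suc (k ℕ.+ 2) ≡ 2 ℕ.* suc (suc (k ℕ.+ 2))
    arith = ℕ-Solver.solve-∀

  -- For t = k + 2, `suc (denominator k)` is 2^t - t - 1, in the form used by `factor`.
  denominator : ℕ → ℕ
  denominator k = 2 ℕ.^ suc (suc k) ℕ.∸ (suc (suc k) ℕ.+ 2)

  suc-denominator : ∀ k → suc (denominator k) ℕ.+ suc (suc (suc k)) ≡ 2 ℕ.^ suc (suc k)
  suc-denominator k = trans (arith (denominator k) k) (ℕ.m∸n+n≡m (t+2≤2^t k))
    where
    arith : ∀ d k → suc d ℕ.+ suc (suc (suc k)) ≡ d ℕ.+ suc (suc (k ℕ.+ 2))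
    arith = ℕ-Solver.solve-∀

  q-denominator : ∀ k → q (suc (suc k)) * fromℕℚ (suc (denominator k)) ≡ fromℕℚ (suc k) * q (suc k)
  q-denominator k = begin
    ½ * (p * f) * d       ≡⟨ arith ½ p f d ⟩
    (f * d) * (½ * p)     ≡⟨ cong (_* (½ * p)) (/-*-ι (suc k) (denominator k)) ⟩
    fromℕℚ (suc k) * (½ * p) ∎
    where
    open ≡-Reasoning
    p = prodFactors (suc k)
    f = factor (suc (suc k))
    d = fromℕℚ (suc (denominator k))
    arith : ∀ h p f d → h * (p * f) * d ≡ (f * d) * (h * p)
    arith = solve-∀ ℚ-ring

  -- This explains the product defining q: being a fixed point means (2^t - t - 1) q_t = (t - 1)
  -- q_{t-1}, which is `q-denominator`.
  q-rec : ∀ k → U (suc k) * q (suc (suc k)) + V (suc k) * q (suc k) ≡ q (suc (suc k))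
  q-rec k = begin
    h * a * x + h * b * y        ≡⟨ arith₁ h a x b y ⟩
    h * (a * x + b * y)          ≡⟨ cong (λ z → h * (a * x + z)) (sym (q-denominator k)) ⟩
    h * (a * x + x * d)          ≡⟨ arith₂ h a x d ⟩
    h * (d + a) * x              ≡⟨ cong (λ z → h * z * x)
        (trans (sym (ι-+ (suc (denominator k)) _)) (cong fromℕℚ (suc-denominator k))) ⟩
    h * fromℕℚ (2 ℕ.^ suc (suc k)) * x ≡⟨ trans (cong (_* x) (½^-2^ (suc (suc k)))) (*-identityˡ x)
        ⟩
    x ∎
    where
    open ≡-Reasoning
    h = ½^ (suc (suc k))
    a = fromℕℚ (suc (suc (suc k)))
    b = fromℕℚ (suc k)
    d = fromℕℚ (suc (denominator k))
    x = q (suc (suc k))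
    y = q (suc k)
    arith₁ : ∀ h a x b y → h * a * x + h * b * y ≡ h * (a * x + b * y)
    arith₁ = solve-∀ ℚ-ring
    arith₂ : ∀ h a x d → h * (a * x + x * d) ≡ h * (d + a) * x
    arith₂ = solve-∀ ℚ-ring

  0≤factor : ∀ k → 0ℚ ≤ factor k
  0≤factor k = nonNegative⁻¹ (factor k) {{normalize-nonNeg (k ℕ.∸ 1) (suc (2 ℕ.^ k ℕ.∸ (k ℕ.+ 2)))}}

  0≤q : ∀ t → 0ℚ ≤ q t
  0≤q t = *-nonNeg 0≤½ (go t)
    where
    go : ∀ t → 0ℚ ≤ prodFactors t
    go zero = 0≤ι 1
    go (suc zero) = 0≤ι 1
    go (suc (suc t)) = *-nonNeg (go (suc t)) (0≤factor (suc (suc t)))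

  -- A single run of weight m + 1 is its maximum together with any subset of the m smaller integers,
  -- so there are 2^m of them.
  B-1-suc : ∀ m → B 1 (suc m) ≡ q 1
  B-1-suc m = trans (B-rec 0 m) (go m)
    where
    go : ∀ m → U 0 * B 1 m + V 0 * B 0 m ≡ q 1
    go zero = refl
    go (suc m) = trans (cong₂ (λ a b → U 0 * a + V 0 * b) (B-1-suc m) (*-zeroˡ (½^ (suc m)))) refl

  -- The recursion has nonnegative coefficients and fixed point q, so the bound propagates from the
  -- weights at which B vanishes.
  B≤q : ∀ s m → B (suc s) m ≤ q (suc s)
  B≤q zero zero = 0≤q 1
  B≤q zero (suc m) = ≤-reflexive (B-1-suc m)
  B≤q (suc k) m = go m m ℕ.≤-refl (suc (suc k) ℕ.≤? m)
    where
    open ≤-Reasoning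
    s = suc k
    go : ∀ f m → m ℕ.≤ f → Dec (suc s ℕ.≤ m) → B (suc s) m ≤ q (suc s)
    go f m m≤f (no ¬p) = ≤-trans (≤-reflexive (B-small s m (ℕ.≤-pred (ℕ.≰⇒> ¬p)))) (0≤q (suc s))
    go zero .zero ℕ.z≤n (yes ())
    go (suc f) m m≤f (yes p) = subst (λ z → B (suc s) z ≤ q (suc s)) (ℕ.m+[n∸m]≡n p) (begin
      B (suc s) (suc s ℕ.+ m′)                ≡⟨ B-rec s m′ ⟩
      U s * B (suc s) m′ + V s * B s m′       ≤⟨ +-mono-≤
          (*-monoˡ (0≤U s) (go f m′ small (suc s ℕ.≤? m′))) (*-monoˡ (0≤V s) (B≤q k m′)) ⟩
      U s * q (suc s) + V s * q s             ≡⟨ q-rec k ⟩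
      q (suc s)                               ∎)
      where
      m′ = m ℕ.∸ suc s
      small : m′ ℕ.≤ f
      small = ℕ.≤-trans (ℕ.∸-monoˡ-≤ (suc s) m≤f) (ℕ.m∸n≤m f s)

  deficit : ℕ → ℕ → ℚ
  deficit s m = q s - B s m

  0≤deficit : ∀ s m → 0ℚ ≤ deficit (suc s) m
  0≤deficit s m = 0≤b-a (B≤q s m)

  deficit≤q : ∀ s m → deficit s m ≤ q s
  deficit≤q s m = ≤-by (B s m) (0≤B s m) (arith (q s) (B s m))
    where
    arith : ∀ a b → a ≡ a - b + b
    arith = solve-∀ ℚ-ring

  deficit-rec : ∀ k m → deficit (2 ℕ.+ k) (2 ℕ.+ k ℕ.+ m) ≡ U (suc k) * deficit (2 ℕ.+ k) m + V
      (suc k) * deficit (suc k) m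
  deficit-rec k m = trans (cong₂ _-_ (sym (q-rec k)) (B-rec (suc k) m))
    (arith (U (suc k)) (q (2 ℕ.+ k)) (V (suc k)) (q (suc k)) (B (2 ℕ.+ k) m) (B (suc k) m))
    where
    arith : ∀ u x v y b c → (u * x + v * y) - (u * b + v * c) ≡ u * (x - b) + v * (y - c)
    arith = solve-∀ ℚ-ring

  ¼ : ℚ
  ¼ = ½ * ½

  4ℚ : ℚ
  4ℚ = fromℕℚ 4

  -- (t + 1)/2^t decreases and equals 3/4 at t = 2. At t = 1 it is 1 and gives no contraction, which
  -- is why the deficits of a single run are evaluated exactly in `deficit-summable`.
  U≤¾ : ∀ k → U (suc k) ≤ ¼ * fromℕℚ 3
  U≤¾ zero = ≤-refl
  U≤¾ (suc k) = ≤-trans (begin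
    ½ * h * fromℕℚ (4 ℕ.+ k)                  ≤⟨ *-monoˡ (*-nonNeg 0≤½ (0≤½^ (2 ℕ.+ k)))
        (ι-mono (ℕ.≤-trans (ℕ.m≤m+n (4 ℕ.+ k) (2 ℕ.+ k)) (ℕ.≤-reflexive (twice k)))) ⟩
    ½ * h * fromℕℚ (2 ℕ.* (3 ℕ.+ k))          ≡⟨ cong (½ * h *_) (ι-* 2 (3 ℕ.+ k)) ⟩
    ½ * h * (fromℕℚ 2 * fromℕℚ (3 ℕ.+ k))     ≡⟨ arith ½ h (fromℕℚ 2) (fromℕℚ (3 ℕ.+ k)) ⟩
    (½ * fromℕℚ 2) * (h * fromℕℚ (3 ℕ.+ k))   ≡⟨ *-identityˡ _ ⟩
    h * fromℕℚ (3 ℕ.+ k)                      ∎) (U≤¾ k)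
    where
    open ≤-Reasoning
    h = ½^ (2 ℕ.+ k)
    twice : ∀ k → 4 ℕ.+ k ℕ.+ (2 ℕ.+ k) ≡ 2 ℕ.* (3 ℕ.+ k)
    twice = ℕ-Solver.solve-∀
    arith : ∀ x h t a → x * h * (t * a) ≡ (x * t) * (h * a)
    arith = solve-∀ ℚ-ring

  -- Summing deficit-rec shows Σ ≤ c + U · Σ for the partial sums, hence Σ ≤ 4 c as U ≤ ¾.
  deficit-summable : ∀ s → ∃ λ S → 0ℚ ≤ S × (∀ M → sum (deficit (suc s)) M ≤ S)
  deficit-summable zero = q 1 , 0≤q 1 , bound
    where
    tail : ∀ M → sum (λ i → deficit 1 (1 ℕ.+ i)) M ≡ 0ℚ
    tail zero = refl
    tail (suc M) = trans (cong₂ _+_ (tail M) (trans (cong (λ z → q 1 - z) (B-1-suc M))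
        (+-inverseʳ (q 1)))) (+-identityˡ 0ℚ)
    bound : ∀ M → sum (deficit 1) M ≤ q 1
    bound zero = 0≤q 1
    bound (suc M) = ≤-reflexive (trans (sum-split (deficit 1) 1 M)
        (trans (cong (sum (deficit 1) 1 +_) (tail M)) refl))
  deficit-summable (suc k) = 4ℚ * c , 0≤4c , λ M → go M M ℕ.≤-refl (suc (suc k) ℕ.≤? M)
    where
    S = proj₁ (deficit-summable k)
    0≤S = proj₁ (proj₂ (deficit-summable k))
    hS = proj₂ (proj₂ (deficit-summable k))
    open ≤-Reasoning
    s = suc k
    -- The first `suc s` deficits are out of reach of the recursion and at most q each; `V s * S` is
    -- the share of the families with one run fewer.
    c = fromℕℚ (suc s) * q (suc s) + V s * S
    0≤c : 0ℚ ≤ c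
    0≤c = +-nonNeg (*-nonNeg (0≤ι (suc s)) (0≤q (suc s))) (*-nonNeg (0≤V s) 0≤S)
    0≤4c : 0ℚ ≤ 4ℚ * c
    0≤4c = *-nonNeg (0≤ι 4) 0≤c
    first : sum (deficit (suc s)) (suc s) ≤ fromℕℚ (suc s) * q (suc s)
    first = ≤-trans (sum-mono (suc s) (λ i _ → deficit≤q (suc s) i))
        (≤-reflexive (sum-const (q (suc s)) (suc s)))
    c≤4c : fromℕℚ (suc s) * q (suc s) ≤ 4ℚ * c
    c≤4c = ≤-trans (≤-by (V s * S) (*-nonNeg (0≤V s) 0≤S) refl)
        (≤-trans (≤-reflexive (sym (*-identityˡ c))) (*-monoʳ 0≤c (ι-mono {1} {4} (ℕ.s≤s ℕ.z≤n))))
    go : ∀ f M → M ℕ.≤ f → Dec (suc s ℕ.≤ M) → sum (deficit (suc s)) M ≤ 4ℚ * c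
    go f M M≤f (no ¬p) = ≤-trans (sum-mono-length (0≤deficit s) (ℕ.<⇒≤ (ℕ.≰⇒> ¬p)))
        (≤-trans first c≤4c)
    go zero .zero ℕ.z≤n (yes ())
    go (suc f) M M≤f (yes p) = subst (λ z → sum (deficit (suc s)) z ≤ 4ℚ * c) (ℕ.m+[n∸m]≡n p) (begin
      sum e (suc s ℕ.+ M′)
        ≡⟨ sum-split e (suc s) M′ ⟩
      sum e (suc s) + sum (λ i → e (suc s ℕ.+ i)) M′
        ≡⟨ cong (sum e (suc s) +_) (trans (sum-cong M′ (λ i _ → deficit-rec k i))
             (trans (sum-+ (λ i → U s * e i) (λ i → V s * deficit s i) M′)
               (cong₂ _+_ (sum-*ˡ (U s) e M′) (sum-*ˡ (V s) (deficit s) M′)))) ⟩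
      sum e (suc s) + (U s * sum e M′ + V s * sum (deficit s) M′)
        ≤⟨ +-mono-≤ first (+-mono-≤ (≤-trans (*-monoˡ (0≤U s) (go f M′ small (suc s ℕ.≤? M′)))
            (*-monoʳ 0≤4c (U≤¾ k))) (*-monoˡ (0≤V s) (hS M′))) ⟩
      fromℕℚ (suc s) * q (suc s) + (¼ * fromℕℚ 3 * (4ℚ * c) + V s * S)
        ≡⟨ arith (fromℕℚ (suc s) * q (suc s)) (V s * S) ¼ (fromℕℚ 3) 4ℚ c ⟩
      c + (4ℚ * ¼) * (fromℕℚ 3 * c)
        ≡⟨ arith′ c ⟩
      4ℚ * c ∎)
      where
      e = deficit (suc s)
      M′ = M ℕ.∸ suc s
      small : M′ ℕ.≤ f
      small = ℕ.≤-trans (ℕ.∸-monoˡ-≤ (suc s) M≤f) (ℕ.m∸n≤m f s)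
      arith : ∀ a b x y z c → a + (x * y * (z * c) + b) ≡ (a + b) + (z * x) * (y * c)
      arith = solve-∀ ℚ-ring
      arith′ : ∀ c → c + (4ℚ * ¼) * (fromℕℚ 3 * c) ≡ 4ℚ * c
      arith′ c = trans (cong₂ _+_ (sym (*-identityˡ c)) (*-identityˡ (fromℕℚ 3 * c)))
          (sym (*-distribʳ-+ c 1ℚ (fromℕℚ 3)))

  convolution : ℕ → ℕ → ℚ
  convolution s n = sum (λ m → B s m * B s (n ℕ.∸ m)) (suc n)

  0≤convolution : ∀ s n → 0ℚ ≤ convolution s n
  0≤convolution s n = sum-nonNeg (suc n) (λ i → *-nonNeg (0≤B s i) (0≤B s (n ℕ.∸ i)))

  convolution-upper : ∀ s n → convolution (suc s) n ≤ fromℕℚ (suc n) * (q (suc s) * q (suc s))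
  convolution-upper s n = ≤-trans
    (sum-mono (suc n) (λ i _ → *-mono (0≤B (suc s) i) (0≤q (suc s)) (B≤q s i) (B≤q s (n ℕ.∸ i))))
    (≤-reflexive (sum-const (q (suc s) * q (suc s)) (suc n)))

  defect : ℕ → ℚ
  defect s = q (suc s) * S + q (suc s) * S
    where S = proj₁ (deficit-summable s)

  -- With x = q and factors b, c ≤ x one has x² - bc = x(x - b) + x(x - c) - (x - b)(x - c). The
  -- last product is dropped, and the other two sum to a bound independent of n.
  convolution-lower : ∀ s n → fromℕℚ (suc n) * (q (suc s) * q (suc s)) ≤ convolution (suc s) n +
      defect s
  convolution-lower s n = begin
    fromℕℚ (suc n) * (x * x)
      ≡⟨ sym (sum-const (x * x) (suc n)) ⟩
    sum (λ _ → x * x) (suc n)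
      ≤⟨ sum-mono (suc n) (λ i _ → ≤-by (e i * e (n ℕ.∸ i))
          (*-nonNeg (0≤deficit s i) (0≤deficit s (n ℕ.∸ i)))
           (arith x (B (suc s) i) (B (suc s) (n ℕ.∸ i)))) ⟩
    sum (λ i → B (suc s) i * B (suc s) (n ℕ.∸ i) + (x * e i + x * e (n ℕ.∸ i))) (suc n)
      ≡⟨ trans (sum-+ _ (λ i → x * e i + x * e (n ℕ.∸ i)) (suc n))
           (cong (convolution (suc s) n +_) (trans (sum-+ (λ i → x * e i) (λ i → x * e (n ℕ.∸ i))
               (suc n))
             (cong₂ _+_ (sum-*ˡ x e (suc n)) (trans (sum-*ˡ x (λ i → e (n ℕ.∸ i)) (suc n))
                 (cong (x *_) (sum-reverse e n)))))) ⟩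
    convolution (suc s) n + (x * sum e (suc n) + x * sum e (suc n))
      ≤⟨ +-monoʳ-≤ (convolution (suc s) n) (+-mono-≤ (*-monoˡ (0≤q (suc s)) (hS (suc n)))
          (*-monoˡ (0≤q (suc s)) (hS (suc n)))) ⟩
    convolution (suc s) n + (x * S + x * S) ∎
    where
    open ≤-Reasoning
    S = proj₁ (deficit-summable s)
    hS = proj₂ (proj₂ (deficit-summable s))
    x = q (suc s)
    e = deficit (suc s)
    arith : ∀ x b c → b * c + (x * (x - b) + x * (x - c)) ≡ x * x + (x - b) * (x - c)
    arith = solve-∀ ℚ-ring

  length-collect : {A : Set} (f : ℕ → List A) (n : ℕ) →
    fromℕℚ (length (collect f n)) ≡ sum (λ i → fromℕℚ (length (f i))) n
  length-collect f zero = refl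
  length-collect f (suc n) = trans (cong fromℕℚ (length-++ (collect f n)))
    (trans (ι-+ (length (collect f n)) (length (f n))) (cong (_+ fromℕℚ (length (f n)))
        (length-collect f n)))

  -- The power ½^n splits as ½^m ½^(n-m) over the two families, and `number-free` supplies the
  -- factor `suc s` for the unrestricted one.
  length-codes : ∀ n → fromℕℚ (length (codes n)) * ½^ n ≡ sum (λ s → fromℕℚ (suc s) * convolution
      (suc s) n) n
  length-codes n = begin
    fromℕℚ (length (codes n)) * ½^ n
      ≡⟨ cong (_* ½^ n) (length-collect _ n) ⟩
    sum (λ s → fromℕℚ (length (collect (product s) (suc n)))) n * ½^ n
      ≡⟨ trans (*-comm _ (½^ n)) (sym (sum-*ˡ (½^ n) _ n)) ⟩
    sum (λ s → ½^ n * fromℕℚ (length (collect (product s) (suc n)))) n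
      ≡⟨ sum-cong n (λ s _ → row s) ⟩
    sum (λ s → fromℕℚ (suc s) * convolution (suc s) n) n ∎
    where
    open ≡-Reasoning
    product : ∀ s m → List _
    product s m = cartesianProduct (Dom.families (suc s) m) (Free.families (suc s) (n ℕ.∸ m))
    arith : ∀ h k a c b → h * k * (a * (c * b)) ≡ c * (a * h * (b * k))
    arith = solve-∀ ℚ-ring
    entry : ∀ s m → m ℕ.≤ n → ½^ n * fromℕℚ (length (product s m)) ≡ fromℕℚ (suc s) *
        (B (suc s) m * B (suc s) (n ℕ.∸ m))
    entry s m m≤n = begin
      ½^ n * fromℕℚ (length (product s m))
        ≡⟨ cong₂ _*_ (trans (cong ½^ (sym (ℕ.m+[n∸m]≡n m≤n))) (½^-+ m (n ℕ.∸ m)))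
             (trans (cong fromℕℚ (trans (length-cartesianProduct (Dom.families (suc s) m) _)
                 (cong (Dom.number (suc s) m ℕ.*_) (number-free s (n ℕ.∸ m)))))
               (trans (ι-* (Dom.number (suc s) m) (suc s ℕ.* Dom.number (suc s) (n ℕ.∸ m)))
                 (cong (fromℕℚ (Dom.number (suc s) m) *_)
                     (ι-* (suc s) (Dom.number (suc s) (n ℕ.∸ m)))))) ⟩
      ½^ m * ½^ (n ℕ.∸ m) * (fromℕℚ (Dom.number (suc s) m) *
          (fromℕℚ (suc s) * fromℕℚ (Dom.number (suc s) (n ℕ.∸ m))))
        ≡⟨ arith (½^ m) (½^ (n ℕ.∸ m)) (fromℕℚ (Dom.number (suc s) m)) (fromℕℚ (suc s))
            (fromℕℚ (Dom.number (suc s) (n ℕ.∸ m))) ⟩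
      fromℕℚ (suc s) * (B (suc s) m * B (suc s) (n ℕ.∸ m)) ∎
    row : ∀ s → ½^ n * fromℕℚ (length (collect (product s) (suc n))) ≡ fromℕℚ (suc s) * convolution
        (suc s) n
    row s = begin
      ½^ n * fromℕℚ (length (collect (product s) (suc n)))
        ≡⟨ cong (½^ n *_) (length-collect (product s) (suc n)) ⟩
      ½^ n * sum (λ m → fromℕℚ (length (product s m))) (suc n)
        ≡⟨ sym (sum-*ˡ (½^ n) _ (suc n)) ⟩
      sum (λ m → ½^ n * fromℕℚ (length (product s m))) (suc n)
        ≡⟨ sum-cong (suc n) (λ m m<n → entry s m (ℕ.≤-pred m<n)) ⟩
      sum (λ m → fromℕℚ (suc s) * (B (suc s) m * B (suc s) (n ℕ.∸ m))) (suc n)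
        ≡⟨ sum-*ˡ (fromℕℚ (suc s)) _ (suc n) ⟩
      fromℕℚ (suc s) * convolution (suc s) n ∎

  term : ℕ → ℚ
  term s = fromℕℚ (suc s) * (q (suc s) * q (suc s))

  0≤term : ∀ s → 0ℚ ≤ term s
  0≤term s = *-nonNeg (0≤ι (suc s)) (*-nonNeg (0≤q (suc s)) (0≤q (suc s)))

  G : ℕ → ℚ
  G = sum term

  γpartial-double : ∀ T → γpartial T + γpartial T ≡ G T
  γpartial-double zero = refl
  γpartial-double (suc T) = trans (arith (γpartial T) ½ (term T))
    (cong₂ _+_ (γpartial-double T) (*-identityˡ (term T)))
    where
    arith : ∀ g h t → (g + h * t) + (g + h * t) ≡ (g + g) + (h + h) * t
    arith = solve-∀ ℚ-ring

  codes-upper : ∀ n → fromℕℚ (length (codes n)) * ½^ n ≤ fromℕℚ (suc n) * G n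
  codes-upper n = begin
    fromℕℚ (length (codes n)) * ½^ n                           ≡⟨ length-codes n ⟩
    sum (λ s → fromℕℚ (suc s) * convolution (suc s) n) n       ≤⟨ sum-mono n (λ s _ → bound s) ⟩
    sum (λ s → fromℕℚ (suc n) * term s) n                      ≡⟨ sum-*ˡ (fromℕℚ (suc n)) term n ⟩
    fromℕℚ (suc n) * G n                                       ∎
    where
    open ≤-Reasoning
    arith : ∀ a b c → a * (b * c) ≡ b * (a * c)
    arith = solve-∀ ℚ-ring
    bound : ∀ s → fromℕℚ (suc s) * convolution (suc s) n ≤ fromℕℚ (suc n) * term s
    bound s = ≤-trans (*-monoˡ (0≤ι (suc s)) (convolution-upper s n))
        (≤-reflexive (arith (fromℕℚ (suc s)) (fromℕℚ (suc n)) (q (suc s) * q (suc s))))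

  -- Each defect depends on the number of runs but not on n. Keeping only the first K rows makes
  -- their sum a constant.
  codes-lower : ∀ K → ∃ λ D → ∀ n → K ℕ.≤ n → fromℕℚ n * G K ≤ fromℕℚ (length (codes n)) * ½^ n + D
  codes-lower K = sum (λ s → fromℕℚ (suc s) * defect s) K , λ n K≤n → begin
    fromℕℚ n * G K
      ≤⟨ *-monoʳ (sum-nonNeg K 0≤term) (ι-mono (ℕ.n≤1+n n)) ⟩
    fromℕℚ (suc n) * G K
      ≡⟨ sym (sum-*ˡ (fromℕℚ (suc n)) term K) ⟩
    sum (λ s → fromℕℚ (suc n) * term s) K
      ≤⟨ sum-mono K (λ s _ → bound s n) ⟩
    sum (λ s → fromℕℚ (suc s) * convolution (suc s) n + fromℕℚ (suc s) * defect s) K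
      ≡⟨ sum-+ (λ s → fromℕℚ (suc s) * convolution (suc s) n) _ K ⟩
    sum (λ s → fromℕℚ (suc s) * convolution (suc s) n) K + sum (λ s → fromℕℚ (suc s) * defect s) K
      ≤⟨ +-monoˡ-≤ _ (≤-trans (sum-mono-length (λ s → *-nonNeg (0≤ι (suc s))
          (0≤convolution (suc s) n)) K≤n) (≤-reflexive (sym (length-codes n)))) ⟩
    fromℕℚ (length (codes n)) * ½^ n + sum (λ s → fromℕℚ (suc s) * defect s) K ∎
    where
    open ≤-Reasoning
    arith : ∀ a b c → b * (a * c) ≡ a * (b * c)
    arith = solve-∀ ℚ-ring
    bound : ∀ s n → fromℕℚ (suc n) * term s ≤ fromℕℚ (suc s) * convolution (suc s) n + fromℕℚ
        (suc s) * defect s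
    bound s n = ≤-trans (≤-reflexive (arith (fromℕℚ (suc s)) (fromℕℚ (suc n))
        (q (suc s) * q (suc s))))
      (≤-trans (*-monoˡ (0≤ι (suc s)) (convolution-lower s n))
          (≤-reflexive (*-distribˡ-+ (fromℕℚ (suc s)) _ _)))

  -- For t = k + 3 this is 2(t - 1) ≤ 2^t - t - 1, with equality at t = 3. It makes the ratio of q_t
  -- to q_{t-1} at most one half.
  2t≤denominator : ∀ k → 2 ℕ.* suc (suc k) ℕ.≤ suc (denominator (suc k))
  2t≤denominator k = ℕ.+-cancelʳ-≤ (suc (suc (suc (suc k)))) _ _
    (ℕ.≤-trans (go k) (ℕ.≤-reflexive (sym (suc-denominator (suc k)))))
    where
    open ℕ.≤-Reasoning
    arith : ∀ k → 2 ℕ.* suc (suc (suc k)) ℕ.+ suc (suc (suc (suc (suc k)))) ℕ.+ suc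
        (suc (suc (suc (suc (k ℕ.+ k ℕ.+ k)))))
      ≡ 2 ℕ.* (2 ℕ.* suc (suc k) ℕ.+ suc (suc (suc (suc k))))
    arith = ℕ-Solver.solve-∀
    go : ∀ k → 2 ℕ.* suc (suc k) ℕ.+ suc (suc (suc (suc k))) ℕ.≤ 2 ℕ.^ suc (suc (suc k))
    go zero = ℕ.≤-refl
    go (suc k) = begin
      2 ℕ.* suc (suc (suc k)) ℕ.+ suc (suc (suc (suc (suc k))))  ≤⟨ ℕ.m≤m+n _
          (suc (suc (suc (suc (suc (k ℕ.+ k ℕ.+ k)))))) ⟩
      2 ℕ.* suc (suc (suc k)) ℕ.+ suc (suc (suc (suc (suc k)))) ℕ.+ suc
          (suc (suc (suc (suc (k ℕ.+ k ℕ.+ k)))))  ≡⟨ arith k ⟩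
      2 ℕ.* (2 ℕ.* suc (suc k) ℕ.+ suc (suc (suc (suc k))))      ≤⟨ ℕ.*-monoʳ-≤ 2 (go k) ⟩
      2 ℕ.^ suc (suc (suc (suc k)))                              ∎

  q-halves : ∀ k → q (suc (suc (suc k))) ≤ ½ * q (suc (suc k))
  q-halves k = *-cancelʳ-≤-pos d {{normalize-pos (suc (denominator (suc k))) 1}} (begin
    q (suc (suc (suc k))) * d        ≡⟨ q-denominator (suc k) ⟩
    fromℕℚ (suc (suc k)) * y         ≡⟨ trans (sym (*-identityˡ _))
        (arith ½ (fromℕℚ 2) (fromℕℚ (suc (suc k))) y) ⟩
    ½ * y * (fromℕℚ 2 * fromℕℚ (suc (suc k)))
      ≤⟨ *-monoˡ (*-nonNeg 0≤½ (0≤q (suc (suc k))))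
          (≤-trans (≤-reflexive (sym (ι-* 2 (suc (suc k))))) (ι-mono (2t≤denominator k))) ⟩
    ½ * y * d ∎)
    where
    open ≤-Reasoning
    d = fromℕℚ (suc (denominator (suc k)))
    y = q (suc (suc k))
    arith : ∀ h t a y → (h * t) * (a * y) ≡ h * y * (t * a)
    arith = solve-∀ ℚ-ring

  -- q₁ = q₂ = 1/2, as the factor at 2 is 1. The halving starts only at t = 3, and the bound is
  -- attained at t = 2.
  q≤½^ : ∀ s → q (suc s) ≤ ½^ s
  q≤½^ zero = toℚᵘ-cancel-≤ (ℚᵘ.*≤* (ℤ.+≤+ (ℕ.s≤s ℕ.z≤n)))
  q≤½^ (suc zero) = ≤-refl
  q≤½^ (suc (suc k)) = ≤-trans (q-halves k) (*-monoˡ 0≤½ (q≤½^ (suc k)))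

  1+s≤2^s : ∀ s → suc s ℕ.≤ 2 ℕ.^ s
  1+s≤2^s zero = ℕ.≤-refl
  1+s≤2^s (suc s) = begin
    suc (suc s)              ≤⟨ ℕ.s≤s (ℕ.m≤m+n (suc s) s) ⟩
    suc (suc s ℕ.+ s)        ≡⟨ arith s ⟩
    2 ℕ.* suc s              ≤⟨ ℕ.*-monoʳ-≤ 2 (1+s≤2^s s) ⟩
    2 ℕ.^ suc s              ∎
    where
    open ℕ.≤-Reasoning
    arith : ∀ s → suc (suc s ℕ.+ s) ≡ 2 ℕ.* suc s
    arith = ℕ-Solver.solve-∀

  -- One of the two factors of geometric decay pays for `suc s`, which is at most 2^s.
  term≤½^ : ∀ s → term s ≤ ½^ s
  term≤½^ s = begin
    fromℕℚ (suc s) * (q (suc s) * q (suc s))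
      ≤⟨ *-mono (0≤ι (suc s)) (*-nonNeg (0≤½^ s) (0≤½^ s)) (ι-mono (1+s≤2^s s))
          (*-mono (0≤q (suc s)) (0≤½^ s) (q≤½^ s) (q≤½^ s)) ⟩
    fromℕℚ (2 ℕ.^ s) * (½^ s * ½^ s)
      ≡⟨ arith (fromℕℚ (2 ℕ.^ s)) (½^ s) ⟩
    (½^ s * fromℕℚ (2 ℕ.^ s)) * ½^ s
      ≡⟨ trans (cong (_* ½^ s) (½^-2^ s)) (*-identityˡ (½^ s)) ⟩
    ½^ s ∎
    where
    open ≤-Reasoning
    arith : ∀ a h → a * (h * h) ≡ (h * a) * h
    arith = solve-∀ ℚ-ring

  G-tail : ∀ {K n} → K ℕ.≤ n → G n ≤ G K + fromℕℚ 2 * ½^ K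
  G-tail {K} {n} K≤n = ≤-trans (≤-reflexive (trans (cong G (sym (ℕ.m+[n∸m]≡n K≤n)))
      (sum-split term K (n ℕ.∸ K))))
    (+-monoʳ-≤ (G K) (≤-trans (≤-by (fromℕℚ 2 * ½^ (K ℕ.+ (n ℕ.∸ K)))
        (*-nonNeg (0≤ι 2) (0≤½^ (K ℕ.+ (n ℕ.∸ K)))) refl) (go (n ℕ.∸ K))))
    where
    open ≤-Reasoning
    arith : ∀ a t d → a + t + d * t ≡ a + t * (1ℚ + d)
    arith = solve-∀ ℚ-ring
    -- The geometric tail that remains is carried on the left, so that the induction closes: ½^j + 2
    -- ½^(j+1) = 2 ½^j.
    go : ∀ o → sum (λ i → term (K ℕ.+ i)) o + fromℕℚ 2 * ½^ (K ℕ.+ o) ≤ fromℕℚ 2 * ½^ K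
    go zero = ≤-reflexive (trans (+-identityˡ _) (cong (λ z → fromℕℚ 2 * ½^ z) (ℕ.+-identityʳ K)))
    go (suc o) = begin
      x + term (K ℕ.+ o) + fromℕℚ 2 * ½^ (K ℕ.+ suc o)
        ≤⟨ +-monoˡ-≤ _ (+-monoʳ-≤ x (term≤½^ (K ℕ.+ o))) ⟩
      x + h + fromℕℚ 2 * ½^ (K ℕ.+ suc o)
        ≡⟨ cong (x + h +_) (trans (cong (λ z → fromℕℚ 2 * ½^ z) (ℕ.+-suc K o))
            (trans (sym (*-assoc (fromℕℚ 2) ½ h)) refl)) ⟩
      x + h + 1ℚ * h
        ≡⟨ trans (+-assoc x h (1ℚ * h)) (cong (x +_) (double h)) ⟩
      x + fromℕℚ 2 * h
        ≤⟨ go o ⟩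
      fromℕℚ 2 * ½^ K ∎
      where
      x = sum (λ i → term (K ℕ.+ i)) o
      h = ½^ (K ℕ.+ o)
      double : ∀ h → h + 1ℚ * h ≡ fromℕℚ 2 * h
      double h = trans (cong (_+ 1ℚ * h) (sym (*-identityˡ h))) (sym (*-distribʳ-+ h 1ℚ 1ℚ))

-- Bounds for twice the density and passage to the limit.

module Density where
  open import Defs
  open Codes using (codes)
  open Orbits using (symmetric; length-walks; walks; codes≤2C′; 2C′≤codes+symmetric)
  open Rationals
  open Asymptotics
  open import Data.Nat as ℕ using (ℕ; zero; suc; pred; ⌊_/2⌋)
  import Data.Nat.Properties as ℕ
  open import Data.List using (length)
  open import Data.List.Properties using (length-map)
  open import Data.Rational
  open import Data.Rational.Properties
  open import Data.Product using (Σ; ∃; _,_; proj₁; proj₂)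
  open import Data.Sum using (inj₁; inj₂)
  open import Relation.Binary.PropositionalEquality
  open import Tactic.RingSolver using (solve-∀)
  import Data.Nat.Tactic.RingSolver as ℕ-Solver

  -- The polynomial p(j) = j² + 6 j + 21 is chosen so that 3 p(j + 1) ≤ 4 p(j).
  quadratic-bound : ∀ j → (j ℕ.* j ℕ.+ 6 ℕ.* j ℕ.+ 21) ℕ.* 3 ℕ.^ j ℕ.≤ 21 ℕ.* 4 ℕ.^ j
  quadratic-bound zero = ℕ.≤-refl
  quadratic-bound (suc j) = begin
    (suc j ℕ.* suc j ℕ.+ 6 ℕ.* suc j ℕ.+ 21) ℕ.* (3 ℕ.* 3 ℕ.^ j)   ≤⟨ ℕ.m≤m+n _
        (j ℕ.* j ℕ.* 3 ℕ.^ j) ⟩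
    (suc j ℕ.* suc j ℕ.+ 6 ℕ.* suc j ℕ.+ 21) ℕ.* (3 ℕ.* 3 ℕ.^ j) ℕ.+ j ℕ.* j ℕ.* 3 ℕ.^ j
        ≡⟨ arith j (3 ℕ.^ j) ⟩
    4 ℕ.* ((j ℕ.* j ℕ.+ 6 ℕ.* j ℕ.+ 21) ℕ.* 3 ℕ.^ j)               ≤⟨ ℕ.*-monoʳ-≤ 4
        (quadratic-bound j) ⟩
    4 ℕ.* (21 ℕ.* 4 ℕ.^ j)                                         ≡⟨ arith′ (4 ℕ.^ j) ⟩
    21 ℕ.* (4 ℕ.* 4 ℕ.^ j)                                         ∎
    where
    open ℕ.≤-Reasoning
    arith : ∀ j x → (suc j ℕ.* suc j ℕ.+ 6 ℕ.* suc j ℕ.+ 21) ℕ.* (3 ℕ.* x) ℕ.+ j ℕ.* j ℕ.* x ≡ 4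
        ℕ.* ((j ℕ.* j ℕ.+ 6 ℕ.* j ℕ.+ 21) ℕ.* x)
    arith = ℕ-Solver.solve-∀
    arith′ : ∀ x → 4 ℕ.* (21 ℕ.* x) ≡ 21 ℕ.* (4 ℕ.* x)
    arith′ = ℕ-Solver.solve-∀

  -- With j + 1 points in a half cycle, n ≤ 2j + 3, and 2(2j + 3)² ≤ 8 p(j) for the polynomial p
  -- above. The constant is 8 · 21, and 4^j ≤ 2^n.
  length-symmetric : ∀ n → length (symmetric n) ℕ.≤ 168 ℕ.* 2 ℕ.^ n
  length-symmetric n = begin
    length (symmetric n)                                  ≡⟨ length-map _ (walks n j) ⟩
    length (walks n j)                                    ≤⟨ length-walks n j ⟩
    2 ℕ.* n ℕ.* n ℕ.* 3 ℕ.^ j                             ≤⟨ ℕ.*-monoˡ-≤ (3 ℕ.^ j)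
        (ℕ.*-mono-≤ (ℕ.*-monoʳ-≤ 2 n≤2j+3) n≤2j+3) ⟩
    2 ℕ.* (2 ℕ.* j ℕ.+ 3) ℕ.* (2 ℕ.* j ℕ.+ 3) ℕ.* 3 ℕ.^ j
        ≤⟨ ℕ.m≤m+n _ ((24 ℕ.* j ℕ.+ 150) ℕ.* 3 ℕ.^ j) ⟩
    2 ℕ.* (2 ℕ.* j ℕ.+ 3) ℕ.* (2 ℕ.* j ℕ.+ 3) ℕ.* 3 ℕ.^ j ℕ.+ (24 ℕ.* j ℕ.+ 150) ℕ.* 3 ℕ.^ j
        ≡⟨ arith j (3 ℕ.^ j) ⟩
    8 ℕ.* ((j ℕ.* j ℕ.+ 6 ℕ.* j ℕ.+ 21) ℕ.* 3 ℕ.^ j)      ≤⟨ ℕ.*-monoʳ-≤ 8 (quadratic-bound j) ⟩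
    8 ℕ.* (21 ℕ.* 4 ℕ.^ j)                                ≡⟨ arith′ (4 ℕ.^ j) ⟩
    168 ℕ.* 4 ℕ.^ j                                       ≡⟨ cong (168 ℕ.*_) (ℕ.^-*-assoc 2 2 j) ⟩
    168 ℕ.* 2 ℕ.^ (2 ℕ.* j)                               ≤⟨ ℕ.*-monoʳ-≤ 168
        (ℕ.^-monoʳ-≤ 2 (2j≤n n)) ⟩
    168 ℕ.* 2 ℕ.^ n                                       ∎
    where
    open ℕ.≤-Reasoning
    j = pred ⌊ n /2⌋
    n≤2j+3 : n ℕ.≤ 2 ℕ.* j ℕ.+ 3
    n≤2j+3 = go n
      where
      step : ∀ k → 2 ℕ.+ (2 ℕ.* k ℕ.+ 3) ≡ 2 ℕ.* suc k ℕ.+ 3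
      step = ℕ-Solver.solve-∀
      go : ∀ n → n ℕ.≤ 2 ℕ.* pred ⌊ n /2⌋ ℕ.+ 3
      go zero = ℕ.z≤n
      go (suc zero) = ℕ.s≤s ℕ.z≤n
      go (suc (suc zero)) = ℕ.s≤s (ℕ.s≤s ℕ.z≤n)
      go (suc (suc (suc zero))) = ℕ.≤-refl
      go (suc (suc n@(suc (suc _)))) = ℕ.≤-trans (ℕ.s≤s (ℕ.s≤s (go n)))
          (ℕ.≤-reflexive (step (pred ⌊ n /2⌋)))
    2j≤n : ∀ n → 2 ℕ.* pred ⌊ n /2⌋ ℕ.≤ n
    2j≤n n = ℕ.≤-trans (ℕ.*-monoʳ-≤ 2 (ℕ.pred[n]≤n {⌊ n /2⌋}))
      (ℕ.≤-trans (ℕ.+-monoʳ-≤ ⌊ n /2⌋ (ℕ.≤-trans (ℕ.≤-reflexive (ℕ.+-identityʳ ⌊ n /2⌋))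
          (ℕ.⌊n/2⌋≤⌈n/2⌉ n)))
        (ℕ.≤-reflexive (ℕ.⌊n/2⌋+⌈n/2⌉≡n n)))
    arith : ∀ j x → 2 ℕ.* (2 ℕ.* j ℕ.+ 3) ℕ.* (2 ℕ.* j ℕ.+ 3) ℕ.* x ℕ.+ (24 ℕ.* j ℕ.+ 150) ℕ.* x ≡
        8 ℕ.* ((j ℕ.* j ℕ.+ 6 ℕ.* j ℕ.+ 21) ℕ.* x)
    arith = ℕ-Solver.solve-∀
    arith′ : ∀ x → 8 ℕ.* (21 ℕ.* x) ≡ 168 ℕ.* x
    arith′ = ℕ-Solver.solve-∀

  density : ℕ → ℚ
  density n = fromℕℚ (C′ n) * ½^ n

  G≤2 : ∀ n → G n ≤ fromℕℚ 2
  G≤2 n = G-tail {0} {n} ℕ.z≤n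

  -- The constant is 168 from the symmetric cycles plus 2, a bound for the one extra `G n` in
  -- `suc n` times `G n`.
  density-upper : ∀ n → density n + density n ≤ fromℕℚ n * G n + fromℕℚ 170
  density-upper n = begin
    fromℕℚ c * h + fromℕℚ c * h                       ≡⟨ sym (*-distribʳ-+ h (fromℕℚ c) (fromℕℚ c))
        ⟩
    (fromℕℚ c + fromℕℚ c) * h                         ≡⟨ cong (_* h) (sym (ι-+ c c)) ⟩
    fromℕℚ (c ℕ.+ c) * h
      ≤⟨ *-monoʳ (0≤½^ n) (ι-mono (ℕ.≤-trans (2C′≤codes+symmetric n)
          (ℕ.+-monoʳ-≤ e (length-symmetric n)))) ⟩
    fromℕℚ (e ℕ.+ 168 ℕ.* 2 ℕ.^ n) * h
      ≡⟨ cong (_* h) (trans (ι-+ e (168 ℕ.* 2 ℕ.^ n)) (cong (fromℕℚ e +_) (ι-* 168 (2 ℕ.^ n)))) ⟩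
    (fromℕℚ e + fromℕℚ 168 * fromℕℚ (2 ℕ.^ n)) * h    ≡⟨ arith (fromℕℚ e) (fromℕℚ 168)
        (fromℕℚ (2 ℕ.^ n)) h ⟩
    fromℕℚ e * h + fromℕℚ 168 * (h * fromℕℚ (2 ℕ.^ n))
      ≤⟨ +-mono-≤ (codes-upper n) (≤-reflexive (trans (cong (fromℕℚ 168 *_) (½^-2^ n))
          (*-identityʳ (fromℕℚ 168)))) ⟩
    fromℕℚ (suc n) * G n + fromℕℚ 168
      ≡⟨ cong (λ z → z * G n + fromℕℚ 168) (ι-+ 1 n) ⟩
    (1ℚ + fromℕℚ n) * G n + fromℕℚ 168                ≡⟨ arith′ (fromℕℚ n) (G n) (fromℕℚ 168) ⟩
    fromℕℚ n * G n + (G n + fromℕℚ 168)               ≤⟨ +-monoʳ-≤ (fromℕℚ n * G n)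
        (≤-trans (+-monoˡ-≤ (fromℕℚ 168) (G≤2 n)) (≤-reflexive (sym (ι-+ 2 168)))) ⟩
    fromℕℚ n * G n + fromℕℚ 170                       ∎
    where
    open ≤-Reasoning
    c = C′ n
    e = length (codes n)
    h = ½^ n
    arith : ∀ e a t h → (e + a * t) * h ≡ e * h + a * (h * t)
    arith = solve-∀ ℚ-ring
    arith′ : ∀ x g a → (1ℚ + x) * g + a ≡ x * g + (g + a)
    arith′ = solve-∀ ℚ-ring

  ι-double : ∀ {e c h} → 0ℚ ≤ h → e ℕ.≤ c ℕ.+ c → fromℕℚ e * h ≤ fromℕℚ c * h + fromℕℚ c * h
  ι-double {e} {c} {h} 0≤h e≤2c = begin
    fromℕℚ e * h                   ≤⟨ *-monoʳ 0≤h (ι-mono {e} {c ℕ.+ c} e≤2c) ⟩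
    fromℕℚ (c ℕ.+ c) * h           ≡⟨ cong (_* h) (ι-+ c c) ⟩
    (fromℕℚ c + fromℕℚ c) * h      ≡⟨ *-distribʳ-+ h (fromℕℚ c) (fromℕℚ c) ⟩
    fromℕℚ c * h + fromℕℚ c * h    ∎
    where open ≤-Reasoning

  density-lower : ∀ K → ∃ λ D → ∀ n → K ℕ.≤ n → fromℕℚ n * G K ≤ density n + density n + D
  density-lower K = proj₁ (codes-lower K) , λ n K≤n → ≤-trans (proj₂ (codes-lower K) n K≤n)
    (+-monoˡ-≤ (proj₁ (codes-lower K)) (ι-double {length (codes n)} {C′ n} {½^ n} (0≤½^ n)
        (codes≤2C′ n)))

  ½^-small : ∀ ε → 0ℚ < ε → ∃ λ K → fromℕℚ 2 * ½^ K ≤ ε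
  ½^-small ε 0<ε with archimedean ε 0<ε (fromℕℚ 2)
  ... | K , h = K , (begin
    fromℕℚ 2 * ½^ K                          ≤⟨ *-monoʳ (0≤½^ K) (h K ℕ.≤-refl) ⟩
    ε * fromℕℚ K * ½^ K                      ≤⟨ *-monoʳ (0≤½^ K)
        (*-monoˡ (<⇒≤ 0<ε) (ι-mono (ℕ.≤-trans (ℕ.n≤1+n K) (1+s≤2^s K)))) ⟩
    ε * fromℕℚ (2 ℕ.^ K) * ½^ K              ≡⟨ trans (*-assoc ε _ _)
        (cong (ε *_) (trans (*-comm _ (½^ K)) (½^-2^ K))) ⟩
    ε * 1ℚ                                   ≡⟨ *-identityʳ ε ⟩
    ε                                        ∎)
    where open ≤-Reasoning

  halve : ∀ {a b} → a + a ≤ b + b → a ≤ b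
  halve {a} {b} p = subst₂ _≤_ (half a) (half b) (*-monoˡ 0≤½ p)
    where
    distrib : ∀ h a → h * (a + a) ≡ (h + h) * a
    distrib = solve-∀ ℚ-ring
    half : ∀ a → ½ * (a + a) ≡ a
    half a = trans (distrib ½ a) (*-identityˡ a)

  -- Everything is doubled because the estimates concern twice the density and `γpartial-double`
  -- evaluates twice γ.
  ∣∣-halve : ∀ {x y z} → x + x ≤ (y + y) + (z + z) → y + y ≤ (x + x) + (z + z) → ∣ x - y ∣ ≤ z
  ∣∣-halve {x} {y} {z} upper lower with ∣p∣≡p∨∣p∣≡-p (x - y)
  ... | inj₁ e = subst (_≤ z) (sym e) (halve (≤-by _ (0≤b-a upper) (arith x y z)))
    where
    arith : ∀ x y z → z + z ≡ ((x - y) + (x - y)) + (((y + y) + (z + z)) - (x + x))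
    arith = solve-∀ ℚ-ring
  ... | inj₂ e = subst (_≤ z) (sym e) (halve (≤-by _ (0≤b-a lower) (arith x y z)))
    where
    arith : ∀ x y z → z + z ≡ ((- (x - y)) + (- (x - y))) + (((x + x) + (z + z)) - (y + y))
    arith = solve-∀ ℚ-ring

  -- Here x is the density and i is n. In each direction the doubled error is at most 2 ε i: one ε i
  -- for comparing partial sums of G, one for the additive constant `A` or `D`.
  estimate : ∀ {x i γ gT gn gK ε A D} → 0ℚ ≤ i → γ + γ ≡ gT →
    x + x ≤ i * gn + A → i * gK ≤ x + x + D → gn ≤ gT + ε → gT ≤ gK + ε →
    A ≤ ε * i → D ≤ ε * i → ∣ x - γ * i ∣ ≤ ε * i
  estimate {x} {i} {γ} {gT} {gn} {gK} {ε} {A} {D} 0≤i 2γ≡gT upper lower gn≤gT gT≤gK A≤z D≤z =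
      ∣∣-halve {x} {γ * i} {ε * i}
    (begin
      x + x                  ≤⟨ upper ⟩
      i * gn + A             ≤⟨ +-mono-≤ (*-monoˡ 0≤i gn≤gT) A≤z ⟩
      i * (gT + ε) + ε * i   ≡⟨ cong (λ g → i * (g + ε) + ε * i) (sym 2γ≡gT) ⟩
      i * (γ + γ + ε) + ε * i ≡⟨ arith i γ ε ⟩
      (γ * i + γ * i) + (ε * i + ε * i) ∎)
    (begin
      γ * i + γ * i          ≡⟨ sym (*-distribʳ-+ i γ γ) ⟩
      (γ + γ) * i            ≡⟨ cong (_* i) 2γ≡gT ⟩
      gT * i                 ≤⟨ *-monoʳ 0≤i gT≤gK ⟩
      (gK + ε) * i           ≡⟨ arith′ i gK ε ⟩
      i * gK + ε * i         ≤⟨ +-monoˡ-≤ (ε * i) lower ⟩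
      x + x + D + ε * i      ≤⟨ +-monoˡ-≤ (ε * i) (+-monoʳ-≤ (x + x) D≤z) ⟩
      x + x + ε * i + ε * i  ≡⟨ +-assoc (x + x) (ε * i) (ε * i) ⟩
      (x + x) + (ε * i + ε * i) ∎)
    where
    open ≤-Reasoning
    arith : ∀ i γ ε → i * (γ + γ + ε) + ε * i ≡ (γ * i + γ * i) + (ε * i + ε * i)
    arith = solve-∀ ℚ-ring
    arith′ : ∀ i g ε → (g + ε) * i ≡ i * g + ε * i
    arith′ = solve-∀ ℚ-ring

  ∣∣-rescale : ∀ {c h p γ i ε m} → 0ℚ ≤ p → h * p ≡ 1ℚ → m ≡ i * p →
    ∣ c * h - γ * i ∣ ≤ ε * i → ∣ c - γ * m ∣ ≤ ε * m
  ∣∣-rescale {c} {h} {p} {γ} {i} {ε} {m} 0≤p hp≡1 refl bound = begin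
    ∣ c - γ * (i * p) ∣            ≡⟨ cong (λ c → ∣ c - γ * (i * p) ∣)
        (trans (sym (*-identityʳ c)) (cong (c *_) (sym hp≡1))) ⟩
    ∣ c * (h * p) - γ * (i * p) ∣  ≡⟨ cong ∣_∣ (arith c h p γ i) ⟩
    ∣ (c * h - γ * i) * p ∣        ≡⟨ ∣p*q∣≡∣p∣*∣q∣ (c * h - γ * i) p ⟩
    ∣ c * h - γ * i ∣ * ∣ p ∣      ≡⟨ cong (∣ c * h - γ * i ∣ *_) (0≤p⇒∣p∣≡p 0≤p) ⟩
    ∣ c * h - γ * i ∣ * p          ≤⟨ *-monoʳ 0≤p bound ⟩
    ε * i * p                      ≡⟨ *-assoc ε i p ⟩
    ε * (i * p)                    ∎
    where
    open ≤-Reasoning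
    arith : ∀ c h p γ i → c * (h * p) - γ * (i * p) ≡ (c * h - γ * i) * p
    arith = solve-∀ ℚ-ring

  G-close : ∀ {K ε} → fromℕℚ 2 * ½^ K ≤ ε → ∀ {m n} → K ℕ.≤ m → K ℕ.≤ n → G n ≤ G m + ε
  G-close {K} small {m} {n} K≤m K≤n =
    ≤-trans (G-tail {K} {n} K≤n) (+-mono-≤ (sum-mono-length {term} {K} {m} 0≤term K≤m) small)

-- The asymptotic formula.

open import Defs
open import Data.Nat using (ℕ)
open import Data.Product using (Σ)
open import Data.Rational using (ℚ; 0ℚ; _<_; _≤_; _-_; _*_; ∣_∣)
import Data.Nat
import Data.Nat as ℕ
import Data.Nat.Properties as ℕ
open import Data.Product using (_,_; proj₁; proj₂)
open import Data.Rational using (_+_)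
open Rationals using (½^; 0≤ι; ι-*; ½^-2^; archimedean)
open Asymptotics using (G; γpartial-double)
open Density

theorem4p5 : (ε : ℚ) → 0ℚ < ε →
    Σ ℕ (λ N → Σ ℕ (λ T₀ → (n T : ℕ) → N Data.Nat.≤ n → T₀ Data.Nat.≤ T →
    ∣ fromℕℚ (C′ n) - γpartial T * n2ⁿ n ∣ ≤ ε * n2ⁿ n))
-- `K` makes the tail of `G` smaller than ε and serves both as the bound on `T` and as the
-- truncation in the lower bound. `D` depends on `K`, so `N₂` can only be chosen after it.
theorem4p5 ε 0<ε = K ℕ.⊔ (N₁ ℕ.⊔ N₂) , K , main
  where
  K = proj₁ (½^-small ε 0<ε)
  D = proj₁ (density-lower K)
  N₁ = proj₁ (archimedean ε 0<ε (fromℕℚ 170))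
  N₂ = proj₁ (archimedean ε 0<ε D)
  main : ∀ n T → K ℕ.⊔ (N₁ ℕ.⊔ N₂) ℕ.≤ n → K ℕ.≤ T → ∣ fromℕℚ (C′ n) - γpartial T * n2ⁿ n ∣ ≤ ε *
      n2ⁿ n
  main n T N≤n K≤T = ∣∣-rescale {fromℕℚ (C′ n)} {½^ n} {fromℕℚ (2 ℕ.^ n)} {γpartial T} {fromℕℚ n}
      {ε} {n2ⁿ n}
    (0≤ι (2 ℕ.^ n)) (½^-2^ n) (ι-* n (2 ℕ.^ n))
    (estimate {density n} {fromℕℚ n} {γpartial T} {G T} {G n} {G K} {ε} {fromℕℚ 170} {D}
      (0≤ι n) (γpartial-double T) (density-upper n) (proj₂ (density-lower K) n K≤n)
      (close {T} {n} K≤T K≤n) (close {K} {T} ℕ.≤-refl K≤T)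
      (proj₂ (archimedean ε 0<ε (fromℕℚ 170)) n (ℕ.≤-trans (ℕ.m≤m⊔n N₁ N₂) N₁⊔N₂≤n))
      (proj₂ (archimedean ε 0<ε D) n (ℕ.≤-trans (ℕ.m≤n⊔m N₁ N₂) N₁⊔N₂≤n)))
    where
    close : ∀ {m n} → K ℕ.≤ m → K ℕ.≤ n → G n ≤ G m + ε
    close = G-close {K} {ε} (proj₂ (½^-small ε 0<ε))
    K≤n : K ℕ.≤ n
    K≤n = ℕ.≤-trans (ℕ.m≤m⊔n K (N₁ ℕ.⊔ N₂)) N≤n
    N₁⊔N₂≤n : N₁ ℕ.⊔ N₂ ℕ.≤ n
    N₁⊔N₂≤n = ℕ.≤-trans (ℕ.m≤n⊔m K (N₁ ℕ.⊔ N₂)) N≤n
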